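{- Let $q$ be a prime power and $n\geq 2$ an integer. Let $\mathcal{S}=(\mathcal{P},\mathcal{B},I)$ be the incidence structure defined in the context: its points are the orbits on $AG(n,q^2)$ of the group $N$; its blocks are the images under the group $G$ of the affine Hermitian variety $X_1^{q+1}+\cdots+X_{n-1}^{q+1}+X_n^q+X_n=0$ together with the images under $G$ of the affine Hermitian cones $\sum_{s=1}^{n-1}(\omega_s^qX_s^q-\omega_sX_s)=0$, with $(\omega_1,\ldots,\omega_{n-1})\in\mathrm{GF}(q^2)^{n-1}\setminus\{(0,\ldots,0)\}$; incidence is inclusion. Then $\mathcal{S}$ is an affine $$2-\left(q^{2n-1},\,q^{2(n-1)},\,q^{2n-3}+\cdots+q+1\right)$$ design and, for $q>2$, $\mathcal{S}$ is isomorphic to the point--hyperplane design of the affine space $AG(2n-1,q)$.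
   Context: Setting: $PG(n,q^2)$ has homogeneous coordinates $(X_1,\ldots,X_{n+1})$; $AG(n,q^2)$ is the complement of the hyperplane $X_{n+1}=0$, and an affine point $(x_1,\ldots,x_n)$ corresponds to $(x_1,\ldots,x_n,1)$. The trace is $\mathrm{tr}:\mathrm{GF}(q^2)\to\mathrm{GF}(q)$, $\mathrm{tr}(x)=x^q+x$, and $T_0=\{t\in\mathrm{GF}(q^2):\mathrm{tr}(t)=0\}$. The group $G$: it is the subgroup of $PGL(n+1,q^2)$ consisting of all collineations given, up to a non-zero scalar, by $(X'_1,\ldots,X'_{n+1})=(X_1,\ldots,X_{n+1})D^{ -1}$, where, for arbitrary $i_1,\ldots,i_n,j_1,\ldots,j_{n-1}\in\mathrm{GF}(q^2)$, $$D=\begin{pmatrix}1&0&\cdots&0&j_1&0\\0&1&\cdots&0&j_2&0\\\vdots&&\ddots&&\vdots&\vdots\\0&0&\cdots&1&j_{n-1}&0\\0&0&\cdots&0&1&0\\i_1&i_2&\cdots&i_{n-1}&i_n&1\end{pmatrix}.$$ $G$ fixes the hyperplane $X_{n+1}=0$ and so acts on $AG(n,q^2)$. The group $N$: it is the subgroup of $G$ given by $i_1=\cdots=i_{n-1}=j_1=\cdots=j_{n-1}=0$ and $i_n\in T_0$. The $N$-orbit of an affine point is $N(x_1,\ldots,x_n)=\{(x_1,\ldots,x_{n-1},x_n+r):r\in T_0\}$. The incidence structure $\mathcal{S}=(\mathcal{P},\mathcal{B},I)$: $\mathcal{P}$ is the set of all $N$-orbits of points of $AG(n,q^2)$. $\mathcal{B}$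 is the set of all subsets of $AG(n,q^2)$ that are images, under elements of $G$, either of the set of affine points satisfying $X_1^{q+1}+\cdots+X_{n-1}^{q+1}+X_n^q+X_n=0$, or of the set of affine points satisfying $\sum_{s=1}^{n-1}(\omega_s^qX_s^q-\omega_sX_s)=0$ for some non-zero $(\omega_1,\ldots,\omega_{n-1})\in\mathrm{GF}(q^2)^{n-1}$. A point $P\in\mathcal{P}$ is incident with a block $B\in\mathcal{B}$ if and only if $P\subseteq B$. Designs: a $2-(v,k,\lambda)$ design has $v$ points, every block is incident with exactly $k$ points, and any two distinct points are incident with exactly $\lambda$ common blocks. Two blocks are parallel if they are equal or disjoint (as sets of points). The $2$-design $\mathcal{S}$ is affine if (a) any two distinct blocks are either disjoint or have a constant number of points in common (here $q^{2n-3}$), and (b) for each point $P$ and each block $B$ with $P\notin B$ there is a unique block $B'$ with $P\in B'$ and $B\cap B'=\emptyset$. The point--hyperplane design of $AG(m,q)$ has the points of $AG(m,q)$ as points and the affine hyperplanes as blocks. -}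

module Defs where

open import Level using (Level; _⊔_) renaming (suc to lsuc)
open import Algebra.Bundles using (CommutativeRing)
open import Algebra.Morphism.Structures using (module RingMorphisms)
open import Data.Bool.Base using (if_then_else_)
open import Data.Fin.Base using (Fin; zero; suc)
open import Data.Fin.Properties using (_≟_)
open import Data.Nat.Base as ℕ using (ℕ; zero; suc)
open import Data.Nat.Primality using (Prime)
open import Data.Product using (∃; ∃₂; _×_; _,_; proj₁)
open import Data.Sum using (_⊎_)
open import Data.Vec.Functional using (Vector; head; tail; init; last)
import Data.Vec.Functional.Relation.Binary.Equality.Setoid as VecEq
open import Function.Base using (_∘_)
open import Function.Bundles using (Inverse; _⇔_)
open import Relation.Binary.Bundles using (Setoid)
import Relation.Binary.Construct.On as On
import Relation.Binary.PropositionalEquality as ≡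
open import Relation.Nullary using (¬_; does)
open import Relation.Unary using (Pred; _⊆_; _≐_)
open import Relation.Unary.Relation.Binary.Equality using (≐-setoid)

private
  variable
    a b c c′ h ℓ ℓ′ p p′ r : Level

PrimePower : ℕ → Set
PrimePower q = ∃₂ λ π e → Prime π × 1 ℕ.≤ e × q ≡.≡ π ℕ.^ e

HasCardinality : Setoid a ℓ → ℕ → Set (a ⊔ ℓ)
HasCardinality S n = Inverse S (≡.setoid (Fin n))

subsetoid : (S : Setoid a ℓ) → Pred (Setoid.Carrier S) p → Setoid (a ⊔ p) ℓ
subsetoid S P = On.setoid {B = ∃ P} S proj₁

-- A set of subsets of A, given by a predicate on subsets; two members are
-- equal when they have the same elements.
subsets : {A : Set a} → Pred (Pred A ℓ) r → Setoid (a ⊔ lsuc ℓ ⊔ r) (a ⊔ ℓ)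
subsets {ℓ = ℓ} {A = A} 𝓕 = subsetoid (≐-setoid A ℓ) 𝓕

record IncidenceStructure p p′ b ℓ h : Set (lsuc (p ⊔ p′ ⊔ b ⊔ ℓ ⊔ h)) where
  infix 4 _I_
  field
    points : Setoid p p′
    blocks : Setoid b ℓ

  open Setoid points public using () renaming (Carrier to Point; _≈_ to _≈ₚ_)
  open Setoid blocks public using () renaming (Carrier to Block; _≈_ to _≈ᵦ_)

  field
    _I_    : Point → Block → Set h
    I-resp : ∀ {P P′ B B′} → P ≈ₚ P′ → B ≈ᵦ B′ → P I B → P′ I B′

  Disjoint : Block → Block → Set (p ⊔ h)
  Disjoint B B′ = ∀ P → ¬ (P I B × P I B′)

module _ (𝓓 : IncidenceStructure p p′ b ℓ h) where
  open IncidenceStructure 𝓓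

  record Is2Design (v k λ′ : ℕ) : Set (p ⊔ p′ ⊔ b ⊔ ℓ ⊔ h) where
    field
      ∣points∣ : HasCardinality points v
      ∣block∣  : ∀ B → HasCardinality (subsetoid points (_I B)) k
      ∣join∣   : ∀ P Q → ¬ P ≈ₚ Q →
                 HasCardinality (subsetoid blocks (λ B → P I B × Q I B)) λ′

  record IsAffine (μ : ℕ) : Set (p ⊔ p′ ⊔ b ⊔ ℓ ⊔ h) where
    field
      meet     : ∀ B B′ → ¬ B ≈ᵦ B′ →
                 Disjoint B B′ ⊎
                 HasCardinality (subsetoid points (λ P → P I B × P I B′)) μ
      parallel : ∀ P B → ¬ P I B →
                 ∃ λ B′ → (P I B′ × Disjoint B B′) ×
                          (∀ B″ → P I B″ × Disjoint B B″ → B″ ≈ᵦ B′)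

infix 4 _≅_

record _≅_ {p₁ p₁′ b₁ ℓ₁ h₁ p₂ p₂′ b₂ ℓ₂ h₂ : Level}
           (𝓓 : IncidenceStructure p₁ p₁′ b₁ ℓ₁ h₁)
           (𝓔 : IncidenceStructure p₂ p₂′ b₂ ℓ₂ h₂)
           : Set (p₁ ⊔ p₁′ ⊔ b₁ ⊔ ℓ₁ ⊔ h₁ ⊔ p₂ ⊔ p₂′ ⊔ b₂ ⊔ ℓ₂ ⊔ h₂) where
  private
    module 𝓓 = IncidenceStructure 𝓓
    module 𝓔 = IncidenceStructure 𝓔
  field
    onPoints  : Inverse 𝓓.points 𝓔.points
    onBlocks  : Inverse 𝓓.blocks 𝓔.blocks
    incidence : ∀ P B →
                P 𝓓.I B ⇔ Inverse.to onPoints P 𝓔.I Inverse.to onBlocks B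

-- A discrete field. For a finite carrier equality is decidable, so the
-- separate apartness relation of HeytingField would carry no information.
record Field c ℓ : Set (lsuc (c ⊔ ℓ)) where
  field
    commutativeRing : CommutativeRing c ℓ

  open CommutativeRing commutativeRing public

  field
    0≉1     : ¬ 0# ≈ 1#
    inverse : ∀ x → ¬ x ≈ 0# → ∃ λ y → x * y ≈ 1#

HasOrder : Field c ℓ → ℕ → Set (c ⊔ ℓ)
HasOrder F n = HasCardinality (Field.setoid F) n

-- Realises K as a subfield of F; used for GF(q) ⊂ GF(q²).
record _↪_ (K : Field c′ ℓ′) (F : Field c ℓ) : Set (c ⊔ ℓ ⊔ c′ ⊔ ℓ′) where
  private
    module K = Field K
    module F = Field F
  open RingMorphisms K.rawRing F.rawRing using (IsRingMonomorphism)
  field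
    ι                  : K.Carrier → F.Carrier
    isRingMonomorphism : IsRingMonomorphism ι

infixl 5 _∷ʳ_

_∷ʳ_ : {A : Set a} {n : ℕ} → Vector A n → A → Vector A (suc n)
_∷ʳ_ {n = zero}  xs x _       = x
_∷ʳ_ {n = suc n} xs x zero    = head xs
_∷ʳ_ {n = suc n} xs x (suc k) = (tail xs ∷ʳ x) k

module LinearAlgebra (F : Field c ℓ) where
  open Field F public
  open import Algebra.Properties.Semiring.Exp semiring public using (_^_)
  open import Algebra.Properties.Semiring.Sum semiring public using (sum)
  open VecEq setoid public using (_≋_; ≋-setoid)

  Matrix : ℕ → ℕ → Set c
  Matrix m n = Vector (Vector Carrier n) m

  𝟎 : {n : ℕ} → Vector Carrier n
  𝟎 _ = 0#

  𝟏 : {n : ℕ} → Matrix n n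
  𝟏 k l = if does (k ≟ l) then 1# else 0#

  infix 4 _∼_ _InverseOf_
  infixl 7 _·_ _⊗_

  _·_ : {m n : ℕ} → Vector Carrier m → Matrix m n → Vector Carrier n
  (X · M) l = sum λ k → X k * M k l

  _⊗_ : {m n o : ℕ} → Matrix m n → Matrix n o → Matrix m o
  (M ⊗ M′) k = M k · M′

  _InverseOf_ : {n : ℕ} → Matrix n n → Matrix n n → Set ℓ
  M InverseOf D = (∀ k → (M ⊗ D) k ≋ 𝟏 k) × (∀ k → (D ⊗ M) k ≋ 𝟏 k)

  -- Equality of homogeneous coordinates, up to a non-zero scalar.
  _∼_ : {n : ℕ} → Vector Carrier n → Vector Carrier n → Set (c ⊔ ℓ)
  X ∼ Y = ∃ λ ρ → ¬ ρ ≈ 0# × (λ k → ρ * X k) ≋ Y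

module _ (K : Field c ℓ) (d : ℕ) where
  open LinearAlgebra K

  IsHyperplane : Pred (Pred (Vector Carrier d) ℓ) (c ⊔ ℓ)
  IsHyperplane H = ∃₂ λ α β → ¬ α ≋ 𝟎 × H ≐ (λ x → sum (λ k → α k * x k) ≈ β)

  AGDesign : IncidenceStructure c ℓ (c ⊔ lsuc ℓ) (c ⊔ ℓ) ℓ
  AGDesign = record
    { points = ≋-setoid d
    ; blocks = subsets IsHyperplane
    ; _I_    = λ x H → proj₁ H x
    ; I-resp = λ {x} {x′} {H} {H′} → resp {x} {x′} {H} {H′}
    }
    where
    resp : {x x′ : Vector Carrier d} {H H′ : ∃ IsHyperplane} →
           x ≋ x′ → proj₁ H ≐ proj₁ H′ → proj₁ H x → proj₁ H′ x′
    resp {H = _ , α , β , _ , H⊆ , ⊆H} x≋x′ (H⊆H′ , _) x∈H =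
      H⊆H′ (⊆H (trans (sym (sum-cong-≋ λ k → *-congˡ (x≋x′ k))) (H⊆ x∈H)))
      where open import Algebra.Properties.Semiring.Sum semiring using (sum-cong-≋)

-- F plays the role of GF(q²).  The dimension is n = suc m, so that a point
-- x : Vector Carrier n splits as init x = (x₁,…,xₙ₋₁) and last x = xₙ.
module Construction (q : ℕ) (F : Field c ℓ) (m : ℕ) where
  open LinearAlgebra F

  n : ℕ
  n = suc m

  tr : Carrier → Carrier
  tr x = x ^ q + x

  T₀ : Pred Carrier ℓ
  T₀ t = tr t ≈ 0#

  AG : Set c
  AG = Vector Carrier n

  homogeneous : AG → Vector Carrier (suc n)
  homogeneous x = x ∷ʳ 1#

  -- The arguments are (i₁,…,iₙ) and (j₁,…,jₙ₋₁); vectors extended by _∷ʳ_ are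
  -- the rows, and then the list of rows itself is extended by _∷ʳ_.
  D : Vector Carrier n → Vector Carrier m → Matrix (suc n) (suc n)
  D i j = (λ k → 𝟏 k ∷ʳ j k ∷ʳ 0#)
       ∷ʳ       (𝟎   ∷ʳ 1#  ∷ʳ 0#)
       ∷ʳ       (i          ∷ʳ 1#)

  record G : Set (c ⊔ ℓ) where
    field
      i         : Vector Carrier n
      j         : Vector Carrier m
      D⁻¹       : Matrix (suc n) (suc n)
      isInverse : D⁻¹ InverseOf D i j

  N : Pred G ℓ
  N g = init i ≋ 𝟎 × j ≋ 𝟎 × T₀ (last i)
    where open G g

  -- g sends the affine point x to the affine point y.
  _∶_↦_ : G → AG → AG → Set (c ⊔ ℓ)
  g ∶ x ↦ y = homogeneous y ∼ homogeneous x · G.D⁻¹ g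

  image : {r : Level} → G → Pred AG r → Pred AG (c ⊔ ℓ ⊔ r)
  image g A y = ∃ λ x → A x × g ∶ x ↦ y

  N-orbit : AG → Pred AG (c ⊔ ℓ)
  N-orbit x y = ∃ λ g → N g × g ∶ x ↦ y

  Hermitian : Pred AG ℓ
  Hermitian x = sum (λ s → init x s ^ suc q) + (last x ^ q + last x) ≈ 0#

  Cone : Vector Carrier m → Pred AG ℓ
  Cone ω x = sum (λ s → ω s ^ q * init x s ^ q - ω s * init x s) ≈ 0#

  IsPoint : Pred (Pred AG (c ⊔ ℓ)) (c ⊔ ℓ)
  IsPoint P = ∃ λ x → P ≐ N-orbit x

  IsBlock : Pred (Pred AG (c ⊔ ℓ)) (c ⊔ ℓ)
  IsBlock B = ∃ λ g → B ≐ image g Hermitian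
                    ⊎ ∃ λ ω → ¬ ω ≋ 𝟎 × B ≐ image g (Cone ω)

  𝒮 : IncidenceStructure (lsuc (c ⊔ ℓ)) (c ⊔ ℓ) (lsuc (c ⊔ ℓ)) (c ⊔ ℓ) (c ⊔ ℓ)
  𝒮 = record
    { points = subsets IsPoint
    ; blocks = subsets IsBlock
    ; _I_    = λ P B → proj₁ P ⊆ proj₁ B
    ; I-resp = λ (_ , P′⊆P) (B⊆B′ , _) P⊆B → B⊆B′ ∘ P⊆B ∘ P′⊆P
    }

open Construction public using (𝒮)

{-# OPTIONS --safe #-}

-- Write n = m + 1 and h(x) = Σ xₛ^(q+1) + tr xₙ, the sum being over s ≤ m.  An
-- element of N fixes x₁,…,xₘ and moves xₙ by an element of trace zero, so an
-- N-orbit is determined by x₁,…,xₘ and h(x).  Choose θ outside the subfield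
-- GF(q) fixed by x ↦ x^q; then xₛ is determined by tr xₛ and tr (θ xₛ), and
-- (h(x), tr xₛ, tr (θ xₛ)) identifies the points of 𝒮 with GF(q)^(2n-1).
-- Expanding h along G, the images of the Hermitian variety become the equations
-- h(x) + tr (a · x) = β, and those of the cones tr (c · x) = β with c ≠ 0.  Every
-- GF(q)-linear functional of x₁,…,xₘ is some tr (c · x), so these are exactly
-- the hyperplanes of AG(2n-1, q).  The parameters of 𝒮 are then those of the
-- point-hyperplane design, where they follow from elimination of one coordinate.
module Submission where

open import Defs
open import Level using (Level; _⊔_)
open import Algebra.Bundles using (CommutativeMonoid; CommutativeRing; CommutativeSemiring)
open import Algebra.Morphism.Structures using (module RingMorphisms)
open import Data.Fin.Base using (Fin; zero; suc; toℕ; fromℕ; inject₁; punchIn; punchOut; combine; remQuot; splitAt; join; _↑ˡ_; _↑ʳ_)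
import Data.Fin.Permutation as Perm
import Data.Fin.Properties as Fin
open import Data.Fin.Relation.Unary.Top using (view; ‵fromℕ; ‵inject₁)
open import Data.List.Base as List using (upTo)
import Data.List.Properties as List
open import Data.Nat.Base as ℕ using (ℕ; zero; suc; _≤_; _<_; z≤n; s≤s)
open import Data.Nat.Combinatorics using (_C_; nCn≡1; nCk+nC[k+1]≡[n+1]C[k+1])
open import Data.Nat.Divisibility using (_∣_; divides; ∣⇒≤)
import Data.Nat.ListAction as ListAction
import Data.Nat.ListAction.Properties as ListAction
open import Data.Nat.Primality using (Prime; euclidsLemma; ¬prime[0]; prime⇒nonTrivial; prime⇒nonZero)
import Data.Nat.Properties as ℕ
open import Data.Nat.Solver using (module +-*-Solver)
open import Data.Product using (∃; ∃₂; _×_; _,_; proj₁; proj₂)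
open import Data.Product.Relation.Binary.Pointwise.NonDependent using (×-setoid)
open import Data.Sum using (_⊎_; inj₁; inj₂; [_,_]′)
open import Data.Sum.Relation.Binary.Pointwise using (⊎-setoid; inj₁; inj₂)
import Data.Vec.Base as Vec
open import Data.Vec.Functional using (Vector; head; tail; init; last; removeAt; insertAt; _∷_; _++_)
open import Data.Vec.Functional.Properties using (insertAt-lookup; removeAt-insertAt; lookup-++ˡ; lookup-++ʳ)
import Data.Vec.Functional.Relation.Binary.Equality.Setoid as VecEq
open import Function.Base using (_∘_; case_of_)
open import Function.Bundles using (Inverse; _⇔_; mk⇔; Equivalence)
open import Function.Construct.Composition using () renaming (inverse to _∘ᵢ_; equivalence to infixr 4 _⨾_)
open import Function.Construct.Symmetry using () renaming (inverse to symᵢ)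
open import Relation.Binary.Bundles using (Setoid)
import Relation.Binary.Construct.On as On
open import Relation.Binary.Definitions using (_Respects_; tri<; tri≈; tri>) renaming (Decidable to Decidable₂)
open import Relation.Binary.PropositionalEquality as ≡ using (_≡_; _≢_)
open import Relation.Nullary using (¬_; yes; no; contradiction)
open import Relation.Nullary.Decidable using (map′; dec-true; dec-false)
open import Relation.Unary using (Pred; Decidable; _≐_; _⊆_)
open import Relation.Unary.Properties using (≐-refl)

-- The quadratic term is what has to disappear. Under the translations and shears in G the sum of
-- norms and the trace of the last coordinate change by the trace of a linear form and a constant,
-- because the two mixed terms of a norm are conjugate; so h keeps its quadratic part and can serve
-- as a single affine coordinate. An element of G acts through the inverse of D, hence the image of
-- a set is its preimage under the affine map induced by D itself. The cones are given by z̄ - z =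
-- 0, which is not a trace; multiplication by δ = θ - θ̄, which conjugation negates, turns it into
-- tr (δz) = 0. The parameters are claimed without reference to a subfield, so GF(q) is built inside
-- F as the fixed field of x ↦ x^q. Counting roots of X^q - X only bounds its size from above; the
-- exact size comes from the bijection x ↦ (tr x, tr (θx)), which yields its square. The same root
-- count shows that any embedded K of order q has the fixed field as its image, so one construction
-- serves the parameters and the isomorphism.

private
  variable
    a b c c′ ℓ ℓ′ ℓ₁ ℓ₂ p r : Level
    p₁ p₁′ b₁ h₁ p₂ p₂′ b₂ h₂ : Level

-- Cardinalities of setoids

module _ (S : Setoid a ℓ₁) (T : Setoid b ℓ₂) where
  private
    module S = Setoid S
    module T = Setoid T

  mkInverse : (to : S.Carrier → T.Carrier) (from : T.Carrier → S.Carrier) →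
              (∀ {x y} → x S.≈ y → to x T.≈ to y) →
              (∀ {x y} → x T.≈ y → from x S.≈ from y) →
              (∀ y → to (from y) T.≈ y) → (∀ x → from (to x) S.≈ x) →
              Inverse S T
  mkInverse to from to-cong from-cong invˡ invʳ = record
    { to        = to
    ; from      = from
    ; to-cong   = to-cong
    ; from-cong = from-cong
    ; inverse   = (λ y≈ → T.trans (to-cong y≈) (invˡ _))
                , (λ x≈ → S.trans (from-cong x≈) (invʳ _))
    }

  restrict : {P : Pred S.Carrier p} {Q : Pred T.Carrier r} (i : Inverse S T) →
             Q Respects T._≈_ → (∀ x → P x ⇔ Q (Inverse.to i x)) →
             Inverse (subsetoid S P) (subsetoid T Q)
  restrict i resp P⇔Q = record
    { to        = λ (x , px) → to x , Equivalence.to (P⇔Q x) px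
    ; from      = λ (y , qy) → from y ,
                    Equivalence.from (P⇔Q (from y)) (resp (T.sym (strictlyInverseˡ y)) qy)
    ; to-cong   = to-cong
    ; from-cong = from-cong
    ; inverse   = (λ y≈ → inverseˡ y≈) , (λ x≈ → inverseʳ x≈)
    }
    where open Inverse i

HasCardinality-≅ : {S : Setoid a ℓ₁} {T : Setoid b ℓ₂} {n : ℕ} →
                   Inverse S T → HasCardinality T n → HasCardinality S n
HasCardinality-≅ = _∘ᵢ_

HasCardinality-unique : {S : Setoid a ℓ} {m n : ℕ} →
                        HasCardinality S m → HasCardinality S n → m ≡ n
HasCardinality-unique i j = Perm.↔⇒≡ (symᵢ i ∘ᵢ j)

module _ {S : Setoid a ℓ} {n : ℕ} (card : HasCardinality S n) where
  open Setoid S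
  open Inverse card

  HasCardinality⇒≟ : Decidable₂ _≈_
  HasCardinality⇒≟ x y =
    map′ (λ eq → trans (sym (strictlyInverseʳ x)) (inverseʳ eq)) to-cong (to x Fin.≟ to y)

module _ {S : Setoid a ℓ₁} {T : Setoid b ℓ₂} where

  HasCardinality-× : {m n : ℕ} → HasCardinality S m → HasCardinality T n →
                     HasCardinality (×-setoid S T) (m ℕ.* n)
  HasCardinality-× {m} {n} i j = mkInverse (×-setoid S T) (≡.setoid _)
    (λ (x , y) → combine (i.to x) (j.to y))
    (λ k → i.from (proj₁ (remQuot {m} n k)) , j.from (proj₂ (remQuot {m} n k)))
    (λ (x≈ , y≈) → ≡.cong₂ combine (i.to-cong x≈) (j.to-cong y≈))
    (λ { ≡.refl → Setoid.refl S , Setoid.refl T })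
    (λ k → ≡.trans (≡.cong₂ combine (i.strictlyInverseˡ _) (j.strictlyInverseˡ _))
                   (Fin.combine-remQuot {m} n k))
    (λ (x , y) → let eq = Fin.remQuot-combine (i.to x) (j.to y) in
       i.inverseʳ (≡.cong proj₁ eq) , j.inverseʳ (≡.cong proj₂ eq))
    where
    module i = Inverse i
    module j = Inverse j

module _ (S : Setoid a ℓ) where
  open Setoid S
  open VecEq S using (≋-setoid)

  HasCardinality-Vector : {q : ℕ} → HasCardinality S q →
                          ∀ d → HasCardinality (≋-setoid d) (q ℕ.^ d)
  HasCardinality-Vector card zero = mkInverse (≋-setoid 0) (≡.setoid _)
    (λ _ → zero) (λ _ ()) (λ _ → ≡.refl) (λ _ ()) (λ { zero → ≡.refl }) (λ _ ())
  HasCardinality-Vector card (suc d) = HasCardinality-≅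
    (mkInverse (≋-setoid (suc d)) (×-setoid S (≋-setoid d))
      (λ v → head v , tail v) (λ (x , v) → x ∷ v)
      (λ v≋ → v≋ zero , v≋ ∘ suc) (λ { (x≈ , v≋) zero → x≈ ; (x≈ , v≋) (suc k) → v≋ k })
      (λ _ → refl , λ _ → refl) (λ { _ zero → refl ; _ (suc k) → refl }))
    (HasCardinality-× card (HasCardinality-Vector card d))

subsetoid-× : {S : Setoid a ℓ₁} {P : Pred (Setoid.Carrier S) p} {Q : Pred (Setoid.Carrier S) r} →
              Inverse (subsetoid S (λ x → P x × Q x)) (subsetoid (subsetoid S P) (Q ∘ proj₁))
subsetoid-× {S = S} = mkInverse _ _ (λ (x , px , qx) → (x , px) , qx) (λ ((x , px) , qx) → x , px , qx)
  (λ eq → eq) (λ eq → eq) (λ _ → Setoid.refl S) (λ _ → Setoid.refl S)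

≐-restrict : {S : Setoid a ℓ₁} {P : Pred (Setoid.Carrier S) p} {Q : Pred (Setoid.Carrier S) r} →
             P ≐ Q → Inverse (subsetoid S P) (subsetoid S Q)
≐-restrict {S = S} (P⊆Q , Q⊆P) = mkInverse _ _ (λ (x , px) → x , P⊆Q px) (λ (x , qx) → x , Q⊆P qx)
  (λ eq → eq) (λ eq → eq) (λ _ → Setoid.refl S) (λ _ → Setoid.refl S)

Fin-subset : {n : ℕ} {P : Pred (Fin n) p} → Decidable P →
             ∃ (HasCardinality (subsetoid (≡.setoid (Fin n)) P))
Fin-subset {n = zero} P? = 0 , mkInverse _ (≡.setoid _) (λ ()) (λ ()) (λ { {() , _} }) (λ { {()} }) (λ ()) (λ ())
Fin-subset {n = suc n} {P} P? with P? zero | Fin-subset {P = P ∘ suc} (P? ∘ suc)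
... | yes p₀ | s , i = suc s , mkInverse _ (≡.setoid _)
  (λ { (zero , _) → zero ; (suc k , pk) → suc (i.to (k , pk)) })
  (λ { zero → zero , p₀ ; (suc l) → suc (proj₁ (i.from l)) , proj₂ (i.from l) })
  (λ { {zero , _} {zero , _} _ → ≡.refl
     ; {suc j , _} {suc k , _} eq → ≡.cong suc (i.to-cong (Fin.suc-injective eq)) })
  (λ { ≡.refl → ≡.refl })
  (λ { zero → ≡.refl ; (suc l) → ≡.cong suc (i.strictlyInverseˡ l) })
  (λ { (zero , _) → ≡.refl ; (suc k , pk) → ≡.cong suc (i.strictlyInverseʳ (k , pk)) })
  where module i = Inverse i
... | no ¬p₀ | s , i = s , mkInverse _ (≡.setoid _)
  (λ { (zero , p₀) → contradiction p₀ ¬p₀ ; (suc k , pk) → i.to (k , pk) })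
  (λ l → suc (proj₁ (i.from l)) , proj₂ (i.from l))
  (λ { {zero , p₀} _ → contradiction p₀ ¬p₀
     ; {suc j , _} {zero , p₀} _ → contradiction p₀ ¬p₀
     ; {suc j , _} {suc k , _} eq → i.to-cong (Fin.suc-injective eq) })
  (λ { ≡.refl → ≡.refl })
  (λ l → i.strictlyInverseˡ l)
  (λ { (zero , p₀) → contradiction p₀ ¬p₀ ; (suc k , pk) → ≡.cong suc (i.strictlyInverseʳ (k , pk)) })
  where module i = Inverse i

-- The size is left existential: for the fixed field it is identified afterwards, by comparing two
-- cardinalities of the same setoid.
HasCardinality-subset : {S : Setoid a ℓ} {n : ℕ} → HasCardinality S n →
                        {P : Pred (Setoid.Carrier S) p} → P Respects Setoid._≈_ S →
                        Decidable P → ∃ (HasCardinality (subsetoid S P))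
HasCardinality-subset {S = S} card {P} resp P? = s ,
  HasCardinality-≅ (symᵢ (restrict _ S (symᵢ card) resp λ x → record
    { to = λ z → z ; from = λ z → z ; to-cong = λ { ≡.refl → ≡.refl } ; from-cong = λ { ≡.refl → ≡.refl } })) i
  where
  s,i = Fin-subset (P? ∘ Inverse.from card)
  s = proj₁ s,i
  i = proj₂ s,i

HasCardinality-⊎ : {S : Setoid a ℓ₁} {T : Setoid b ℓ₂} {m n : ℕ} →
                   HasCardinality S m → HasCardinality T n →
                   HasCardinality (⊎-setoid S T) (m ℕ.+ n)
HasCardinality-⊎ {S = S} {T} {m} {n} i j = mkInverse (⊎-setoid S T) (≡.setoid _)
  (join m n ∘ to) (from ∘ splitAt m)
  (≡.cong (join m n) ∘ to-cong) (λ { ≡.refl → Setoid.refl (⊎-setoid S T) })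
  (λ k → ≡.trans (≡.cong (join m n) (to∘from (splitAt m k))) (Fin.join-splitAt m n k))
  (λ x → Setoid.trans (⊎-setoid S T)
           (Setoid.reflexive (⊎-setoid S T) (≡.cong from (Fin.splitAt-join m n (to x)))) (from∘to x))
  where
  module i = Inverse i
  module j = Inverse j
  to : _ ⊎ _ → Fin m ⊎ Fin n
  to = [ inj₁ ∘ i.to , inj₂ ∘ j.to ]′
  from : Fin m ⊎ Fin n → _ ⊎ _
  from = [ inj₁ ∘ i.from , inj₂ ∘ j.from ]′
  to-cong : ∀ {x y} → Setoid._≈_ (⊎-setoid S T) x y → to x ≡ to y
  to-cong (inj₁ eq) = ≡.cong inj₁ (i.to-cong eq)
  to-cong (inj₂ eq) = ≡.cong inj₂ (j.to-cong eq)
  to∘from : ∀ s → to (from s) ≡ s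
  to∘from (inj₁ k) = ≡.cong inj₁ (i.strictlyInverseˡ k)
  to∘from (inj₂ k) = ≡.cong inj₂ (j.strictlyInverseˡ k)
  from∘to : ∀ x → Setoid._≈_ (⊎-setoid S T) (from (to x)) x
  from∘to (inj₁ x) = inj₁ (i.strictlyInverseʳ x)
  from∘to (inj₂ x) = inj₂ (j.strictlyInverseʳ x)

-- A ring solver with integer coefficients

module ℤ-RingSolver (R : CommutativeRing c ℓ) where
  open CommutativeRing R
  open import Algebra.Solver.Ring.AlmostCommutativeRing
    using (fromCommutativeRing; _-Raw-AlmostCommutative⟶_)
  open import Algebra.Properties.Semiring.Mult semiring using (×-homo-+; ×1-homo-*) renaming (_×_ to _×ₙ_)
  open import Algebra.Properties.Ring ring
    using (-0#≈0#; -‿distribˡ-*; -‿distribʳ-*; -‿+-comm; -‿involutive)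
  open import Data.Integer.Base as ℤ using (ℤ; +_; -[1+_]; _⊖_)
  import Data.Integer.Properties as ℤ
  open import Data.Maybe.Base using (map)
  open import Relation.Nullary.Decidable using (dec⇒maybe)
  open import Relation.Binary.Reasoning.Setoid setoid

  ⟦_⟧ᶻ : ℤ → Carrier
  ⟦ + n ⟧ᶻ      = n ×ₙ 1#
  ⟦ -[1+ n ] ⟧ᶻ = - (suc n ×ₙ 1#)

  ⊖-homo : ∀ m n → ⟦ m ⊖ n ⟧ᶻ ≈ m ×ₙ 1# - n ×ₙ 1#
  ⊖-homo m       zero    = sym (trans (+-congˡ -0#≈0#) (+-identityʳ _))
  ⊖-homo zero    (suc n) = sym (+-identityˡ _)
  ⊖-homo (suc m) (suc n) = begin
    ⟦ suc m ⊖ suc n ⟧ᶻ                       ≡⟨ ≡.cong ⟦_⟧ᶻ (ℤ.[1+m]⊖[1+n]≡m⊖n m n) ⟩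
    ⟦ m ⊖ n ⟧ᶻ                               ≈⟨ ⊖-homo m n ⟩
    x - y                                    ≈⟨ +-congˡ (+-identityˡ _) ⟨
    x + (0# - y)                             ≈⟨ +-congˡ (+-congʳ (-‿inverseʳ 1#)) ⟨
    x + (1# - 1# - y)                        ≈⟨ +-congˡ (+-assoc _ _ _) ⟩
    x + (1# + (- 1# - y))                    ≈⟨ +-assoc _ _ _ ⟨
    x + 1# + (- 1# - y)                      ≈⟨ +-cong (+-comm _ _) (-‿+-comm _ _) ⟩
    suc m ×ₙ 1# - suc n ×ₙ 1#                ∎
    where
    x = m ×ₙ 1#
    y = n ×ₙ 1#

  -homo : ∀ i → ⟦ ℤ.- i ⟧ᶻ ≈ - ⟦ i ⟧ᶻ
  -homo (+ zero)  = sym -0#≈0#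
  -homo (+ suc n) = refl
  -homo -[1+ n ]  = sym (-‿involutive _)

  +-homo : ∀ i j → ⟦ i ℤ.+ j ⟧ᶻ ≈ ⟦ i ⟧ᶻ + ⟦ j ⟧ᶻ
  +-homo (+ m)    (+ n)    = ×-homo-+ 1# m n
  +-homo (+ m)    -[1+ n ] = ⊖-homo m (suc n)
  +-homo -[1+ m ] (+ n)    = trans (⊖-homo n (suc m)) (+-comm _ _)
  +-homo -[1+ m ] -[1+ n ] = begin
    - (suc (suc (m ℕ.+ n)) ×ₙ 1#)   ≡⟨ ≡.cong (λ k → - (suc k ×ₙ 1#)) (≡.sym (ℕₚ.+-suc m n)) ⟩
    - ((suc m ℕ.+ suc n) ×ₙ 1#)     ≈⟨ -‿cong (×-homo-+ 1# (suc m) (suc n)) ⟩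
    - (suc m ×ₙ 1# + suc n ×ₙ 1#)   ≈⟨ -‿+-comm _ _ ⟨
    - (suc m ×ₙ 1#) - suc n ×ₙ 1#   ∎
    where import Data.Nat.Properties as ℕₚ

  *-homo⁺ : ∀ m j → ⟦ + m ℤ.* j ⟧ᶻ ≈ m ×ₙ 1# * ⟦ j ⟧ᶻ
  *-homo⁺ m (+ n)    = trans (reflexive (≡.cong ⟦_⟧ᶻ (≡.sym (ℤ.pos-* m n)))) (×1-homo-* m n)
  *-homo⁺ m -[1+ n ] = begin
    ⟦ + m ℤ.* -[1+ n ] ⟧ᶻ         ≡⟨ ≡.cong ⟦_⟧ᶻ (ℤ.neg-distribʳ-* (+ m) (+ suc n)) ⟨
    ⟦ ℤ.- (+ m ℤ.* + suc n) ⟧ᶻ    ≈⟨ -homo (+ m ℤ.* + suc n) ⟩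
    - ⟦ + m ℤ.* + suc n ⟧ᶻ        ≈⟨ -‿cong (*-homo⁺ m (+ suc n)) ⟩
    - (m ×ₙ 1# * (suc n ×ₙ 1#))   ≈⟨ -‿distribʳ-* _ _ ⟩
    m ×ₙ 1# * - (suc n ×ₙ 1#)     ∎

  *-homo : ∀ i j → ⟦ i ℤ.* j ⟧ᶻ ≈ ⟦ i ⟧ᶻ * ⟦ j ⟧ᶻ
  *-homo (+ m)    j = *-homo⁺ m j
  *-homo -[1+ m ] j = begin
    ⟦ -[1+ m ] ℤ.* j ⟧ᶻ          ≡⟨ ≡.cong ⟦_⟧ᶻ (ℤ.neg-distribˡ-* (+ suc m) j) ⟨
    ⟦ ℤ.- (+ suc m ℤ.* j) ⟧ᶻ     ≈⟨ -homo (+ suc m ℤ.* j) ⟩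
    - ⟦ + suc m ℤ.* j ⟧ᶻ         ≈⟨ -‿cong (*-homo⁺ (suc m) j) ⟩
    - (suc m ×ₙ 1# * ⟦ j ⟧ᶻ)     ≈⟨ -‿distribˡ-* _ _ ⟩
    - (suc m ×ₙ 1#) * ⟦ j ⟧ᶻ     ∎

  morphism : ℤ.+-*-rawRing -Raw-AlmostCommutative⟶ fromCommutativeRing R
  morphism = record
    { ⟦_⟧ = ⟦_⟧ᶻ ; +-homo = +-homo ; *-homo = *-homo ; -‿homo = -homo
    ; 0-homo = refl ; 1-homo = +-identityʳ 1# }

  open import Algebra.Solver.Ring ℤ.+-*-rawRing (fromCommutativeRing R) morphism
    (λ i j → map (λ i≡j → reflexive (≡.cong ⟦_⟧ᶻ i≡j)) (dec⇒maybe (i ℤ.≟ j)))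
    public

-- Finite fields

-- The absorption identity, by induction along Pascal's rule; it exhibits a multiple of `suc n` to
-- which Euclid's lemma can be applied.
[1+k]*nC[1+k] : ∀ n k → suc k ℕ.* (suc n C suc k) ≡ suc n ℕ.* (n C k)
[1+k]*nC[1+k] zero    zero    = ≡.refl
[1+k]*nC[1+k] zero    (suc k) = ℕ.*-zeroʳ (suc (suc k))
[1+k]*nC[1+k] (suc n) zero    = begin
  1 ℕ.* (suc (suc n) C 1)             ≡⟨ ≡.cong (1 ℕ.*_) (nCk+nC[k+1]≡[n+1]C[k+1] (suc n) 0) ⟨
  1 ℕ.* (1 ℕ.+ (suc n C 1))           ≡⟨ ≡.cong (λ z → suc (z ℕ.+ 0)) (≡.trans (≡.sym (ℕ.*-identityˡ _)) ([1+k]*nC[1+k] n 0)) ⟩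
  suc (suc n ℕ.* 1 ℕ.+ 0)             ≡⟨ ≡.cong suc (ℕ.+-identityʳ _) ⟩
  suc (suc n) ℕ.* 1                   ∎
  where open ≡.≡-Reasoning
[1+k]*nC[1+k] (suc n) (suc k) = begin
  suc (suc k) ℕ.* (suc (suc n) C suc (suc k))  ≡⟨ ≡.cong (suc (suc k) ℕ.*_) (nCk+nC[k+1]≡[n+1]C[k+1] (suc n) (suc k)) ⟨
  suc (suc k) ℕ.* (A ℕ.+ B)                    ≡⟨ solve 3 (λ k a b → (con 1 :+ (con 1 :+ k)) :* (a :+ b) := a :+ (con 1 :+ k) :* a :+ (con 1 :+ (con 1 :+ k)) :* b) ≡.refl k A B ⟩
  A ℕ.+ suc k ℕ.* A ℕ.+ suc (suc k) ℕ.* B      ≡⟨ ≡.cong₂ (λ x y → A ℕ.+ x ℕ.+ y) ([1+k]*nC[1+k] n k) ([1+k]*nC[1+k] n (suc k)) ⟩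
  A ℕ.+ suc n ℕ.* (n C k) ℕ.+ suc n ℕ.* (n C suc k)
    ≡⟨ solve 4 (λ n a x y → a :+ (con 1 :+ n) :* x :+ (con 1 :+ n) :* y := a :+ (con 1 :+ n) :* (x :+ y)) ≡.refl n A (n C k) (n C suc k) ⟩
  A ℕ.+ suc n ℕ.* (n C k ℕ.+ n C suc k)        ≡⟨ ≡.cong (λ z → A ℕ.+ suc n ℕ.* z) (nCk+nC[k+1]≡[n+1]C[k+1] n k) ⟩
  suc (suc n) ℕ.* A                            ∎
  where
  open ≡.≡-Reasoning
  open +-*-Solver
  A = suc n C suc k
  B = suc n C suc (suc k)

-- By absorption the prime divides the product of `suc k` with the binomial coefficient, and it is
-- too large to divide `suc k`.
prime∣C : ∀ {n k} → Prime (suc n) → suc k < suc n → suc n ∣ suc n C suc k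
prime∣C {n} {k} pr k<n with euclidsLemma (suc k) (suc n C suc k) pr
  (divides (n C k) (≡.trans ([1+k]*nC[1+k] n k) (ℕ.*-comm (suc n) (n C k))))
... | inj₁ ∣k = contradiction (∣⇒≤ ∣k) (ℕ.<⇒≱ k<n)
... | inj₂ ∣C = ∣C

module _ (S : CommutativeSemiring c ℓ) where
  open CommutativeSemiring S hiding (zero)
  open import Algebra.Properties.Semiring.Exp semiring using (_^_; ^-assocʳ; ^-congˡ)
  open import Algebra.Properties.Semiring.Sum semiring using (sum; sum-init-last; sum-cong-≋; sum-replicate-zero)
  open import Algebra.Properties.Semiring.Mult semiring using (×-assocˡ; ×-congʳ; ×-homo-1; ×-assoc-*) renaming (_×_ to _×ₙ_)
  open import Algebra.Properties.CommutativeSemiring.Binomial S using (binomialTerm; binomial; theorem)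
  open import Relation.Binary.Reasoning.Setoid setoid

  ×-zero : ∀ n → n ×ₙ 0# ≈ 0#
  ×-zero zero    = refl
  ×-zero (suc n) = trans (+-identityˡ _) (×-zero n)

  -- In the binomial expansion all terms but the two outer ones have a coefficient divisible by π,
  -- and multiples of π vanish.
  frobenius-+ : ∀ {π} → Prime π → π ×ₙ 1# ≈ 0# → ∀ x y → (x + y) ^ π ≈ x ^ π + y ^ π
  frobenius-+ {zero} pr π1≈0 x y = contradiction pr ¬prime[0]
  frobenius-+ {suc n} pr π1≈0 x y = begin
    (x + y) ^ suc n                         ≈⟨ theorem (suc n) x y ⟩
    t zero + sum (tail t)                   ≈⟨ +-congˡ (sum-init-last (tail t)) ⟩
    t zero + (sum (init (tail t)) + t (suc (fromℕ n)))
      ≈⟨ +-cong first (+-cong (trans (sum-cong-≋ middle) (sum-replicate-zero n)) end) ⟩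
    y ^ suc n + (0# + x ^ suc n)            ≈⟨ +-congˡ (+-identityˡ _) ⟩
    y ^ suc n + x ^ suc n                   ≈⟨ +-comm _ _ ⟩
    x ^ suc n + y ^ suc n                   ∎
    where
    t : Vector Carrier (suc (suc n))
    t = binomialTerm x y (suc n)

    first : t zero ≈ y ^ suc n
    first = trans (×-homo-1 _) (*-identityˡ _)

    end : t (suc (fromℕ n)) ≈ x ^ suc n
    end = begin
      (suc n C suc (toℕ (fromℕ n))) ×ₙ binomial x y (suc n) (suc (fromℕ n))
        ≡⟨ ≡.cong (λ k → (suc n C suc k) ×ₙ (x ^ suc k * y ^ (n ℕ.∸ k))) (Fin.toℕ-fromℕ n) ⟩
      (suc n C suc n) ×ₙ (x ^ suc n * y ^ (n ℕ.∸ n))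
        ≡⟨ ≡.cong₂ (λ i j → i ×ₙ (x ^ suc n * y ^ j)) (nCn≡1 (suc n)) (ℕ.n∸n≡0 n) ⟩
      1 ×ₙ (x ^ suc n * 1#)  ≈⟨ trans (×-homo-1 _) (*-identityʳ _) ⟩
      x ^ suc n              ∎

    π×≈0 : ∀ z → suc n ×ₙ z ≈ 0#
    π×≈0 z = begin
      suc n ×ₙ z           ≈⟨ ×-congʳ (suc n) (*-identityˡ z) ⟨
      suc n ×ₙ (1# * z)    ≈⟨ ×-assoc-* (suc n) 1# z ⟨
      (suc n ×ₙ 1#) * z    ≈⟨ *-congʳ π1≈0 ⟩
      0# * z               ≈⟨ zeroˡ z ⟩
      0#                   ∎

    middle : ∀ i → t (suc (inject₁ i)) ≈ 0#
    middle i with divides d eq ← prime∣C pr (s≤s (ℕ.≤-trans (ℕ.≤-reflexive (≡.cong suc (Fin.toℕ-inject₁ i))) (Fin.toℕ<n i)))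
      = begin
        (suc n C suc (toℕ (inject₁ i))) ×ₙ z   ≡⟨ ≡.cong (_×ₙ z) eq ⟩
        (d ℕ.* suc n) ×ₙ z                     ≈⟨ ×-assocˡ z d (suc n) ⟨
        d ×ₙ (suc n ×ₙ z)                      ≈⟨ ×-congʳ d (π×≈0 z) ⟩
        d ×ₙ 0#                                ≈⟨ ×-zero d ⟩
        0#                                     ∎
      where z = binomial x y (suc n) (suc (inject₁ i))

  frobeniusⁿ-+ : ∀ {π} → Prime π → π ×ₙ 1# ≈ 0# →
                 ∀ e x y → (x + y) ^ (π ℕ.^ e) ≈ x ^ (π ℕ.^ e) + y ^ (π ℕ.^ e)
  frobeniusⁿ-+ {π} pr π1≈0 zero x y = trans (*-identityʳ _) (sym (+-cong (*-identityʳ _) (*-identityʳ _)))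
  frobeniusⁿ-+ {π} pr π1≈0 (suc e) x y = begin
    (x + y) ^ (π ℕ.* π ℕ.^ e)                    ≈⟨ ^-assocʳ (x + y) π (π ℕ.^ e) ⟨
    ((x + y) ^ π) ^ (π ℕ.^ e)                    ≈⟨ ^-congˡ (π ℕ.^ e) (frobenius-+ pr π1≈0 x y) ⟩
    (x ^ π + y ^ π) ^ (π ℕ.^ e)                  ≈⟨ frobeniusⁿ-+ pr π1≈0 e (x ^ π) (y ^ π) ⟩
    (x ^ π) ^ (π ℕ.^ e) + (y ^ π) ^ (π ℕ.^ e)    ≈⟨ +-cong (^-assocʳ x π _) (^-assocʳ y π _) ⟩
    x ^ (π ℕ.* π ℕ.^ e) + y ^ (π ℕ.* π ℕ.^ e)    ∎

module _ (M : CommutativeMonoid c ℓ) {n : ℕ} (card : HasCardinality (CommutativeMonoid.setoid M) n) where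
  open CommutativeMonoid M
  open import Algebra.Properties.CommutativeMonoid.Sum M using (sum; sum-permute; sum-cong-≋)

  total : (Carrier → Carrier) → Carrier
  total f = sum (f ∘ Inverse.from card)

  -- A bijection of the carrier becomes, through the enumeration, a permutation of indices. It is
  -- used for translation by 1 in the additive group and for multiplication by a non-zero element in
  -- the multiplicative monoid.
  total-reindex : (σ : Inverse setoid setoid) {f : Carrier → Carrier} →
                  (∀ {x y} → x ≈ y → f x ≈ f y) → total f ≈ total (f ∘ Inverse.to σ)
  total-reindex σ f-cong =
    trans (sum-permute _ ((symᵢ card ∘ᵢ σ) ∘ᵢ card))
          (sum-cong-≋ {n} λ i → f-cong (Inverse.strictlyInverseʳ card (Inverse.to σ (Inverse.from card i))))

-- Cancellation and roots of monic polynomials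

module FieldProperties (F : Field c ℓ) where
  open Field F hiding (zero)
  open import Algebra.Properties.Semiring.Exp semiring using (_^_)
  open import Algebra.Properties.Ring ring using (x∙y⁻¹≈ε⇒x≈y)
  open ℤ-RingSolver commutativeRing
  open import Relation.Binary.Reasoning.Setoid setoid

  *-cancelˡ : ∀ {x y z} → ¬ x ≈ 0# → x * y ≈ x * z → y ≈ z
  *-cancelˡ {x} {y} {z} x≉0 xy≈xz with x⁻¹ , xx⁻¹≈1 ← inverse x x≉0 = begin
    y               ≈⟨ *-identityˡ y ⟨
    1# * y          ≈⟨ *-congʳ xx⁻¹≈1 ⟨
    x * x⁻¹ * y     ≈⟨ solve 3 (λ x i y → x :* i :* y := i :* (x :* y)) refl x x⁻¹ y ⟩
    x⁻¹ * (x * y)   ≈⟨ *-congˡ xy≈xz ⟩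
    x⁻¹ * (x * z)   ≈⟨ solve 3 (λ x i y → x :* i :* y := i :* (x :* y)) refl x x⁻¹ z ⟨
    x * x⁻¹ * z     ≈⟨ *-congʳ xx⁻¹≈1 ⟩
    1# * z          ≈⟨ *-identityˡ z ⟩
    z               ∎

  xy≈0⇒y≈0 : ∀ {x y} → ¬ x ≈ 0# → x * y ≈ 0# → y ≈ 0#
  xy≈0⇒y≈0 {x} x≉0 xy≈0 = *-cancelˡ x≉0 (trans xy≈0 (sym (zeroʳ x)))

  *-nonzero : ∀ {x y} → ¬ x ≈ 0# → ¬ y ≈ 0# → ¬ x * y ≈ 0#
  *-nonzero x≉0 y≉0 = y≉0 ∘ xy≈0⇒y≈0 x≉0

  inverse-nonzero : ∀ {x y} → x * y ≈ 1# → ¬ y ≈ 0#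
  inverse-nonzero {x} xy≈1 y≈0 = 0≉1 (trans (sym (zeroʳ x)) (trans (*-congˡ (sym y≈0)) xy≈1))

  x-y≈0⇒x≈y : ∀ {x y} → x - y ≈ 0# → x ≈ y
  x-y≈0⇒x≈y = x∙y⁻¹≈ε⇒x≈y _ _

  -- A monic polynomial of degree d is stored as its d lower coefficients, constant term first, with
  -- the leading 1 implicit. The degree is thus part of the type, and no leading coefficient has to
  -- be tested for zero.
  evalMonic : ∀ {d} → Vec.Vec Carrier d → Carrier → Carrier
  evalMonic Vec.[]        x = 1#
  evalMonic (a Vec.∷ p) x = a + x * evalMonic p x

  -- Synthetic division. For p = a + xP the difference p(x) - p(r) is x(P(x) - P(r)) + (x - r)P(r),
  -- so the value P(r) becomes the constant term of the quotient, which stays monic.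
  divideMonic : ∀ {d} (p : Vec.Vec Carrier (suc d)) r → ∃ λ (s : Vec.Vec Carrier d) →
                ∀ x → evalMonic p x - evalMonic p r ≈ (x - r) * evalMonic s x
  divideMonic (a Vec.∷ Vec.[]) r = Vec.[] , λ x →
    solve 4 (λ a x r 1# → (a :+ x :* 1#) :- (a :+ r :* 1#) := (x :- r) :* 1#) refl a x r 1#
  divideMonic (a Vec.∷ p@(_ Vec.∷ _)) r with s , eq ← divideMonic p r = evalMonic p r Vec.∷ s , λ x → begin
    a + x * evalMonic p x - (a + r * evalMonic p r)
      ≈⟨ solve 5 (λ a x r P R → a :+ x :* P :- (a :+ r :* R) := x :* (P :- R) :+ (x :- r) :* R) refl a x r (evalMonic p x) (evalMonic p r) ⟩
    x * (evalMonic p x - evalMonic p r) + (x - r) * evalMonic p r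
      ≈⟨ +-congʳ (*-congˡ (eq x)) ⟩
    x * ((x - r) * evalMonic s x) + (x - r) * evalMonic p r
      ≈⟨ solve 4 (λ x r S R → x :* ((x :- r) :* S) :+ (x :- r) :* R := (x :- r) :* (R :+ x :* S)) refl x r (evalMonic s x) (evalMonic p r) ⟩
    (x - r) * (evalMonic p r + x * evalMonic s x) ∎

  -- Dividing by the linear factor of one root leaves a monic quotient that must vanish at the other
  -- roots, as these differ from the first. In degree 0 the polynomial is the constant 1 and has no
  -- root.
  roots≤degree : ∀ {d k} (p : Vec.Vec Carrier d) (ρ : Fin k → Carrier) →
                 (∀ {i j} → ρ i ≈ ρ j → i ≡ j) → (∀ i → evalMonic p (ρ i) ≈ 0#) → k ≤ d
  roots≤degree {k = zero} p ρ inj roots = z≤n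
  roots≤degree {zero} {suc k} Vec.[] ρ inj roots = contradiction (sym (roots zero)) 0≉1
  roots≤degree {suc d} {suc k} p ρ inj roots with s , eq ← divideMonic p (ρ zero) =
    s≤s (roots≤degree s (ρ ∘ suc) (Fin.suc-injective ∘ inj) λ i →
      xy≈0⇒y≈0 (λ eq → contradiction (inj (x-y≈0⇒x≈y eq)) λ ())
        (trans (sym (eq _)) (trans (+-cong (roots (suc i)) (-‿cong (roots zero))) (-‿inverseʳ 0#))))

  evalMonic-replicate-0 : ∀ d x → evalMonic (Vec.replicate d 0#) x ≈ x ^ d
  evalMonic-replicate-0 zero    x = refl
  evalMonic-replicate-0 (suc d) x = trans (+-identityˡ _) (*-congˡ (evalMonic-replicate-0 d x))

  -- The ρ i are distinct roots of X^q - X, with lower coefficients 0, -1, 0, ..., 0. For q ≥ 2 the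
  -- term -X lies below the leading one, so this polynomial is monic of degree q.
  fixed-bound : ∀ {q k} → 1 < q → (ρ : Fin k → Carrier) →
                (∀ {i j} → ρ i ≈ ρ j → i ≡ j) → (∀ i → ρ i ^ q ≈ ρ i) → k ≤ q
  fixed-bound {suc zero} (s≤s ()) ρ inj fixed
  fixed-bound {suc (suc q)} _ ρ inj fixed =
    roots≤degree (0# Vec.∷ - 1# Vec.∷ Vec.replicate q 0#) ρ inj λ i → let x = ρ i in begin
      0# + x * (- 1# + x * evalMonic (Vec.replicate q 0#) x)
        ≈⟨ trans (+-identityˡ _) (*-congˡ (+-congˡ (*-congˡ (evalMonic-replicate-0 q x)))) ⟩
      x * (- 1# + x * x ^ q)
        ≈⟨ solve 3 (λ x y o → x :* (:- o :+ x :* y) := x :* (x :* y) :- x :* o) refl x (x ^ q) 1# ⟩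
      x ^ suc (suc q) - x * 1#
        ≈⟨ +-congˡ (-‿cong (*-identityʳ x)) ⟩
      x ^ suc (suc q) - x   ≈⟨ +-congʳ (fixed i) ⟩
      x - x                 ≈⟨ -‿inverseʳ x ⟩
      0#                    ∎

-- Characteristic and Fermat's identity in a finite field

module FiniteFieldProperties (F : Field c ℓ) {N : ℕ} (card : HasOrder F N) where
  open Field F hiding (zero)
  open FieldProperties F
  open import Algebra.Properties.Semiring.Exp semiring using (_^_)
  open import Algebra.Properties.Semiring.Mult semiring using (×1-homo-*; ×-homo-1) renaming (_×_ to _×ₙ_)
  open import Algebra.Properties.Group +-group using (identityʳ-unique)
  import Algebra.Properties.CommutativeMonoid.Sum +-commutativeMonoid as +Sum
  import Algebra.Properties.CommutativeMonoid.Sum *-commutativeMonoid as *Sum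
  open ℤ-RingSolver commutativeRing
  open import Relation.Binary.Reasoning.Setoid setoid

  _≟_ : Decidable₂ _≈_
  _≟_ = HasCardinality⇒≟ card

  element : Fin N → Carrier
  element = Inverse.from card

  -- Translation by 1 permutes the field, so the sum of all elements is unchanged when each of the N
  -- summands grows by 1.
  order×1≈0 : N ×ₙ 1# ≈ 0#
  order×1≈0 = identityʳ-unique S (N ×ₙ 1#) (sym (begin
    S                                              ≈⟨ total-reindex +-commutativeMonoid card translate (λ eq → eq) ⟩
    +Sum.sum (λ i → element i + 1#)                ≈⟨ +Sum.∑-distrib-+ element (λ _ → 1#) ⟩
    S + +Sum.sum {N} (λ _ → 1#)                    ≈⟨ +-congˡ (+Sum.sum-replicate N) ⟩
    S + N ×ₙ 1#                                    ∎))
    where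
    S = total +-commutativeMonoid card (λ x → x)
    translate : Inverse setoid setoid
    translate = mkInverse setoid setoid (_+ 1#) (_- 1#) +-congʳ +-congʳ
      (λ y → solve 2 (λ y o → y :- o :+ o := y) refl y 1#)
      (λ y → solve 2 (λ y o → y :+ o :- o := y) refl y 1#)

  -- A power of `π ×ₙ 1#` vanishes, and there are no zero divisors.
  characteristic : ∀ {π k} → N ≡ π ℕ.^ k → π ×ₙ 1# ≈ 0#
  characteristic {π} {k} ≡.refl = go k order×1≈0
    where
    go : ∀ k → (π ℕ.^ k) ×ₙ 1# ≈ 0# → π ×ₙ 1# ≈ 0#
    go zero    1≈0 = contradiction (sym (trans (sym (×-homo-1 1#)) 1≈0)) 0≉1
    go (suc k) eq with (π ×ₙ 1#) ≟ 0#
    ... | yes π≈0 = π≈0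
    ... | no  π≉0 = go k (xy≈0⇒y≈0 π≉0 (trans (sym (×1-homo-* π (π ℕ.^ k))) eq))

  private
    -- Substituting 1 at y = 0 lets products over the non-zero elements run over the given
    -- enumeration of the whole field, so the units need no enumeration of their own.
    orOne : Carrier → Carrier → Carrier
    orOne x y with y ≟ 0#
    ... | yes _ = 1#
    ... | no  _ = x

    orOne-0 : ∀ {x y} → y ≈ 0# → orOne x y ≈ 1#
    orOne-0 {x} {y} y≈0 with y ≟ 0#
    ... | yes _  = refl
    ... | no y≉0 = contradiction y≈0 y≉0

    orOne-≉ : ∀ {x y} → ¬ y ≈ 0# → orOne x y ≈ x
    orOne-≉ {x} {y} y≉0 with y ≟ 0#
    ... | yes y≈0 = contradiction y≈0 y≉0
    ... | no  _   = refl

    orOne-cong : ∀ {x x′ y y′} → x ≈ x′ → y ≈ y′ → orOne x y ≈ orOne x′ y′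
    orOne-cong {y = y} {y′} x≈ y≈ with y ≟ 0#
    ... | yes y≈0 = sym (orOne-0 (trans (sym y≈) y≈0))
    ... | no  y≉0 = trans x≈ (sym (orOne-≉ (y≉0 ∘ trans y≈)))

    orOne-nonzero : ∀ y → ¬ orOne y y ≈ 0#
    orOne-nonzero y with y ≟ 0#
    ... | yes _  = 0≉1 ∘ sym
    ... | no y≉0 = y≉0

    product-nonzero : ∀ {n} (f : Vector Carrier n) → (∀ i → ¬ f i ≈ 0#) → ¬ *Sum.sum f ≈ 0#
    product-nonzero {zero}  f nz = 0≉1 ∘ sym
    product-nonzero {suc n} f nz = *-nonzero (nz zero) (product-nonzero (tail f) (nz ∘ suc))

    -- The product over the field of orOne x: one factor is missing from x ^ N.
    product-orOne : ∀ x → x * *Sum.sum (orOne x ∘ element) ≈ x ^ N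
    product-orOne x = helper card
      where
      -- `N` is generalised so that it can be matched against `suc`: the factor at the index of 0 is
      -- removed, and the outer x takes its place.
      helper : ∀ {N} (card : HasOrder F N) → x * *Sum.sum (orOne x ∘ Inverse.from card) ≈ x ^ N
      helper {zero}  card = contradiction (Inverse.to card 0#) Fin.¬Fin0
      helper {suc N} card = *-congˡ (begin
        *Sum.sum h                                ≈⟨ *Sum.sum-remove {i = i₀} h ⟩
        h i₀ * *Sum.sum (removeAt h i₀)           ≈⟨ *-cong (orOne-0 (Inverse.strictlyInverseʳ card 0#))
                                                            (*Sum.sum-cong-≋ λ i → orOne-≉ (≢i₀ i)) ⟩
        1# * *Sum.sum {N} (λ _ → x)               ≈⟨ *-identityˡ _ ⟩
        *Sum.sum {N} (λ _ → x)                    ≈⟨ *Sum.sum-replicate N ⟩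
        x ^ N                                     ∎)
        where
        h  = orOne x ∘ Inverse.from card
        i₀ = Inverse.to card 0#
        ≢i₀ : ∀ i → ¬ Inverse.from card (punchIn i₀ i) ≈ 0#
        ≢i₀ i eq = Fin.punchInᵢ≢i i₀ i (≡.trans (≡.sym (Inverse.strictlyInverseˡ card _)) (Inverse.to-cong card eq))

  -- For x ≠ 0, multiplication by x permutes the field, so the product `Πg` of the non-zero elements
  -- equals `Πx * Πg`, where `Πx` collects one factor x for each of them. Cancelling gives
  -- `Πx ≈ 1#`, and one further x completes `x ^ N`.
  x^order≈x : ∀ x → x ^ N ≈ x
  x^order≈x x with x ≟ 0#
  ... | yes x≈0 = trans (sym (product-orOne x)) (trans (*-congʳ x≈0) (trans (zeroˡ _) (sym x≈0)))
  ... | no  x≉0 with x⁻¹ , xx⁻¹≈1 ← inverse x x≉0 = trans (sym (product-orOne x)) (trans (*-congˡ Πx≈1) (*-identityʳ x))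
    where
    g : Carrier → Carrier
    g y = orOne y y
    Πg = total *-commutativeMonoid card g
    Πx = *Sum.sum (orOne x ∘ element)

    scale : Inverse setoid setoid
    scale = mkInverse setoid setoid (x *_) (x⁻¹ *_) *-congˡ *-congˡ
      (λ y → trans (sym (*-assoc _ _ _)) (trans (*-congʳ xx⁻¹≈1) (*-identityˡ y)))
      (λ y → trans (sym (*-assoc _ _ _)) (trans (*-congʳ (trans (*-comm _ _) xx⁻¹≈1)) (*-identityˡ y)))

    g-* : ∀ y → g (x * y) ≈ orOne x y * g y
    g-* y with y ≟ 0#
    ... | yes y≈0 = trans (orOne-0 (trans (*-congˡ y≈0) (zeroʳ x))) (sym (*-identityˡ _))
    ... | no  y≉0 = orOne-≉ (*-nonzero x≉0 y≉0)

    Πx≈1 : Πx ≈ 1#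
    Πx≈1 = *-cancelˡ (product-nonzero (g ∘ element) (orOne-nonzero ∘ element)) (begin
      Πg * Πx                                                ≈⟨ *-comm _ _ ⟩
      Πx * Πg                                                ≈⟨ *Sum.∑-distrib-+ (orOne x ∘ element) (g ∘ element) ⟨
      *Sum.sum (λ i → orOne x (element i) * g (element i))   ≈⟨ *Sum.sum-cong-≋ (g-* ∘ element) ⟨
      *Sum.sum (λ i → g (x * element i))
        ≈⟨ total-reindex *-commutativeMonoid card scale {f = g} (λ eq → orOne-cong eq eq) ⟨
      Πg                                                     ≈⟨ *-identityʳ Πg ⟨
      Πg * 1#                                                ∎)

-- Hyperplanes of an affine space

geometricSum : ℕ → ℕ → ℕ
geometricSum q n = ListAction.sum (List.map (q ℕ.^_) (upTo n))

-- The highest power is split off, to match the division of a projective space into an affine part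
-- and a hyperplane at infinity.
geometricSum-suc : ∀ q n → geometricSum q (suc n) ≡ q ℕ.^ n ℕ.+ geometricSum q n
geometricSum-suc q n = begin
  ListAction.sum (List.map (q ℕ.^_) (upTo (suc n)))          ≡⟨ ≡.cong (ListAction.sum ∘ List.map (q ℕ.^_)) (List.upTo-∷ʳ n) ⟨
  ListAction.sum (List.map (q ℕ.^_) (upTo n List.∷ʳ n))      ≡⟨ ≡.cong ListAction.sum (List.map-++ (q ℕ.^_) (upTo n) List.[ n ]) ⟩
  ListAction.sum (List.map (q ℕ.^_) (upTo n) List.∷ʳ q ℕ.^ n) ≡⟨ ListAction.sum-++ (List.map (q ℕ.^_) (upTo n)) _ ⟩
  geometricSum q n ℕ.+ (q ℕ.^ n ℕ.+ 0)                       ≡⟨ ≡.cong (geometricSum q n ℕ.+_) (ℕ.+-identityʳ _) ⟩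
  geometricSum q n ℕ.+ q ℕ.^ n                               ≡⟨ ℕ.+-comm _ (q ℕ.^ n) ⟩
  q ℕ.^ n ℕ.+ geometricSum q n                               ∎
  where open ≡.≡-Reasoning

-- Linear equations and elimination of a coordinate

module DotProduct (K : Field c ℓ) where
  open LinearAlgebra K hiding (zero)
  open FieldProperties K
  open import Algebra.Properties.Semiring.Sum semiring using (sum-cong-≋; ∑-distrib-+; *-distribˡ-sum; sum-remove; sum-replicate-zero)
  open ℤ-RingSolver commutativeRing using (solve; _:=_; _:+_; _:-_; _:*_; :-_)
  open import Relation.Binary.Reasoning.Setoid setoid

  infix 8 _∙_
  _∙_ : {n : ℕ} → Vector Carrier n → Vector Carrier n → Carrier
  α ∙ x = sum λ k → α k * x k

  module ≋ {n : ℕ} = Setoid (≋-setoid n)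

  ∙-cong : ∀ {n} {α α′ x x′ : Vector Carrier n} → α ≋ α′ → x ≋ x′ → α ∙ x ≈ α′ ∙ x′
  ∙-cong α≋ x≋ = sum-cong-≋ λ k → *-cong (α≋ k) (x≋ k)

  ∙-congˡ : ∀ {n} {α x x′ : Vector Carrier n} → x ≋ x′ → α ∙ x ≈ α ∙ x′
  ∙-congˡ x≋ = sum-cong-≋ λ k → *-congˡ (x≋ k)

  ∙-congʳ : ∀ {n} {α α′ x : Vector Carrier n} → α ≋ α′ → α ∙ x ≈ α′ ∙ x
  ∙-congʳ α≋ = sum-cong-≋ λ k → *-congʳ (α≋ k)

  ∙-comm : ∀ {n} (α x : Vector Carrier n) → α ∙ x ≈ x ∙ α
  ∙-comm α x = sum-cong-≋ λ k → *-comm (α k) (x k)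

  𝟎-∙ : ∀ {n} (x : Vector Carrier n) → 𝟎 ∙ x ≈ 0#
  𝟎-∙ {n} x = trans (sum-cong-≋ λ k → zeroˡ (x k)) (sum-replicate-zero n)

  ∙-+ : ∀ {n} (α x y : Vector Carrier n) → α ∙ (λ k → x k + y k) ≈ α ∙ x + α ∙ y
  ∙-+ α x y = trans (sum-cong-≋ λ k → distribˡ (α k) (x k) (y k)) (∑-distrib-+ (λ k → α k * x k) (λ k → α k * y k))

  *-∙ : ∀ {n} ρ (α x : Vector Carrier n) → (λ k → ρ * α k) ∙ x ≈ ρ * α ∙ x
  *-∙ ρ α x = trans (sum-cong-≋ λ k → *-assoc ρ (α k) (x k)) (sym (*-distribˡ-sum ρ (λ k → α k * x k)))

  ∙-* : ∀ {n} ρ (α x : Vector Carrier n) → α ∙ (λ k → ρ * x k) ≈ ρ * α ∙ x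
  ∙-* ρ α x = trans (∙-comm α _) (trans (*-∙ ρ x α) (*-congˡ (∙-comm x α)))

  +-∙ : ∀ {n} (α β x : Vector Carrier n) → (λ k → α k + β k) ∙ x ≈ α ∙ x + β ∙ x
  +-∙ α β x = trans (∙-comm _ x) (trans (∙-+ x α β) (+-cong (∙-comm x α) (∙-comm x β)))

  ∙-remove : ∀ {n} (p : Fin (suc n)) (α x : Vector Carrier (suc n)) →
             α ∙ x ≈ α p * x p + removeAt α p ∙ removeAt x p
  ∙-remove p α x = sum-remove {i = p} (λ k → α k * x k)

  ≋-pivot : ∀ {n} (p : Fin (suc n)) {x y : Vector Carrier (suc n)} →
            x p ≈ y p → removeAt x p ≋ removeAt y p → x ≋ y
  ≋-pivot p {x} {y} xₚ≈yₚ x̂≋ŷ k with p Fin.≟ k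
  ... | yes ≡.refl = xₚ≈yₚ
  ... | no  p≢k    = ≡.subst (λ k → x k ≈ y k) (Fin.punchIn-punchOut p≢k) (x̂≋ŷ (punchOut p≢k))

  removeAt-cong : ∀ {n} (p : Fin (suc n)) {x y : Vector Carrier (suc n)} → x ≋ y → removeAt x p ≋ removeAt y p
  removeAt-cong p x≋y k = x≋y (punchIn p k)

  Plane : ∀ {n} → Vector Carrier n → Carrier → Pred (Vector Carrier n) ℓ
  Plane α β x = α ∙ x ≈ β

  module Pivot {n : ℕ} (α : Vector Carrier (suc n)) (p : Fin (suc n)) (αₚ≉0 : ¬ α p ≈ 0#) where

    αₚ⁻¹ : Carrier
    αₚ⁻¹ = proj₁ (inverse (α p) αₚ≉0)

    αₚαₚ⁻¹≈1 : α p * αₚ⁻¹ ≈ 1#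
    αₚαₚ⁻¹≈1 = proj₂ (inverse (α p) αₚ≉0)

    -- Since `α p` is invertible, the equation α ∙ x = β can be solved for coordinate p: the plane
    -- is a graph over the remaining coordinates, and this is the inverse of the projection
    -- `removeAt`.
    complete : Carrier → Vector Carrier n → Vector Carrier (suc n)
    complete β y = insertAt y p (αₚ⁻¹ * (β - removeAt α p ∙ y))

    removeAt-complete : ∀ β y → removeAt (complete β y) p ≋ y
    removeAt-complete β y k = reflexive (removeAt-insertAt y p _ k)

    complete∈Plane : ∀ β y → Plane α β (complete β y)
    complete∈Plane β y = begin
      α ∙ complete β y                          ≈⟨ ∙-remove p α (complete β y) ⟩
      α p * complete β y p + removeAt α p ∙ removeAt (complete β y) p
        ≈⟨ +-cong (*-congˡ (reflexive (insertAt-lookup y p _))) (∙-congˡ {α = removeAt α p} (removeAt-complete β y)) ⟩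
      α p * (αₚ⁻¹ * (β - removeAt α p ∙ y)) + removeAt α p ∙ y
        ≈⟨ +-congʳ (trans (sym (*-assoc _ _ _)) (trans (*-congʳ αₚαₚ⁻¹≈1) (*-identityˡ _))) ⟩
      β - removeAt α p ∙ y + removeAt α p ∙ y
        ≈⟨ solve 2 (λ b s → b :- s :+ s := b) refl β (removeAt α p ∙ y) ⟩
      β                                         ∎

    Plane-unique : ∀ {β x y} → Plane α β x → Plane α β y → removeAt x p ≋ removeAt y p → x ≋ y
    Plane-unique {β} {x} {y} x∈ y∈ x̂≋ŷ = ≋-pivot p (*-cancelˡ αₚ≉0 (begin
      α p * x p                     ≈⟨ solve 2 (λ u s → u := u :+ s :- s) refl (α p * x p) s ⟩
      α p * x p + s - s             ≈⟨ +-congʳ (trans (sym (∙-remove p α x)) (trans x∈ (sym y∈))) ⟩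
      α ∙ y - s                     ≈⟨ +-cong (∙-remove p α y) (-‿cong (∙-congˡ {α = removeAt α p} x̂≋ŷ)) ⟩
      α p * y p + t - t             ≈⟨ solve 2 (λ u s → u :+ s :- s := u) refl (α p * y p) t ⟩
      α p * y p                     ∎)) x̂≋ŷ
      where
      s = removeAt α p ∙ removeAt x p
      t = removeAt α p ∙ removeAt y p

    complete-unique : ∀ {β x y} → Plane α β x → removeAt x p ≋ y → complete β y ≋ x
    complete-unique {β} x∈ x̂≋y = Plane-unique (complete∈Plane β _) x∈
      (≋.trans (removeAt-complete β _) (≋.sym x̂≋y))

    Plane≅ : ∀ β → Inverse (subsetoid (≋-setoid (suc n)) (Plane α β)) (≋-setoid n)
    Plane≅ β = mkInverse _ (≋-setoid n)
      (λ (x , _) → removeAt x p) (λ y → complete β y , complete∈Plane β y)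
      (removeAt-cong p)
      (λ {x} {y} x≋y → complete-unique (complete∈Plane β y) (≋.trans (removeAt-complete β y) (≋.sym x≋y)))
      (removeAt-complete β)
      (λ (x , x∈) → complete-unique x∈ ≋.refl)

    -- Subtracting a multiple of α from α′ so as to kill the coordinate p.
    module _ (α′ : Vector Carrier (suc n)) where

      ratio : Carrier
      ratio = α′ p * αₚ⁻¹

      reduce : Vector Carrier n
      reduce k = removeAt α′ p k - ratio * removeAt α p k

      ratio*αₚ : ratio * α p ≈ α′ p
      ratio*αₚ = trans (*-assoc _ _ _) (trans (*-congˡ (trans (*-comm _ _) αₚαₚ⁻¹≈1)) (*-identityʳ _))

      reduce-∙ : ∀ x → reduce ∙ removeAt x p ≈ α′ ∙ x - ratio * α ∙ x
      reduce-∙ x = begin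
        reduce ∙ x̂                             ≈⟨ sum-cong-≋ (λ k → solve 4 (λ a r b x → (a :- r :* b) :* x := a :* x :+ (:- r) :* (b :* x)) refl (α̂′ k) ratio (α̂ k) (x̂ k)) ⟩
        sum (λ k → α̂′ k * x̂ k + - ratio * (α̂ k * x̂ k)) ≈⟨ ∑-distrib-+ (λ k → α̂′ k * x̂ k) (λ k → - ratio * (α̂ k * x̂ k)) ⟩
        α̂′ ∙ x̂ + sum (λ k → - ratio * (α̂ k * x̂ k))    ≈⟨ +-congˡ (*-distribˡ-sum (- ratio) (λ k → α̂ k * x̂ k)) ⟨
        α̂′ ∙ x̂ + - ratio * α̂ ∙ x̂               ≈⟨ solve 5 (λ s r t y x → s :+ (:- r) :* t := r :* y :* x :+ s :- r :* (y :* x :+ t)) refl (α̂′ ∙ x̂) ratio (α̂ ∙ x̂) (α p) (x p) ⟩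
        ratio * α p * x p + α̂′ ∙ x̂ - ratio * (α p * x p + α̂ ∙ x̂)
          ≈⟨ +-cong (trans (+-congʳ (*-congʳ ratio*αₚ)) (sym (∙-remove p α′ x))) (-‿cong (*-congˡ (sym (∙-remove p α x)))) ⟩
        α′ ∙ x - ratio * α ∙ x                 ∎
        where
        α̂ = removeAt α p
        α̂′ = removeAt α′ p
        x̂ = removeAt x p

      -- On the first plane α ∙ x is the constant β, so subtracting `ratio` times it only shifts the
      -- right-hand side of the second equation.
      reduce-Plane : ∀ {β β′ x} → Plane α β x → Plane α′ β′ x ⇔ Plane reduce (β′ - ratio * β) (removeAt x p)
      reduce-Plane {β} {β′} {x} x∈ = mk⇔
        (λ x∈′ → trans (reduce-∙ x) (+-cong x∈′ (-‿cong (*-congˡ x∈))))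
        (λ x̂∈ → begin
          α′ ∙ x                                     ≈⟨ solve 2 (λ u v → u := u :- v :+ v) refl (α′ ∙ x) (ratio * α ∙ x) ⟩
          α′ ∙ x - ratio * α ∙ x + ratio * α ∙ x     ≈⟨ +-cong (trans (sym (reduce-∙ x)) x̂∈) (*-congˡ x∈) ⟩
          β′ - ratio * β + ratio * β                 ≈⟨ solve 2 (λ u v → u :- v :+ v := u) refl β′ (ratio * β) ⟩
          β′                                         ∎)

      reduce≋𝟎⇒proportional : reduce ≋ 𝟎 → (λ k → ratio * α k) ≋ α′
      reduce≋𝟎⇒proportional red = ≋-pivot p ratio*αₚ (λ k → sym (x-y≈0⇒x≈y (red k)))

      reduce≋𝟎⇒ratio≉0 : reduce ≋ 𝟎 → ¬ α′ ≋ 𝟎 → ¬ ratio ≈ 0#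
      reduce≋𝟎⇒ratio≉0 red α′≉𝟎 r≈0 = α′≉𝟎 λ k →
        trans (sym (reduce≋𝟎⇒proportional red k)) (trans (*-congʳ r≈0) (zeroˡ _))

  ∼-refl : ∀ {n} {x : Vector Carrier n} → x ∼ x
  ∼-refl = 1# , 0≉1 ∘ sym , λ _ → *-identityˡ _

  ∼-sym : ∀ {n} {x y : Vector Carrier n} → x ∼ y → y ∼ x
  ∼-sym {x = x} {y} (ρ , ρ≉0 , ρx≋y) with ρ⁻¹ , ρρ⁻¹≈1 ← inverse ρ ρ≉0 =
    ρ⁻¹ , inverse-nonzero ρρ⁻¹≈1 , λ k → begin
      ρ⁻¹ * y k          ≈⟨ *-congˡ (ρx≋y k) ⟨
      ρ⁻¹ * (ρ * x k)    ≈⟨ *-assoc _ _ _ ⟨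
      ρ⁻¹ * ρ * x k      ≈⟨ *-congʳ (trans (*-comm _ _) ρρ⁻¹≈1) ⟩
      1# * x k           ≈⟨ *-identityˡ _ ⟩
      x k                ∎

  ∼-trans : ∀ {n} {x y z : Vector Carrier n} → x ∼ y → y ∼ z → x ∼ z
  ∼-trans (ρ , ρ≉0 , ρx≋y) (σ , σ≉0 , σy≋z) =
    σ * ρ , *-nonzero σ≉0 ρ≉0 , λ k → trans (*-assoc _ _ _) (trans (*-congˡ (ρx≋y k)) (σy≋z k))

  ≋⇒∼ : ∀ {n} {x y : Vector Carrier n} → x ≋ y → x ∼ y
  ≋⇒∼ x≋y = 1# , 0≉1 ∘ sym , λ k → trans (*-identityˡ _) (x≋y k)

  -- Its elements serve as directions of normals: a hyperplane through a given point is determined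
  -- by its normal up to a non-zero factor.
  projectiveSpace : ℕ → Setoid _ _
  projectiveSpace n = record
    { Carrier = ∃ λ (α : Vector Carrier n) → ¬ α ≋ 𝟎
    ; _≈_ = λ (α , _) (α′ , _) → α ∼ α′
    ; isEquivalence = record { refl = ∼-refl ; sym = ∼-sym ; trans = ∼-trans }
    }

  Plane-∼ : ∀ {n} {α α′ P : Vector Carrier n} → α ∼ α′ → Plane α (α ∙ P) ⊆ Plane α′ (α′ ∙ P)
  Plane-∼ {α = α} {α′} {P} (ρ , _ , ρα≋α′) {x} x∈ = begin
    α′ ∙ x                ≈⟨ ∙-congʳ {x = x} ρα≋α′ ⟨
    (λ k → ρ * α k) ∙ x   ≈⟨ *-∙ ρ α x ⟩
    ρ * α ∙ x             ≈⟨ *-congˡ x∈ ⟩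
    ρ * α ∙ P             ≈⟨ *-∙ ρ α P ⟨
    (λ k → ρ * α k) ∙ P   ≈⟨ ∙-congʳ {x = P} ρα≋α′ ⟩
    α′ ∙ P                ∎

-- Counting in the point-hyperplane design

module AffineGeometry (K : Field c ℓ) {q : ℕ} (card : HasOrder K q) where
  open LinearAlgebra K hiding (zero)
  open FieldProperties K
  open DotProduct K
  open FiniteFieldProperties K card using (_≟_)
  open ℤ-RingSolver commutativeRing using (solve; _:=_; _:+_; _:-_; _:*_; :-_)
  open import Relation.Binary.Reasoning.Setoid setoid

  zero-or-pivot : ∀ {n} (α : Vector Carrier n) → α ≋ 𝟎 ⊎ ∃ λ p → ¬ α p ≈ 0#
  zero-or-pivot {n} α with Fin.all? (λ k → α k ≟ 0#)
  ... | yes α≋𝟎 = inj₁ α≋𝟎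
  ... | no  α≉𝟎 = inj₂ (Fin.¬∀⟶∃¬ n (λ k → α k ≈ 0#) (λ k → α k ≟ 0#) α≉𝟎)

  pivot : ∀ {n} {α : Vector Carrier n} → ¬ α ≋ 𝟎 → ∃ λ p → ¬ α p ≈ 0#
  pivot {α = α} α≉𝟎 = Fin.¬∀⟶∃¬ _ (λ k → α k ≈ 0#) (λ k → α k ≟ 0#) α≉𝟎

  Plane-card : ∀ {n} {α : Vector Carrier (suc n)} β → ¬ α ≋ 𝟎 →
               HasCardinality (subsetoid (≋-setoid (suc n)) (Plane α β)) (q ℕ.^ n)
  Plane-card {n} {α} β α≉𝟎 with p , αₚ≉0 ← pivot α≉𝟎 =
    HasCardinality-≅ (Pivot.Plane≅ α p αₚ≉0 β) (HasCardinality-Vector setoid card n)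

  Plane-inhabited : ∀ {n} {α : Vector Carrier n} β → ¬ α ≋ 𝟎 → ∃ (Plane α β)
  Plane-inhabited {zero}  β α≉𝟎 = contradiction (λ ()) α≉𝟎
  Plane-inhabited {suc n} {α} β α≉𝟎 with p , αₚ≉0 ← pivot α≉𝟎 =
    Pivot.complete α p αₚ≉0 β 𝟎 , Pivot.complete∈Plane α p αₚ≉0 β 𝟎

  -- If the normals were not proportional, α′ would take every value on the first plane, whereas the
  -- inclusion permits only one.
  Plane-⊆⇒∼ : ∀ {n} {α α′ : Vector Carrier n} {β β′} → ¬ α ≋ 𝟎 → ¬ α′ ≋ 𝟎 →
              Plane α β ⊆ Plane α′ β′ → α ∼ α′
  Plane-⊆⇒∼ {zero} α≉𝟎 _ _ = contradiction (λ ()) α≉𝟎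
  Plane-⊆⇒∼ {suc n} {α} {α′} {β} {β′} α≉𝟎 α′≉𝟎 H⊆H′ with p , αₚ≉0 ← pivot α≉𝟎 = go
    where
    open Pivot α p αₚ≉0
    β″ = β′ - ratio α′ * β
    go : α ∼ α′
    go with zero-or-pivot (reduce α′)
    ... | inj₁ red = ratio α′ , reduce≋𝟎⇒ratio≉0 α′ red α′≉𝟎 , reduce≋𝟎⇒proportional α′ red
    -- The inclusion forces the reduced form to have the value `β″`; `β″ + 1#` is a value certain to
    -- differ from it.
    ... | inj₂ (r , redᵣ≉0) with y , y∈ ← Plane-inhabited (β″ + 1#) (λ red → redᵣ≉0 (red r))
      = contradiction (begin
        0#               ≈⟨ -‿inverseʳ β″ ⟨
        β″ - β″          ≈⟨ +-congʳ (trans (sym y∈) y∈″) ⟨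
        β″ + 1# - β″     ≈⟨ solve 2 (λ b o → b :+ o :- b := o) refl β″ 1# ⟩
        1#               ∎) 0≉1
      where
      x = complete β y
      y∈″ : reduce α′ ∙ y ≈ β″
      y∈″ = trans (∙-congˡ {α = reduce α′} (≋.sym (removeAt-complete β y)))
                  (Equivalence.to (reduce-Plane α′ {x = x} (complete∈Plane β y)) (H⊆H′ {x} (complete∈Plane β y)))

  -- A non-zero first entry can be scaled to 1, after which the other entries are arbitrary; if it
  -- is zero, a point of the hyperplane at infinity remains.
  projectiveSpace-suc : ∀ n → Inverse (projectiveSpace (suc n)) (⊎-setoid (≋-setoid n) (projectiveSpace n))
  projectiveSpace-suc n = mkInverse (projectiveSpace (suc n)) (⊎-setoid (≋-setoid n) (projectiveSpace n))
    to from (λ {x} {y} → to-cong {x} {y}) from-cong to∘from from∘to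
    where
    to : (∃ λ (α : Vector Carrier (suc n)) → ¬ α ≋ 𝟎) → Vector Carrier n ⊎ (∃ λ (α : Vector Carrier n) → ¬ α ≋ 𝟎)
    to (α , α≉𝟎) with head α ≟ 0#
    ... | yes α₀≈0 = inj₂ (tail α , λ tail≋𝟎 → α≉𝟎 λ { zero → α₀≈0 ; (suc k) → tail≋𝟎 k })
    ... | no  α₀≉0 = inj₁ λ k → proj₁ (inverse _ α₀≉0) * α (suc k)

    from : Vector Carrier n ⊎ (∃ λ (α : Vector Carrier n) → ¬ α ≋ 𝟎) → ∃ λ (α : Vector Carrier (suc n)) → ¬ α ≋ 𝟎
    from (inj₁ v) = 1# ∷ v , λ eq → 0≉1 (sym (eq zero))
    from (inj₂ (α , α≉𝟎)) = 0# ∷ α , λ eq → α≉𝟎 (eq ∘ suc)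

    scale-inverse : ∀ {x y i j ρ u v} → x * i ≈ 1# → y * j ≈ 1# → ρ * x ≈ y → ρ * u ≈ v → i * u ≈ j * v
    scale-inverse {x} {y} {i} {j} {ρ} {u} {v} xi≈1 yj≈1 ρx≈y ρu≈v = begin
      i * u                  ≈⟨ *-identityˡ _ ⟨
      1# * (i * u)           ≈⟨ *-congʳ yj≈1 ⟨
      y * j * (i * u)        ≈⟨ *-congʳ (*-congʳ ρx≈y) ⟨
      ρ * x * j * (i * u)    ≈⟨ solve 5 (λ r x j i u → r :* x :* j :* (i :* u) := x :* i :* (j :* (r :* u))) refl ρ x j i u ⟩
      x * i * (j * (ρ * u))  ≈⟨ *-cong xi≈1 (*-congˡ ρu≈v) ⟩
      1# * (j * v)           ≈⟨ *-identityˡ _ ⟩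
      j * v                  ∎

    open Setoid (⊎-setoid (≋-setoid n) (projectiveSpace n)) using () renaming (_≈_ to _≈⊎_)

    to-cong : ∀ {x y} → proj₁ x ∼ proj₁ y → to x ≈⊎ to y
    to-cong {α , _} {α′ , _} (ρ , ρ≉0 , ρα≋α′) with head α ≟ 0# | head α′ ≟ 0#
    ... | yes _    | yes _     = inj₂ (ρ , ρ≉0 , ρα≋α′ ∘ suc)
    ... | yes α₀≈0 | no  α₀′≉0 = contradiction (trans (sym (ρα≋α′ zero)) (trans (*-congˡ α₀≈0) (zeroʳ ρ))) α₀′≉0
    ... | no  α₀≉0 | yes α₀′≈0 = contradiction (trans (ρα≋α′ zero) α₀′≈0) (*-nonzero ρ≉0 α₀≉0)
    ... | no  α₀≉0 | no  α₀′≉0 = inj₁ λ k →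
      scale-inverse (proj₂ (inverse _ α₀≉0)) (proj₂ (inverse _ α₀′≉0)) (ρα≋α′ zero) (ρα≋α′ (suc k))

    from-cong : ∀ {x y} → x ≈⊎ y → proj₁ (from x) ∼ proj₁ (from y)
    from-cong (inj₁ v≋w) = ≋⇒∼ λ { zero → refl ; (suc k) → v≋w k }
    from-cong (inj₂ (ρ , ρ≉0 , ρα≋α′)) = ρ , ρ≉0 , λ { zero → zeroʳ ρ ; (suc k) → ρα≋α′ k }

    to∘from : ∀ y → to (from y) ≈⊎ y
    to∘from (inj₁ v) with 1# ≟ 0#
    ... | yes 1≈0 = contradiction (sym 1≈0) 0≉1
    ... | no  1≉0 = inj₁ λ k → trans (*-congʳ (trans (sym (*-identityˡ _)) (proj₂ (inverse _ 1≉0)))) (*-identityˡ _)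
    to∘from (inj₂ (α , α≉𝟎)) with 0# ≟ 0#
    ... | yes _  = inj₂ ∼-refl
    ... | no 0≉0 = contradiction refl 0≉0

    from∘to : ∀ x → proj₁ (from (to x)) ∼ proj₁ x
    from∘to (α , α≉𝟎) with head α ≟ 0#
    ... | yes α₀≈0 = ≋⇒∼ λ { zero → sym α₀≈0 ; (suc k) → refl }
    ... | no  α₀≉0 = head α , α₀≉0 , λ { zero → *-identityʳ _ ; (suc k) →
            trans (sym (*-assoc _ _ _)) (trans (*-congʳ (proj₂ (inverse _ α₀≉0))) (*-identityˡ _)) }

  projectiveSpace-card : ∀ n → HasCardinality (projectiveSpace n) (geometricSum q n)
  projectiveSpace-card zero = mkInverse (projectiveSpace 0) (≡.setoid _)
    (λ (_ , α≉𝟎) → contradiction (λ ()) α≉𝟎) (λ ())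
    (λ { {_ , α≉𝟎} → contradiction (λ ()) α≉𝟎 }) (λ { {()} }) (λ ()) (λ (_ , α≉𝟎) → contradiction (λ ()) α≉𝟎)
  projectiveSpace-card (suc n) = ≡.subst (HasCardinality (projectiveSpace (suc n))) (≡.sym (geometricSum-suc q n))
    (HasCardinality-≅ (projectiveSpace-suc n)
      (HasCardinality-⊎ (HasCardinality-Vector setoid card n) (projectiveSpace-card n)))

  -- The dimension is d + 2: two non-parallel hyperplanes eliminate two coordinates and meet in
  -- `q ^ d` points.
  module _ (d : ℕ) where
    open IncidenceStructure (AGDesign K (suc (suc d)))

    block-card : ∀ B → HasCardinality (subsetoid points (_I B)) (q ℕ.^ suc d)
    block-card (H , α , β , α≉𝟎 , H≐) = HasCardinality-≅ (≐-restrict {S = points} H≐) (Plane-card β α≉𝟎)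

    open Pivot

    -- Once the second equation is reduced on the first hyperplane, its linear part either vanishes,
    -- which makes the normals proportional, or describes a hyperplane in one dimension less. A
    -- common point is returned beside the count because the uniqueness of parallels has to refute
    -- disjointness.
    meet-or-parallel : ∀ B B′ (let α = proj₁ (proj₂ B) ; β = proj₁ (proj₂ (proj₂ B)) ; α′ = proj₁ (proj₂ B′) ; β′ = proj₁ (proj₂ (proj₂ B′))) →
            HasCardinality (subsetoid points (λ P → P I B × P I B′)) (q ℕ.^ d) × ∃ (λ P → P I B × P I B′) ⊎
            ∃ λ ρ → ¬ ρ ≈ 0# × (λ k → ρ * α k) ≋ α′
    meet-or-parallel (H , α , β , α≉𝟎 , H⊆ , ⊆H) (H′ , α′ , β′ , α′≉𝟎 , H′⊆ , ⊆H′)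
      with p , αₚ≉0 ← pivot α≉𝟎 | zero-or-pivot (reduce α p αₚ≉0 α′)
    ... | inj₁ red = inj₂ (ratio α p αₚ≉0 α′ , reduce≋𝟎⇒ratio≉0 α p αₚ≉0 α′ red α′≉𝟎 , reduce≋𝟎⇒proportional α p αₚ≉0 α′ red)
    ... | inj₂ (r , redᵣ≉0) = inj₁
      ( HasCardinality-≅ (≐-restrict {S = points} ((λ (h , h′) → H⊆ h , H′⊆ h′) , (λ (h , h′) → ⊆H h , ⊆H′ h′)) ∘ᵢ meet≅)
                         (Plane-card β″ red≉𝟎)
      , Inverse.from meet≅ y .proj₁ , ⊆H (Inverse.from meet≅ y .proj₂ .proj₁) , ⊆H′ (Inverse.from meet≅ y .proj₂ .proj₂) )
      where
      red≉𝟎 : ¬ reduce α p αₚ≉0 α′ ≋ 𝟎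
      red≉𝟎 red = redᵣ≉0 (red r)
      β″ = β′ - ratio α p αₚ≉0 α′ * β
      y = Plane-inhabited β″ red≉𝟎
      meet≅ : Inverse (subsetoid points (λ P → Plane α β P × Plane α′ β′ P))
                      (subsetoid (≋-setoid (suc d)) (Plane (reduce α p αₚ≉0 α′) β″))
      meet≅ = subsetoid-× {S = points} ∘ᵢ
        restrict (subsetoid points (Plane α β)) (≋-setoid (suc d)) (Plane≅ α p αₚ≉0 β)
          (λ {y} {z} y≋z y∈ → trans (∙-congˡ {α = reduce α p αₚ≉0 α′} (≋.sym y≋z)) y∈)
          (λ (x , x∈) → reduce-Plane α p αₚ≉0 α′ {x = x} x∈)

    through : (P α : Vector Carrier (suc (suc d))) → ¬ α ≋ 𝟎 → Block
    through P α α≉𝟎 = Plane α (α ∙ P) , α , α ∙ P , α≉𝟎 , (λ x∈ → x∈) , (λ x∈ → x∈)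

    through-unique : ∀ {P} (B : Block) (P∈B : P I B) {α} (α≉𝟎 : ¬ α ≋ 𝟎) → α ∼ proj₁ (proj₂ B) →
                     B ≈ᵦ through P α α≉𝟎
    through-unique {P} (H , α′ , β′ , _ , H⊆ , ⊆H) P∈B {α} α≉𝟎 α∼α′ =
      (λ {x} x∈ → Plane-∼ {P = P} (∼-sym α∼α′) {x} (trans (H⊆ x∈) (sym (H⊆ P∈B)))) ,
      (λ {x} x∈ → ⊆H (trans (Plane-∼ {P = P} α∼α′ {x} x∈) (H⊆ P∈B)))

    isAffine : IsAffine (AGDesign K (suc (suc d))) (q ℕ.^ d)
    isAffine = record { meet = meet ; parallel = parallel }
      where
      meet : ∀ B B′ → ¬ B ≈ᵦ B′ → Disjoint B B′ ⊎ HasCardinality (subsetoid points (λ P → P I B × P I B′)) (q ℕ.^ d)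
      meet B B′ B≉B′ with meet-or-parallel B B′
      ... | inj₁ (size , _) = inj₂ size
      -- With a common point P, both blocks would be the plane through P with the normal of B.
      ... | inj₂ α∼α′ = inj₁ λ P (P∈B , P∈B′) → B≉B′
        (let C = through P (proj₁ (proj₂ B)) (proj₁ (proj₂ (proj₂ (proj₂ B)))) in
        Setoid.trans blocks {B} {C} {B′}
          (through-unique {P} B P∈B (proj₁ (proj₂ (proj₂ (proj₂ B)))) ∼-refl)
          (Setoid.sym blocks {B′} {C} (through-unique {P} B′ P∈B′ (proj₁ (proj₂ (proj₂ (proj₂ B)))) α∼α′)))

      parallel : ∀ P B → ¬ P I B → ∃ λ B′ → (P I B′ × Disjoint B B′) × (∀ B″ → P I B″ × Disjoint B B″ → B″ ≈ᵦ B′)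
      parallel P B@(H , α , β , α≉𝟎 , H⊆ , ⊆H) P∉B = through P α α≉𝟎 ,
        (refl , λ Q (Q∈B , Q∈B′) → P∉B (⊆H (trans (sym Q∈B′) (H⊆ Q∈B)))) , unique
        where
        unique : ∀ B″ → P I B″ × Disjoint B B″ → B″ ≈ᵦ through P α α≉𝟎
        unique B″ (P∈B″ , disjoint) with meet-or-parallel B B″
        ... | inj₁ (_ , Q , Q∈) = contradiction Q∈ (disjoint Q)
        ... | inj₂ α∼α″ = through-unique {P} B″ P∈B″ α≉𝟎 α∼α″

    -- A hyperplane through P contains Q exactly when its normal is orthogonal to v = Q - P. Such a
    -- normal is determined by its entries away from a pivot of v, so these hyperplanes correspond
    -- to the non-zero vectors with d + 1 entries, up to scaling.
    join-card : ∀ P Q → ¬ P ≈ₚ Q → HasCardinality (subsetoid blocks (λ B → P I B × Q I B)) (geometricSum q (suc d))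
    join-card P Q P≉Q with p , vₚ≉0 ← pivot {α = λ k → Q k - P k} (λ v≋𝟎 → P≉Q λ k → sym (x-y≈0⇒x≈y (v≋𝟎 k))) =
      HasCardinality-≅ (mkInverse _ (projectiveSpace (suc d)) to from
        (λ {x} {y} → to-cong {x} {y}) (λ {x} {y} → from-cong {x} {y}) to∘from from∘to) (projectiveSpace-card (suc d))
      where
      v : Vector Carrier (suc (suc d))
      v k = Q k - P k

      open Pivot v p vₚ≉0 using () renaming (complete to complete′; complete∈Plane to complete∈; Plane-unique to unique; removeAt-complete to removeAt-complete′)

      ∙v : ∀ α → α ∙ Q ≈ α ∙ P + v ∙ α
      ∙v α = begin
        α ∙ Q                       ≈⟨ ∙-congˡ {α = α} (λ k → solve 2 (λ q p → q := p :+ (q :- p)) refl (Q k) (P k)) ⟩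
        α ∙ (λ k → P k + v k)       ≈⟨ ∙-+ α P v ⟩
        α ∙ P + α ∙ v               ≈⟨ +-congˡ (∙-comm α v) ⟩
        α ∙ P + v ∙ α               ∎

      v∙α≈0 : ∀ (B : Block) → P I B → Q I B → v ∙ proj₁ (proj₂ B) ≈ 0#
      v∙α≈0 (_ , α , β , _ , H⊆ , _) P∈ Q∈ = begin
        v ∙ α                        ≈⟨ solve 2 (λ x y → y := x :+ y :- x) refl (α ∙ P) (v ∙ α) ⟩
        α ∙ P + v ∙ α - α ∙ P        ≈⟨ +-cong (trans (sym (∙v α)) (H⊆ Q∈)) (-‿cong (H⊆ P∈)) ⟩
        β - β                        ≈⟨ -‿inverseʳ β ⟩
        0#                           ∎

      0∈ : Plane v 0# 𝟎
      0∈ = trans (∙-comm v 𝟎) (𝟎-∙ v)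

      to : (∃ λ B → P I B × Q I B) → ∃ λ (α : Vector Carrier (suc d)) → ¬ α ≋ 𝟎
      to (B@(_ , α , _ , α≉𝟎 , _) , P∈ , Q∈) = removeAt α p , λ α̂≋𝟎 → α≉𝟎 (unique {0#} {α} {𝟎} (v∙α≈0 B P∈ Q∈) 0∈ α̂≋𝟎)

      normal : Vector Carrier (suc d) → Vector Carrier (suc (suc d))
      normal = complete′ 0#

      normal≉𝟎 : ∀ {α̂} → ¬ α̂ ≋ 𝟎 → ¬ normal α̂ ≋ 𝟎
      normal≉𝟎 {α̂} α̂≉𝟎 eq = α̂≉𝟎 (≋.trans (≋.sym (removeAt-complete′ 0# α̂)) (removeAt-cong p eq))

      from : (∃ λ (α : Vector Carrier (suc d)) → ¬ α ≋ 𝟎) → ∃ λ B → P I B × Q I B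
      from (α̂ , α̂≉𝟎) = through P (normal α̂) (normal≉𝟎 α̂≉𝟎) ,
        refl , trans (∙v (normal α̂)) (trans (+-congˡ (complete∈ 0# α̂)) (+-identityʳ _))

      to-cong : ∀ {x y} → proj₁ x ≈ᵦ proj₁ y → proj₁ (to x) ∼ proj₁ (to y)
      to-cong {(_ , α , β , α≉𝟎 , _ , ⊆H) , _} {(_ , α′ , _ , α′≉𝟎 , H′⊆ , _) , _} (H⊆H′ , _)
        with ρ , ρ≉0 , ρα≋α′ ← Plane-⊆⇒∼ {β = β} α≉𝟎 α′≉𝟎 (λ {x} x∈ → H′⊆ (H⊆H′ (⊆H {x} x∈))) =
        ρ , ρ≉0 , removeAt-cong p ρα≋α′

      normal-∼ : ∀ {α̂ α′} → α̂ ∼ removeAt α′ p → v ∙ α′ ≈ 0# → normal α̂ ∼ α′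
      normal-∼ {α̂} {α′} (ρ , ρ≉0 , ρα̂≋) v∙α′≈0 = ρ , ρ≉0 , unique {0#}
        (trans (∙-* ρ v (normal α̂)) (trans (*-congˡ (complete∈ 0# α̂)) (zeroʳ ρ))) v∙α′≈0
        (λ k → trans (*-congˡ (removeAt-complete′ 0# α̂ k)) (ρα̂≋ k))

      from-cong : ∀ {x y} → proj₁ x ∼ proj₁ y → proj₁ (from x) ≈ᵦ proj₁ (from y)
      from-cong {α̂ , _} {α̂′ , _} α̂∼α̂′ =
        (λ {x} → Plane-∼ {P = P} α∼α′ {x}) , (λ {x} → Plane-∼ {P = P} (∼-sym α∼α′) {x})
        where α∼α′ = normal-∼ {α′ = normal α̂′} (∼-trans α̂∼α̂′ (≋⇒∼ (≋.sym (removeAt-complete′ 0# α̂′)))) (complete∈ 0# α̂′)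

      to∘from : ∀ y → proj₁ (to (from y)) ∼ proj₁ y
      to∘from (α̂ , _) = ≋⇒∼ (removeAt-complete′ 0# α̂)

      from∘to : ∀ x → proj₁ (from (to x)) ≈ᵦ proj₁ x
      from∘to x@(B , P∈ , Q∈) = Setoid.sym blocks {B} {proj₁ (from (to x))}
        (through-unique {P} B P∈ (normal≉𝟎 (proj₂ (to x))) (normal-∼ {α′ = proj₁ (proj₂ B)} ∼-refl (v∙α≈0 B P∈ Q∈)))

    is2Design : Is2Design (AGDesign K (suc (suc d))) (q ℕ.^ suc (suc d)) (q ℕ.^ suc d) (geometricSum q (suc d))
    is2Design = record
      { ∣points∣ = HasCardinality-Vector setoid card (suc (suc d))
      ; ∣block∣  = block-card
      ; ∣join∣   = join-card
      }

-- Invariance under isomorphism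

module _ {𝓓 : IncidenceStructure p₁ p₁′ b₁ ℓ₁ h₁} {𝓔 : IncidenceStructure p₂ p₂′ b₂ ℓ₂ h₂} (i : 𝓓 ≅ 𝓔) where
  private
    module 𝓓 = IncidenceStructure 𝓓
    module 𝓔 = IncidenceStructure 𝓔
    module Dₚ = Setoid 𝓓.points
    module Dᵦ = Setoid 𝓓.blocks
    module Eₚ = Setoid 𝓔.points
    module Eᵦ = Setoid 𝓔.blocks
  open _≅_ i
  private
    module P = Inverse onPoints
    module B = Inverse onBlocks
    module I {P} {B} = Equivalence (incidence P B)

    points-injective : ∀ {P Q} → P.to P 𝓔.≈ₚ P.to Q → P 𝓓.≈ₚ Q
    points-injective eq = Dₚ.trans (Dₚ.sym (P.strictlyInverseʳ _)) (P.inverseʳ eq)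

    blocks-injective : ∀ {B B′} → B.to B 𝓔.≈ᵦ B.to B′ → B 𝓓.≈ᵦ B′
    blocks-injective eq = Dᵦ.trans (Dᵦ.sym (B.strictlyInverseʳ _)) (B.inverseʳ eq)

    points-surjective : ∀ P → P 𝓔.≈ₚ P.to (P.from P)
    points-surjective P = Eₚ.sym (P.strictlyInverseˡ P)

  ≅-Is2Design : ∀ {v k λ′} → Is2Design 𝓔 v k λ′ → Is2Design 𝓓 v k λ′
  ≅-Is2Design is2Design = record
    { ∣points∣ = HasCardinality-≅ onPoints ∣points∣
    ; ∣block∣  = λ B → HasCardinality-≅
        (restrict 𝓓.points 𝓔.points onPoints (λ P≈ → 𝓔.I-resp P≈ Eᵦ.refl) (λ P → incidence P B))
        (∣block∣ (B.to B))
    ; ∣join∣   = λ P Q P≉Q → HasCardinality-≅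
        (restrict 𝓓.blocks 𝓔.blocks onBlocks
          (λ B≈ (P∈ , Q∈) → 𝓔.I-resp Eₚ.refl B≈ P∈ , 𝓔.I-resp Eₚ.refl B≈ Q∈)
          (λ B → mk⇔ (λ (P∈ , Q∈) → I.to P∈ , I.to Q∈) (λ (P∈ , Q∈) → I.from P∈ , I.from Q∈)))
        (∣join∣ (P.to P) (P.to Q) (P≉Q ∘ points-injective))
    }
    where open Is2Design is2Design

  ≅-IsAffine : ∀ {μ} → IsAffine 𝓔 μ → IsAffine 𝓓 μ
  ≅-IsAffine {μ} isAffine = record { meet = meet′ ; parallel = parallel′ }
    where
    open IsAffine isAffine

    meet′ : ∀ B B′ → ¬ B 𝓓.≈ᵦ B′ → 𝓓.Disjoint B B′ ⊎
            HasCardinality (subsetoid 𝓓.points (λ P → P 𝓓.I B × P 𝓓.I B′)) μ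
    meet′ B B′ B≉B′ with meet (B.to B) (B.to B′) (B≉B′ ∘ blocks-injective)
    ... | inj₁ disjoint = inj₁ λ P (P∈B , P∈B′) → disjoint (P.to P) (I.to P∈B , I.to P∈B′)
    ... | inj₂ size = inj₂ (HasCardinality-≅
        (restrict 𝓓.points 𝓔.points onPoints
          (λ P≈ (P∈B , P∈B′) → 𝓔.I-resp P≈ Eᵦ.refl P∈B , 𝓔.I-resp P≈ Eᵦ.refl P∈B′)
          (λ P → mk⇔ (λ (P∈B , P∈B′) → I.to P∈B , I.to P∈B′) (λ (P∈B , P∈B′) → I.from P∈B , I.from P∈B′)))
        size)

    parallel′ : ∀ P B → ¬ P 𝓓.I B → ∃ λ B′ → (P 𝓓.I B′ × 𝓓.Disjoint B B′) ×
                (∀ B″ → P 𝓓.I B″ × 𝓓.Disjoint B B″ → B″ 𝓓.≈ᵦ B′)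
    parallel′ P B P∉B with B′ , (P∈B′ , disjoint) , unique ← parallel (P.to P) (B.to B) (P∉B ∘ I.from) =
      B.from B′ ,
      ( I.from (𝓔.I-resp Eₚ.refl (Eᵦ.sym (B.strictlyInverseˡ B′)) P∈B′)
      , λ Q (Q∈B , Q∈B′) → disjoint (P.to Q) (I.to Q∈B , 𝓔.I-resp Eₚ.refl (B.strictlyInverseˡ B′) (I.to Q∈B′)) ) ,
      λ B″ (P∈B″ , disjoint″) → Dᵦ.sym (B.inverseʳ (Eᵦ.sym (unique (B.to B″)
        ( I.to P∈B″
        , λ Q (Q∈B , Q∈B″) → disjoint″ (P.from Q)
            ( I.from (𝓔.I-resp (points-surjective Q) Eᵦ.refl Q∈B)
            , I.from (𝓔.I-resp (points-surjective Q) Eᵦ.refl Q∈B″) )))))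

-- The group G acting on affine points

-- `_∷ʳ_` recurses on the length, so for a variable length its entries do not compute; these
-- equations replace the missing reductions when the rows of D are read off.
init-∷ʳ : ∀ {A : Set a} {n} (xs : Vector A n) x k → (xs ∷ʳ x) (inject₁ k) ≡ xs k
init-∷ʳ {n = suc n} xs x zero    = ≡.refl
init-∷ʳ {n = suc n} xs x (suc k) = init-∷ʳ (tail xs) x k

last-∷ʳ : ∀ {A : Set a} {n} (xs : Vector A n) x → last (xs ∷ʳ x) ≡ x
last-∷ʳ {n = zero}  xs x = ≡.refl
last-∷ʳ {n = suc n} xs x = last-∷ʳ (tail xs) x

module _ {A : Set a} {n : ℕ} (x : Vector A n) (u v : A) where

  ∷ʳ²-init : ∀ k → (x ∷ʳ u ∷ʳ v) (inject₁ (inject₁ k)) ≡ x k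
  ∷ʳ²-init k = ≡.trans (init-∷ʳ (x ∷ʳ u) v (inject₁ k)) (init-∷ʳ x u k)

  ∷ʳ²-penultimate : (x ∷ʳ u ∷ʳ v) (inject₁ (fromℕ n)) ≡ u
  ∷ʳ²-penultimate = ≡.trans (init-∷ʳ (x ∷ʳ u) v (fromℕ n)) (last-∷ʳ x u)

  ∷ʳ²-last : (x ∷ʳ u ∷ʳ v) (fromℕ (suc n)) ≡ v
  ∷ʳ²-last = last-∷ʳ (x ∷ʳ u) v

module MatrixProperties (F : Field c ℓ) where
  open LinearAlgebra F hiding (zero)
  open DotProduct F
  open import Algebra.Properties.Semiring.Sum semiring
    using (sum-cong-≋; ∑-comm; *-distribˡ-sum; *-distribʳ-sum; sum-remove; sum-replicate-zero; sum-init-last)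
  open import Relation.Binary.Reasoning.Setoid setoid

  𝟏-diagonal : ∀ {n} (k : Fin n) → 𝟏 k k ≡ 1#
  𝟏-diagonal k rewrite dec-true (k Fin.≟ k) ≡.refl = ≡.refl

  𝟏-off : ∀ {n} {k l : Fin n} → k ≢ l → 𝟏 k l ≡ 0#
  𝟏-off {k = k} {l} k≢l rewrite dec-false (k Fin.≟ l) k≢l = ≡.refl

  𝟏-inject₁ : ∀ {n} (k l : Fin n) → 𝟏 (inject₁ k) (inject₁ l) ≡ 𝟏 k l
  𝟏-inject₁ k l with k Fin.≟ l
  ... | yes ≡.refl = 𝟏-diagonal (inject₁ k)
  ... | no  k≢l    = 𝟏-off (k≢l ∘ Fin.inject₁-injective)

  𝟏-inject₁-fromℕ : ∀ {n} (k : Fin n) → 𝟏 (inject₁ k) (fromℕ n) ≡ 0#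
  𝟏-inject₁-fromℕ k = 𝟏-off {k = inject₁ k} (Fin.fromℕ≢inject₁ ∘ ≡.sym)

  𝟏-fromℕ-inject₁ : ∀ {n} (k : Fin n) → 𝟏 (fromℕ n) (inject₁ k) ≡ 0#
  𝟏-fromℕ-inject₁ k = 𝟏-off {l = inject₁ k} Fin.fromℕ≢inject₁

  ·-identityʳ : ∀ {n} (X : Vector Carrier n) → X · 𝟏 ≋ X
  ·-identityʳ {suc n} X l = begin
    (X · 𝟏) l                                                 ≈⟨ sum-remove {i = l} (λ k → X k * 𝟏 k l) ⟩
    X l * 𝟏 l l + sum (λ k → X (punchIn l k) * 𝟏 (punchIn l k) l)
      ≈⟨ +-cong (trans (*-congˡ (reflexive (𝟏-diagonal l))) (*-identityʳ _))
                (trans (sum-cong-≋ λ k → trans (*-congˡ (reflexive (𝟏-off (Fin.punchInᵢ≢i l k)))) (zeroʳ _)) (sum-replicate-zero n)) ⟩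
    X l + 0#                                                  ≈⟨ +-identityʳ _ ⟩
    X l                                                       ∎

  ·-congʳ : ∀ {m n} {X Y : Vector Carrier m} {M : Matrix m n} → X ≋ Y → X · M ≋ Y · M
  ·-congʳ X≋Y l = sum-cong-≋ λ k → *-congʳ (X≋Y k)

  ·-congˡ : ∀ {m n} {X : Vector Carrier m} {M M′ : Matrix m n} → (∀ k → M k ≋ M′ k) → X · M ≋ X · M′
  ·-congˡ M≋M′ l = sum-cong-≋ λ k → *-congˡ (M≋M′ k l)

  ·-assoc : ∀ {m n o} (X : Vector Carrier m) (M : Matrix m n) (M′ : Matrix n o) → (X · M) · M′ ≋ X · (M ⊗ M′)
  ·-assoc X M M′ l = begin
    sum (λ k → sum (λ j → X j * M j k) * M′ k l)    ≈⟨ sum-cong-≋ (λ k → *-distribʳ-sum (M′ k l) (λ j → X j * M j k)) ⟩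
    sum (λ k → sum (λ j → X j * M j k * M′ k l))    ≈⟨ ∑-comm (λ k j → X j * M j k * M′ k l) ⟩
    sum (λ j → sum (λ k → X j * M j k * M′ k l))    ≈⟨ sum-cong-≋ (λ j → sum-cong-≋ λ k → *-assoc (X j) (M j k) (M′ k l)) ⟩
    sum (λ j → sum (λ k → X j * (M j k * M′ k l)))  ≈⟨ sum-cong-≋ (λ j → sym (*-distribˡ-sum (X j) (λ k → M j k * M′ k l))) ⟩
    sum (λ j → X j * sum (λ k → M j k * M′ k l))    ∎

  *-· : ∀ {m n} ρ (X : Vector Carrier m) (M : Matrix m n) l → ((λ k → ρ * X k) · M) l ≈ ρ * (X · M) l
  *-· ρ X M l = *-∙ ρ X (λ k → M k l)

  ·-init-last : ∀ {m n} (X : Vector Carrier (suc m)) (M : Matrix (suc m) n) l →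
                (X · M) l ≈ (init X · init M) l + last X * last M l
  ·-init-last X M l = sum-init-last (λ k → X k * M k l)

  ≋-init-last : ∀ {n} {X Y : Vector Carrier (suc n)} → init X ≋ init Y → last X ≈ last Y → X ≋ Y
  ≋-init-last init≋ last≈ k with view k
  ... | ‵fromℕ     = last≈
  ... | ‵inject₁ k = init≋ k

  sum-++ : ∀ m {n} (t : Vector Carrier (m ℕ.+ n)) →
           sum t ≈ sum (λ i → t (i ↑ˡ n)) + sum (λ i → t (m ↑ʳ i))
  sum-++ zero    t = sym (+-identityˡ _)
  sum-++ (suc m) t = trans (+-congˡ (sum-++ m (tail t))) (sym (+-assoc _ _ _))

module GroupAction (q : ℕ) (F : Field c ℓ) (m : ℕ) where
  open LinearAlgebra F hiding (zero)
  open DotProduct F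
  open MatrixProperties F
  open Construction q F m
  open import Algebra.Properties.Semiring.Sum semiring using (sum-cong-≋; sum-replicate-zero)
  open import Relation.Binary.Reasoning.Setoid setoid

  module _ (i : Vector Carrier n) (j : Vector Carrier m) where
    private
      rows : Matrix m (suc n)
      rows k = 𝟏 k ∷ʳ j k ∷ʳ 0#

      row-n : Vector Carrier (suc n)
      row-n = 𝟎 ∷ʳ 1# ∷ʳ 0#

      row-last : Vector Carrier (suc n)
      row-last = i ∷ʳ 1#

    D-rows : ∀ k → D i j (inject₁ (inject₁ k)) ≡ rows k
    D-rows k = ≡.trans (init-∷ʳ (rows ∷ʳ row-n) row-last (inject₁ k)) (init-∷ʳ rows row-n k)

    D-row-n : D i j (inject₁ (fromℕ m)) ≡ row-n
    D-row-n = ≡.trans (init-∷ʳ (rows ∷ʳ row-n) row-last (fromℕ m)) (last-∷ʳ rows row-n)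

    D-row-last : D i j (fromℕ n) ≡ row-last
    D-row-last = last-∷ʳ (rows ∷ʳ row-n) row-last

    private
      ·D : ∀ (X : Vector Carrier (suc n)) l →
           (X · D i j) l ≈ sum (λ k → init (init X) k * rows k l) + last (init X) * row-n l + last X * row-last l
      ·D X l = trans (·-init-last X (D i j) l) (+-cong
        (trans (·-init-last (init X) (init (D i j)) l)
          (+-cong (sum-cong-≋ λ k → *-congˡ {init (init X) k} (reflexive (≡.cong (λ M → M l) (D-rows k))))
                  (*-congˡ (reflexive (≡.cong (λ M → M l) D-row-n)))))
        (*-congˡ (reflexive (≡.cong (λ M → M l) D-row-last))))

    ·D-init : ∀ X l → (X · D i j) (inject₁ (inject₁ l)) ≈ init (init X) l + last X * init i l
    ·D-init X l = begin
      (X · D i j) (inject₁ (inject₁ l))    ≈⟨ ·D X _ ⟩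
      sum (λ k → x k * rows k (inject₁ (inject₁ l))) + u * row-n (inject₁ (inject₁ l)) + v * row-last (inject₁ (inject₁ l))
        ≈⟨ +-cong (+-cong (sum-cong-≋ λ k → *-congˡ {x k} (reflexive (∷ʳ²-init (𝟏 k) (j k) 0# l))) (*-congˡ (reflexive (∷ʳ²-init (𝟎 {m}) 1# 0# l))))
                  (*-congˡ (reflexive (init-∷ʳ i 1# (inject₁ l)))) ⟩
      (x · 𝟏) l + u * 0# + v * init i l    ≈⟨ +-congʳ (+-cong (·-identityʳ x l) (zeroʳ u)) ⟩
      x l + 0# + v * init i l              ≈⟨ +-congʳ (+-identityʳ _) ⟩
      x l + v * init i l                   ∎
      where
      x = init (init X)
      u = last (init X)
      v = last X

    ·D-n : ∀ X → (X · D i j) (inject₁ (fromℕ m)) ≈ init (init X) ∙ j + last (init X) + last X * last i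
    ·D-n X = begin
      (X · D i j) (inject₁ (fromℕ m))      ≈⟨ ·D X _ ⟩
      sum (λ k → x k * rows k (inject₁ (fromℕ m))) + u * row-n (inject₁ (fromℕ m)) + v * row-last (inject₁ (fromℕ m))
        ≈⟨ +-cong (+-cong (sum-cong-≋ λ k → *-congˡ {x k} (reflexive (∷ʳ²-penultimate (𝟏 k) (j k) 0#))) (*-congˡ (reflexive (∷ʳ²-penultimate (𝟎 {m}) 1# 0#))))
                  (*-congˡ (reflexive (init-∷ʳ i 1# (fromℕ m)))) ⟩
      x ∙ j + u * 1# + v * last i          ≈⟨ +-congʳ (+-congˡ (*-identityʳ u)) ⟩
      x ∙ j + u + v * last i               ∎
      where
      x = init (init X)
      u = last (init X)
      v = last X

    ·D-last : ∀ X → (X · D i j) (fromℕ n) ≈ last X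
    ·D-last X = begin
      (X · D i j) (fromℕ n)                ≈⟨ ·D X _ ⟩
      sum (λ k → x k * rows k (fromℕ n)) + u * row-n (fromℕ n) + v * row-last (fromℕ n)
        ≈⟨ +-cong (+-cong (sum-cong-≋ λ k → trans (*-congˡ {x k} (reflexive (∷ʳ²-last (𝟏 k) (j k) 0#))) (zeroʳ _)) (*-congˡ (reflexive (∷ʳ²-last (𝟎 {m}) 1# 0#))))
                  (*-congˡ (reflexive (last-∷ʳ i 1#))) ⟩
      sum {m} (λ k → 0#) + u * 0# + v * 1# ≈⟨ +-cong (+-cong (sum-replicate-zero m) (zeroʳ u)) (*-identityʳ v) ⟩
      0# + 0# + v                          ≈⟨ trans (+-congʳ (+-identityʳ 0#)) (+-identityˡ v) ⟩
      v                                    ∎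
      where
      x = init (init X)
      u = last (init X)
      v = last X

  init-homogeneous : ∀ x → init (homogeneous x) ≋ x
  init-homogeneous x k = reflexive (init-∷ʳ x 1# k)

  last-homogeneous : ∀ x → last (homogeneous x) ≈ 1#
  last-homogeneous x = reflexive (last-∷ʳ x 1#)

  -- The affine map that D i j induces; an element of G acts by its inverse.
  transform : Vector Carrier n → Vector Carrier m → AG → AG
  transform i j y = (λ k → init y k + init i k) ∷ʳ (last y + init y ∙ j + last i)

  homogeneous-·D : ∀ i j y → homogeneous y · D i j ≋ homogeneous (transform i j y)
  homogeneous-·D i j y = ≋-init-last
    (≋-init-last
      (λ l → trans (·D-init i j Y l) (trans (+-cong (y≋ (inject₁ l)) (trans (*-congʳ Yₗ≈1) (*-identityˡ _)))
        (sym (trans (init-homogeneous T (inject₁ l)) (reflexive (init-∷ʳ _ _ l))))))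
      (trans (·D-n i j Y) (trans
        (+-cong (trans (+-comm _ _) (+-cong (y≋ (fromℕ m)) (∙-congʳ {x = j} (y≋ ∘ inject₁)))) (trans (*-congʳ Yₗ≈1) (*-identityˡ _)))
        (sym (trans (init-homogeneous T (fromℕ m)) (reflexive (last-∷ʳ (λ k → init y k + init i k) _)))))))
    (trans (·D-last i j Y) (trans Yₗ≈1 (sym (last-homogeneous T))))
    where
    Y = homogeneous y
    T = transform i j y
    y≋ = init-homogeneous y
    Yₗ≈1 = last-homogeneous y

  homogeneous-cong : ∀ {x y : AG} → x ≋ y → homogeneous x ≋ homogeneous y
  homogeneous-cong {x} {y} x≋y = ≋-init-last
    (λ k → trans (init-homogeneous x k) (trans (x≋y k) (sym (init-homogeneous y k))))
    (trans (last-homogeneous x) (sym (last-homogeneous y)))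

  homogeneous-injective : ∀ {x y : AG} → homogeneous x ≋ homogeneous y → x ≋ y
  homogeneous-injective {x} {y} eq k =
    trans (sym (init-homogeneous x k)) (trans (eq (inject₁ k)) (init-homogeneous y k))

  -- Multiplying by D moves the inverse matrix to the other side. Both sides then end in the
  -- coordinate 1, which forces the projective scalar to be 1.
  ↦⇔transform : ∀ g x y → g ∶ x ↦ y ⇔ x ≋ transform (G.i g) (G.j g) y
  ↦⇔transform g x y = mk⇔ to from
    where
    open G g
    X = homogeneous x
    Y = homogeneous y
    T = homogeneous (transform i j y)

    to : g ∶ x ↦ y → x ≋ transform i j y
    to (ρ , _ , ρY≋XD⁻¹) = homogeneous-injective λ k → trans (X≋ρT k) (trans (*-congʳ ρ≈1) (*-identityˡ _))
      where
      X≋ρT : X ≋ (λ k → ρ * T k)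
      X≋ρT k = begin
        X k                          ≈⟨ ·-identityʳ X k ⟨
        (X · 𝟏) k                    ≈⟨ ·-congˡ {X = X} (proj₁ isInverse) k ⟨
        (X · (D⁻¹ ⊗ D i j)) k        ≈⟨ ·-assoc X D⁻¹ (D i j) k ⟨
        ((X · D⁻¹) · D i j) k        ≈⟨ ·-congʳ {M = D i j} ρY≋XD⁻¹ k ⟨
        ((λ k → ρ * Y k) · D i j) k  ≈⟨ *-· ρ Y (D i j) k ⟩
        ρ * (Y · D i j) k            ≈⟨ *-congˡ (homogeneous-·D i j y k) ⟩
        ρ * T k                      ∎
      ρ≈1 : ρ ≈ 1#
      ρ≈1 = begin
        ρ           ≈⟨ *-identityʳ ρ ⟨
        ρ * 1#      ≈⟨ *-congˡ (last-homogeneous (transform i j y)) ⟨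
        ρ * last T  ≈⟨ X≋ρT (fromℕ n) ⟨
        last X      ≈⟨ last-homogeneous x ⟩
        1#          ∎

    from : x ≋ transform i j y → g ∶ x ↦ y
    from x≋ = ≋⇒∼ λ k → begin
      Y k                          ≈⟨ ·-identityʳ Y k ⟨
      (Y · 𝟏) k                    ≈⟨ ·-congˡ {X = Y} (proj₂ isInverse) k ⟨
      (Y · (D i j ⊗ D⁻¹)) k        ≈⟨ ·-assoc Y (D i j) D⁻¹ k ⟨
      ((Y · D i j) · D⁻¹) k        ≈⟨ ·-congʳ {M = D⁻¹} (homogeneous-·D i j y) k ⟩
      (T · D⁻¹) k                  ≈⟨ ·-congʳ {M = D⁻¹} (homogeneous-cong {x} x≋) k ⟨
      (X · D⁻¹) k                  ∎

  -- With j = 0 only the last row of D differs from the identity, and the product adds the last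
  -- rows. The hypothesis is symmetric in effect, so both one-sided inverses follow from this lemma.
  D-translation-inverse : ∀ {i i′ : Vector Carrier n} → (∀ k → i k + i′ k ≈ 0#) → ∀ k → (D i 𝟎 ⊗ D i′ 𝟎) k ≋ 𝟏 k
  D-translation-inverse {i} {i′} i+i′≈0 k with view k
  ... | ‵fromℕ = ≋-init-last
    (≋-init-last
      (λ l → trans (·D-init i′ 𝟎 R l) (trans (+-cong (R≈ (inject₁ l)) (trans (*-congʳ Rₗ≈1) (*-identityˡ _)))
               (trans (i+i′≈0 (inject₁ l)) (reflexive (≡.sym (𝟏-fromℕ-inject₁ (inject₁ l)))))))
      (trans (·D-n i′ 𝟎 R) (trans (+-cong (trans (+-congʳ (trans (∙-comm (init (init R)) 𝟎) (𝟎-∙ (init (init R))))) (trans (+-identityˡ _) (R≈ (fromℕ m))))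
                                          (trans (*-congʳ Rₗ≈1) (*-identityˡ _)))
               (trans (i+i′≈0 (fromℕ m)) (reflexive (≡.sym (𝟏-fromℕ-inject₁ (fromℕ m))))))))
    (trans (·D-last i′ 𝟎 R) (trans Rₗ≈1 (reflexive (≡.sym (𝟏-diagonal (fromℕ n))))))
    where
    R = D i 𝟎 (fromℕ n)
    R≈ : ∀ l → R (inject₁ l) ≈ i l
    R≈ l = reflexive (≡.trans (≡.cong (λ M → M (inject₁ l)) (D-row-last i 𝟎)) (init-∷ʳ i 1# l))
    Rₗ≈1 : last R ≈ 1#
    Rₗ≈1 = reflexive (≡.trans (≡.cong last (D-row-last i 𝟎)) (last-∷ʳ i 1#))
  ... | ‵inject₁ k′ = ≋-init-last
    (≋-init-last
      (λ l → trans (·D-init i′ 𝟎 R l) (trans (+-congˡ (trans (*-congʳ Rₗ≈0) (zeroˡ _))) (trans (+-identityʳ _) (R≈𝟏 (inject₁ l)))))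
      (trans (·D-n i′ 𝟎 R) (trans (+-cong (trans (+-congʳ (trans (∙-comm (init (init R)) 𝟎) (𝟎-∙ (init (init R))))) (+-identityˡ _))
                                          (trans (*-congʳ Rₗ≈0) (zeroˡ _)))
        (trans (+-identityʳ _) (R≈𝟏 (fromℕ m))))))
    (trans (·D-last i′ 𝟎 R) (trans Rₗ≈0 (reflexive (≡.sym (𝟏-inject₁-fromℕ k′)))))
    where
    R = D i 𝟎 (inject₁ k′)
    row : (∀ l → init R l ≈ 𝟏 k′ l) × last R ≈ 0#
    row with view k′
    ... | ‵fromℕ = ≋-init-last
            (λ l → reflexive (≡.trans (≡.trans (row-n (inject₁ (inject₁ l))) (∷ʳ²-init (𝟎 {m}) 1# 0# l)) (≡.sym (𝟏-fromℕ-inject₁ l))))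
            (reflexive (≡.trans (≡.trans (row-n (inject₁ (fromℕ m))) (∷ʳ²-penultimate (𝟎 {m}) 1# 0#)) (≡.sym (𝟏-diagonal (fromℕ m)))))
          , reflexive (≡.trans (row-n (fromℕ n)) (∷ʳ²-last (𝟎 {m}) 1# 0#))
      where
      row-n : ∀ l → D i 𝟎 (inject₁ (fromℕ m)) l ≡ (𝟎 ∷ʳ 1# ∷ʳ 0#) l
      row-n l = ≡.cong (λ M → M l) (D-row-n i 𝟎)
    ... | ‵inject₁ k″ = ≋-init-last
            (λ l → reflexive (≡.trans (≡.trans (row-k (inject₁ (inject₁ l))) (∷ʳ²-init (𝟏 k″) 0# 0# l)) (≡.sym (𝟏-inject₁ k″ l))))
            (reflexive (≡.trans (≡.trans (row-k (inject₁ (fromℕ m))) (∷ʳ²-penultimate (𝟏 k″) 0# 0#)) (≡.sym (𝟏-inject₁-fromℕ k″))))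
          , reflexive (≡.trans (row-k (fromℕ n)) (∷ʳ²-last (𝟏 k″) 0# 0#))
      where
      row-k : ∀ l → D i 𝟎 (inject₁ (inject₁ k″)) l ≡ (𝟏 k″ ∷ʳ 0# ∷ʳ 0#) l
      row-k l = ≡.cong (λ M → M l) (D-rows i 𝟎 k″)
    R≈𝟏 : ∀ l → R (inject₁ l) ≈ 𝟏 (inject₁ k′) (inject₁ l)
    R≈𝟏 l = trans (proj₁ row l) (reflexive (≡.sym (𝟏-inject₁ k′ l)))
    Rₗ≈0 = proj₂ row

  -- Translations are the only elements of G that have to be exhibited: they suffice to connect the
  -- points of an N-orbit and to realise every hyperplane as a block.
  translation : Vector Carrier n → G
  translation i = record
    { i = i
    ; j = 𝟎
    ; D⁻¹ = D (λ k → - i k) 𝟎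
    ; isInverse = D-translation-inverse (λ k → -‿inverseˡ (i k)) , D-translation-inverse (λ k → -‿inverseʳ (i k))
    }

  -- As g sends x to y exactly when x = T y, the image under g is the preimage under T: the equation
  -- of the image arises by substitution.
  image⇔ : ∀ g {A : Pred AG r} → (∀ {x y} → x ≋ y → A x → A y) →
           ∀ y → image g A y ⇔ A (transform (G.i g) (G.j g) y)
  image⇔ g resp y = mk⇔
    (λ (x , x∈A , x↦y) → resp (Equivalence.to (↦⇔transform g x y) x↦y) x∈A)
    (λ Ty∈A → T y , Ty∈A , Equivalence.from (↦⇔transform g (T y) y) ≋.refl)
    where T = transform (G.i g) (G.j g)

-- The Hermitian form and the coordinates of 𝒮

primePower⇒>1 : ∀ {q} → PrimePower q → 1 < q
primePower⇒>1 (π , suc e , pr , _ , ≡.refl) =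
  ℕ.<-≤-trans (ℕ.nonTrivial⇒n>1 π) (ℕ.m≤m*n π (π ℕ.^ e))
  where
  instance
    _ = prime⇒nonTrivial pr
    _ = prime⇒nonZero pr
    _ = ℕ.m^n≢0 π e

m*m≡n*n⇒m≡n : ∀ {m n} → m ℕ.* m ≡ n ℕ.* n → m ≡ n
m*m≡n*n⇒m≡n {m} {n} eq with ℕ.<-cmp m n
... | tri< m<n _ _ = contradiction eq (ℕ.<⇒≢ (ℕ.*-mono-< m<n m<n))
... | tri≈ _ m≡n _ = m≡n
... | tri> _ _ n<m = contradiction (≡.sym eq) (ℕ.<⇒≢ (ℕ.*-mono-< n<m n<m))

splitAt-elim : ∀ m {n} (P : Pred (Fin (m ℕ.+ n)) p) →
               (∀ i → P (i ↑ˡ n)) → (∀ j → P (m ↑ʳ j)) → ∀ k → P k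
splitAt-elim m {n} P l r k with splitAt m k | Fin.join-splitAt m n k
... | inj₁ i | ≡.refl = l i
... | inj₂ j | ≡.refl = r j

-- From coordinates of affine points to an isomorphism of designs

module _ (q : ℕ) (F : Field c ℓ) (m : ℕ) (K : Field c′ ℓ′) (d : ℕ) where
  open Construction q F m using (AG; N-orbit; IsBlock)
  open LinearAlgebra K using (_≋_; 𝟎)
  open DotProduct K using (Plane)
  private
    module K = LinearAlgebra K
    module KD = DotProduct K
    module 𝒮 = IncidenceStructure (𝒮 q F m)
    module 𝒜 = IncidenceStructure (AGDesign K d)

  -- It is enough to have a map on affine points that is onto, has the N-orbits as fibres, and under
  -- which the blocks are exactly the full preimages of hyperplanes.
  module _
    (coordinates : AG → Vector (Field.Carrier K) d)
    (fromCoordinates : Vector (Field.Carrier K) d → AG)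
    (coordinates-fromCoordinates : ∀ v → coordinates (fromCoordinates v) ≋ v)
    (N-orbit⇔coordinates : ∀ x y → N-orbit x y ⇔ coordinates x ≋ coordinates y)
    (block⇒plane : (B : ∃ IsBlock) → ∃₂ λ α β → ¬ α ≋ 𝟎 × (∀ y → proj₁ B y ⇔ Plane α β (coordinates y)))
    (plane⇒block : ∀ α β → ¬ α ≋ 𝟎 → ∃ λ (B : ∃ IsBlock) → ∀ y → proj₁ B y ⇔ Plane α β (coordinates y))
    where

    onPoints : Inverse 𝒮.points 𝒜.points
    onPoints = mkInverse 𝒮.points 𝒜.points to from
      (λ {P} {P′} → to-cong {P} {P′}) (λ {v} {w} → from-cong {v} {w}) coordinates-fromCoordinates from∘to
      where
      module ⇔ {x y} = Equivalence (N-orbit⇔coordinates x y)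
      to : 𝒮.Point → 𝒜.Point
      to (_ , x , _) = coordinates x
      from : 𝒜.Point → 𝒮.Point
      from v = N-orbit (fromCoordinates v) , fromCoordinates v , (λ y∈ → y∈) , (λ y∈ → y∈)
      to-cong : ∀ {P P′} → P 𝒮.≈ₚ P′ → to P K.≋ to P′
      to-cong {_ , x , _ , N⊆P} {_ , x′ , P′⊆N , _} (P⊆P′ , _) =
        KD.≋.sym (⇔.to {x′} {x} (P′⊆N (P⊆P′ (N⊆P (⇔.from {x} {x} KD.≋.refl)))))
      from-cong : ∀ {v w} → v K.≋ w → from v 𝒮.≈ₚ from w
      from-cong {v} {w} v≋w =
        (λ {y} y∈ → ⇔.from (KD.≋.trans (KD.≋.sym eq) (⇔.to y∈))) , (λ {y} y∈ → ⇔.from (KD.≋.trans eq (⇔.to y∈)))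
        where
        eq : coordinates (fromCoordinates v) K.≋ coordinates (fromCoordinates w)
        eq = KD.≋.trans (coordinates-fromCoordinates v) (KD.≋.trans v≋w (KD.≋.sym (coordinates-fromCoordinates w)))
      from∘to : ∀ P → from (to P) 𝒮.≈ₚ P
      from∘to (P , x , P⊆N , N⊆P) =
        (λ {y} y∈ → N⊆P (⇔.from (KD.≋.trans (KD.≋.sym eq) (⇔.to y∈)))) , (λ {y} y∈ → ⇔.from (KD.≋.trans eq (⇔.to (P⊆N y∈))))
        where eq = coordinates-fromCoordinates (coordinates x)

    onBlocks : Inverse 𝒮.blocks 𝒜.blocks
    onBlocks = mkInverse 𝒮.blocks 𝒜.blocks to from
      (λ {B} {B′} → to-cong {B} {B′}) (λ {H} {H′} → from-cong {H} {H′}) to∘from from∘to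
      where
      Plane-resp : ∀ {α β v w} → v K.≋ w → KD.Plane α β v → KD.Plane α β w
      Plane-resp {α} v≋w v∈ = K.trans (KD.∙-congˡ {α = α} (KD.≋.sym v≋w)) v∈
      to : 𝒮.Block → 𝒜.Block
      to B = let α , β , α≉𝟎 , _ = block⇒plane B in KD.Plane α β , α , β , α≉𝟎 , (λ v∈ → v∈) , (λ v∈ → v∈)
      from : 𝒜.Block → 𝒮.Block
      from (_ , α , β , α≉𝟎 , _) = proj₁ (plane⇒block α β α≉𝟎)
      module T (B : 𝒮.Block) (y : AG) = Equivalence (proj₂ (proj₂ (proj₂ (block⇒plane B))) y)
      from⇔ : ∀ H y → proj₁ (from H) y ⇔ Plane (proj₁ (proj₂ H)) (proj₁ (proj₂ (proj₂ H))) (coordinates y)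
      from⇔ (_ , α , β , α≉𝟎 , _) = proj₂ (plane⇒block α β α≉𝟎)
      module F (H : 𝒜.Block) (y : AG) = Equivalence (from⇔ H y)

      -- Surjectivity of `coordinates` enters here: over each v lies an affine point at which the
      -- inclusion of the blocks can be applied.
      to-⊆ : ∀ B B′ → proj₁ B ⊆ proj₁ B′ → proj₁ (to B) ⊆ proj₁ (to B′)
      to-⊆ B B′ B⊆B′ {v} v∈ = Plane-resp {α′} (coordinates-fromCoordinates v)
        (T.to B′ y (B⊆B′ (T.from B y (Plane-resp {α} (KD.≋.sym (coordinates-fromCoordinates v)) v∈))))
        where
        y = fromCoordinates v
        α = proj₁ (block⇒plane B)
        α′ = proj₁ (block⇒plane B′)
      to-cong : ∀ {B B′} → B 𝒮.≈ᵦ B′ → to B 𝒜.≈ᵦ to B′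
      to-cong {B} {B′} (B⊆B′ , B′⊆B) = (λ {v} → to-⊆ B B′ B⊆B′ {v}) , (λ {v} → to-⊆ B′ B B′⊆B {v})
      from-⊆ : ∀ H H′ → proj₁ H ⊆ proj₁ H′ → proj₁ (from H) ⊆ proj₁ (from H′)
      from-⊆ H@(_ , _ , _ , _ , _ , ⊆H) H′@(_ , _ , _ , _ , H′⊆ , _) H⊆H′ {y} y∈ =
        F.from H′ y (H′⊆ (H⊆H′ (⊆H (F.to H y y∈))))
      from-cong : ∀ {H H′} → H 𝒜.≈ᵦ H′ → from H 𝒮.≈ᵦ from H′
      from-cong {H} {H′} (H⊆H′ , H′⊆H) = from-⊆ H H′ H⊆H′ , from-⊆ H′ H H′⊆H
      to∘from : ∀ H → to (from H) 𝒜.≈ᵦ H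
      to∘from H@(_ , α , β , _ , H⊆ , ⊆H) =
        (λ {v} v∈ → let y = fromCoordinates v ; y≋v = coordinates-fromCoordinates v in
          ⊆H (Plane-resp {α} y≋v (F.to H y (T.from (from H) y (Plane-resp {α′} (KD.≋.sym y≋v) v∈))))) ,
        (λ {v} v∈ → let y = fromCoordinates v ; y≋v = coordinates-fromCoordinates v in
          Plane-resp {α′} y≋v (T.to (from H) y (F.from H y (Plane-resp {α} (KD.≋.sym y≋v) (H⊆ v∈)))))
        where α′ = proj₁ (block⇒plane (from H))
      from∘to : ∀ B → from (to B) 𝒮.≈ᵦ B
      from∘to B = (λ {y} y∈ → T.from B y (F.to (to B) y y∈)) , (λ {y} y∈ → F.from (to B) y (T.to B y y∈))

    -- The coordinates are constant on an orbit, so a block contains the whole orbit as soon as it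
    -- contains the representative x.
    incidence : ∀ P B → P 𝒮.I B ⇔ Inverse.to onPoints P 𝒜.I Inverse.to onBlocks B
    incidence (P , x , P⊆N , N⊆P) B@(_ , _) = mk⇔
      (λ P⊆B → B⇔.to x (P⊆B (N⊆P (⇔.from {x} {x} KD.≋.refl))))
      (λ x∈ {y} y∈P → B⇔.from y (K.trans (KD.∙-congˡ {α = α} (KD.≋.sym (⇔.to {x} {y} (P⊆N y∈P)))) x∈))
      where
      module ⇔ {x y} = Equivalence (N-orbit⇔coordinates x y)
      α = proj₁ (block⇒plane B)
      module B⇔ y = Equivalence (proj₂ (proj₂ (proj₂ (block⇒plane B))) y)

    coordinates⇒≅ : 𝒮 q F m ≅ AGDesign K d
    coordinates⇒≅ = record { onPoints = onPoints ; onBlocks = onBlocks ; incidence = incidence }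

-- The conjugation x ↦ x^q and its fixed field

module Conjugation (F : Field c ℓ) {q : ℕ} (primePower : PrimePower q) (card : HasOrder F (q ℕ.^ 2)) where
  open LinearAlgebra F hiding (zero)
  open DotProduct F
  open FieldProperties F
  open MatrixProperties F
  open FiniteFieldProperties F card using (_≟_; element; characteristic; x^order≈x)
  open import Algebra.Properties.Semiring.Exp semiring using (^-assocʳ; ^-congˡ; ^-congʳ)
  open import Algebra.Properties.CommutativeSemiring.Exp commutativeSemiring using (^-distrib-*)
  open import Algebra.Properties.Group +-group using (identityʳ-unique; inverseʳ-unique)
  open ℤ-RingSolver commutativeRing using (solve; _:=_; _:+_; _:-_; _:*_; :-_)
  open import Relation.Binary.Reasoning.Setoid setoid

  1<q : 1 < q
  1<q = primePower⇒>1 primePower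

  bar : Carrier → Carrier
  bar x = x ^ q

  bar-cong : ∀ {x y} → x ≈ y → bar x ≈ bar y
  bar-cong = ^-congˡ q

  bar-* : ∀ x y → bar (x * y) ≈ bar x * bar y
  bar-* x y = ^-distrib-* x y q

  -- With q = π^e the order of F is π^(2e), so π is the characteristic and `bar` is an iterate of
  -- the Frobenius map.
  bar-+ : ∀ x y → bar (x + y) ≈ bar x + bar y
  bar-+ x y = let π , e , pr , _ , q≡πᵉ = primePower in
    ≡.subst (λ q → (x + y) ^ q ≈ x ^ q + y ^ q) (≡.sym q≡πᵉ)
      (frobeniusⁿ-+ commutativeSemiring pr
        (characteristic {k = e ℕ.* 2} (≡.trans (≡.cong (ℕ._^ 2) q≡πᵉ) (ℕ.^-*-assoc π e 2))) e x y)

  bar-bar : ∀ x → bar (bar x) ≈ x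
  bar-bar x = begin
    (x ^ q) ^ q    ≈⟨ ^-assocʳ x q q ⟩
    x ^ (q ℕ.* q)  ≈⟨ ^-congʳ x (≡.cong (q ℕ.*_) (ℕ.*-identityʳ q)) ⟨
    x ^ (q ℕ.^ 2)  ≈⟨ x^order≈x x ⟩
    x              ∎

  bar-0 : bar 0# ≈ 0#
  bar-0 = identityʳ-unique (bar 0#) (bar 0#) (trans (sym (bar-+ 0# 0#)) (bar-cong (+-identityˡ 0#)))

  bar-neg : ∀ x → bar (- x) ≈ - bar x
  bar-neg x = inverseʳ-unique (bar x) (bar (- x)) (trans (sym (bar-+ x (- x))) (trans (bar-cong (-‿inverseʳ x)) bar-0))

  -- `bar 1#` is idempotent, and it is non-zero because `bar` is an involution fixing 0.
  bar-1 : bar 1# ≈ 1#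
  bar-1 = *-cancelˡ (λ eq → 0≉1 (trans (sym bar-0) (trans (bar-cong (sym eq)) (bar-bar 1#))))
    (trans (sym (bar-* 1# 1#)) (trans (bar-cong (*-identityˡ 1#)) (sym (*-identityʳ _))))

  bar-- : ∀ x y → bar (x - y) ≈ bar x - bar y
  bar-- x y = trans (bar-+ x (- y)) (+-congˡ (bar-neg y))

  Fixed : Pred Carrier ℓ
  Fixed x = bar x ≈ x

  abstract
    Fixed-resp : ∀ {x y} → x ≈ y → Fixed x → Fixed y
    Fixed-resp x≈y fx = trans (bar-cong (sym x≈y)) (trans fx x≈y)

    Fixed-0 : Fixed 0#
    Fixed-0 = bar-0

    Fixed-+ : ∀ {x y} → Fixed x → Fixed y → Fixed (x + y)
    Fixed-+ fx fy = trans (bar-+ _ _) (+-cong fx fy)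

    Fixed-* : ∀ {x y} → Fixed x → Fixed y → Fixed (x * y)
    Fixed-* fx fy = trans (bar-* _ _) (*-cong fx fy)

    Fixed-neg : ∀ {x} → Fixed x → Fixed (- x)
    Fixed-neg fx = trans (bar-neg _) (-‿cong fx)

    Fixed-inverse : ∀ {x y} → Fixed x → x * y ≈ 1# → Fixed y
    Fixed-inverse {x} {y} fx xy≈1 = *-cancelˡ x≉0 (begin
      x * bar y      ≈⟨ *-congʳ fx ⟨
      bar x * bar y  ≈⟨ bar-* x y ⟨
      bar (x * y)    ≈⟨ bar-cong xy≈1 ⟩
      bar 1#         ≈⟨ bar-1 ⟩
      1#             ≈⟨ xy≈1 ⟨
      x * y          ∎)
      where
      x≉0 : ¬ x ≈ 0#
      x≉0 = inverse-nonzero (trans (*-comm y x) xy≈1)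

  tr : Carrier → Carrier
  tr x = bar x + x

  tr-cong : ∀ {x y} → x ≈ y → tr x ≈ tr y
  tr-cong x≈y = +-cong (bar-cong x≈y) x≈y

  abstract
    tr-fixed : ∀ x → Fixed (tr x)
    tr-fixed x = trans (bar-+ _ _) (trans (+-congʳ (bar-bar x)) (+-comm _ _))

  tr-+ : ∀ x y → tr (x + y) ≈ tr x + tr y
  tr-+ x y = trans (+-congʳ (bar-+ x y))
    (solve 4 (λ a b x y → a :+ b :+ (x :+ y) := a :+ x :+ (b :+ y)) refl (bar x) (bar y) x y)

  tr-0 : tr 0# ≈ 0#
  tr-0 = trans (+-congʳ bar-0) (+-identityʳ 0#)

  tr-fixed-* : ∀ {a} x → Fixed a → tr (a * x) ≈ a * tr x
  tr-fixed-* {a} x fa = trans (+-congʳ (trans (bar-* a x) (*-congʳ fa))) (sym (distribˡ a _ _))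

  abstract
    norm-fixed : ∀ x → Fixed (x * bar x)
    norm-fixed x = trans (bar-* x (bar x)) (trans (*-congˡ (bar-bar x)) (*-comm _ _))

  -- Otherwise X^q - X would have all q² > q elements of F as roots.
  ∃-nonfixed : ∃ λ θ → ¬ Fixed θ
  ∃-nonfixed with Fin.all? (λ i → bar (element i) ≟ element i)
  ... | yes fixed = contradiction
        (fixed-bound 1<q element (λ eq → ≡.trans (≡.sym (Inverse.strictlyInverseˡ card _)) (≡.trans (Inverse.to-cong card eq) (Inverse.strictlyInverseˡ card _))) fixed)
        (ℕ.<⇒≱ (≡.subst (q <_) (≡.cong (q ℕ.*_) (≡.sym (ℕ.*-identityʳ q))) (ℕ.m<m*n q q {{ℕ.>-nonZero (ℕ.<⇒≤ 1<q)}} 1<q)))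
  ... | no ¬fixed with i , nf ← Fin.¬∀⟶∃¬ _ (λ i → Fixed (element i)) (λ i → bar (element i) ≟ element i) ¬fixed =
    element i , nf

  θ : Carrier
  θ = proj₁ ∃-nonfixed

  θ̄ : Carrier
  θ̄ = bar θ

  -- The determinant of the system x̄ + x = a, θ̄x̄ + θx = b in the unknowns x̄ and x; it is
  -- non-zero because θ is not fixed.
  δ : Carrier
  δ = θ - θ̄

  δ≉0 : ¬ δ ≈ 0#
  δ≉0 δ≈0 = proj₂ ∃-nonfixed (sym (x-y≈0⇒x≈y δ≈0))

  ε : Carrier
  ε = proj₁ (inverse δ δ≉0)

  δε≈1 : δ * ε ≈ 1#
  δε≈1 = proj₂ (inverse δ δ≉0)

  bar-δ : bar δ ≈ - δ
  bar-δ = trans (bar-- θ θ̄) (trans (+-congˡ (-‿cong (bar-bar θ)))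
    (solve 2 (λ x y → y :- x := :- (x :- y)) refl θ θ̄))

  bar-ε : bar ε ≈ - ε
  bar-ε = *-cancelˡ δ≉0 (begin
    δ * bar ε          ≈⟨ solve 2 (λ d e → d :* e := :- (:- d :* e)) refl δ (bar ε) ⟩
    - (- δ * bar ε)    ≈⟨ -‿cong (*-congʳ bar-δ) ⟨
    - (bar δ * bar ε)  ≈⟨ -‿cong (trans (sym (bar-* δ ε)) (trans (bar-cong δε≈1) bar-1)) ⟩
    - 1#               ≈⟨ -‿cong δε≈1 ⟨
    - (δ * ε)          ≈⟨ solve 2 (λ d e → :- (d :* e) := d :* (:- e)) refl δ ε ⟩
    δ * - ε            ∎)

  private
    *δε : ∀ x → x * (δ * ε) ≈ x
    *δε x = trans (*-congˡ δε≈1) (*-identityʳ x)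

  -- Obtained by solving a = x̄ + x, b = θ̄ x̄ + θ x for x.
  fromTraces : Carrier → Carrier → Carrier
  fromTraces a b = (b - θ̄ * a) * ε

  fromTraces-cong : ∀ {a a′ b b′} → a ≈ a′ → b ≈ b′ → fromTraces a b ≈ fromTraces a′ b′
  fromTraces-cong a≈ b≈ = *-congʳ (+-cong b≈ (-‿cong (*-congˡ a≈)))

  bar-fromTraces : ∀ {a b} → Fixed a → Fixed b → bar (fromTraces a b) ≈ (b - θ * a) * - ε
  bar-fromTraces {a} {b} fa fb = trans (bar-* _ ε) (*-cong
    (trans (bar-- b _) (+-cong fb (-‿cong (trans (bar-* θ̄ a) (*-cong (bar-bar θ) fa))))) bar-ε)

  tr-fromTraces : ∀ {a b} → Fixed a → Fixed b → tr (fromTraces a b) ≈ a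
  tr-fromTraces {a} {b} fa fb = begin
    tr (fromTraces a b)                         ≈⟨ +-congʳ (bar-fromTraces fa fb) ⟩
    (b - θ * a) * - ε + (b - θ̄ * a) * ε         ≈⟨ solve 5 (λ a b t u e → (b :- t :* a) :* (:- e) :+ (b :- u :* a) :* e := a :* ((t :- u) :* e)) refl a b θ θ̄ ε ⟩
    a * (δ * ε)                                 ≈⟨ *δε a ⟩
    a                                           ∎

  trθ-fromTraces : ∀ {a b} → Fixed a → Fixed b → tr (θ * fromTraces a b) ≈ b
  trθ-fromTraces {a} {b} fa fb = begin
    tr (θ * fromTraces a b)                          ≈⟨ +-congʳ (trans (bar-* θ _) (*-congˡ (bar-fromTraces fa fb))) ⟩
    θ̄ * ((b - θ * a) * - ε) + θ * ((b - θ̄ * a) * ε)  ≈⟨ solve 5 (λ a b t u e → u :* ((b :- t :* a) :* (:- e)) :+ t :* ((b :- u :* a) :* e) := b :* ((t :- u) :* e)) refl a b θ θ̄ ε ⟩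
    b * (δ * ε)                                      ≈⟨ *δε b ⟩
    b                                                ∎

  fromTraces-tr : ∀ x → fromTraces (tr x) (tr (θ * x)) ≈ x
  fromTraces-tr x = begin
    (tr (θ * x) - θ̄ * tr x) * ε                        ≈⟨ *-congʳ (+-congʳ (+-congʳ (bar-* θ x))) ⟩
    (θ̄ * bar x + θ * x - θ̄ * (bar x + x)) * ε          ≈⟨ solve 5 (λ x y t u e → (u :* y :+ t :* x :- u :* (y :+ x)) :* e := x :* ((t :- u) :* e)) refl x (bar x) θ θ̄ ε ⟩
    x * (δ * ε)                                        ≈⟨ *δε x ⟩
    x                                                  ∎

  -- The coordinates with respect to the basis 1, θ over the fixed field.
  coord₀ : Carrier → Carrier
  coord₀ x = (bar x * θ - x * θ̄) * ε

  coord₁ : Carrier → Carrier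
  coord₁ x = (x - bar x) * ε

  abstract
    coord₀-fixed : ∀ x → Fixed (coord₀ x)
    coord₀-fixed x = begin
      bar (coord₀ x)                                ≈⟨ trans (bar-* _ ε) (*-cong (bar-- _ _) bar-ε) ⟩
      (bar (bar x * θ) - bar (x * θ̄)) * - ε         ≈⟨ *-congʳ (+-cong (trans (bar-* _ _) (*-congʳ (bar-bar x))) (-‿cong (trans (bar-* _ _) (*-congˡ (bar-bar θ))))) ⟩
      (x * θ̄ - bar x * θ) * - ε                     ≈⟨ solve 5 (λ x y t u e → (x :* u :- y :* t) :* (:- e) := (y :* t :- x :* u) :* e) refl x (bar x) θ θ̄ ε ⟩
      coord₀ x                                      ∎

    coord₁-fixed : ∀ x → Fixed (coord₁ x)
    coord₁-fixed x = begin
      bar (coord₁ x)              ≈⟨ trans (bar-* _ ε) (*-cong (trans (bar-- _ _) (+-congˡ (-‿cong (bar-bar x)))) bar-ε) ⟩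
      (bar x - x) * - ε           ≈⟨ solve 3 (λ x y e → (y :- x) :* (:- e) := (x :- y) :* e) refl x (bar x) ε ⟩
      coord₁ x                    ∎

  coords : ∀ x → coord₀ x + coord₁ x * θ ≈ x
  coords x = trans (solve 5 (λ x y t u e → (y :* t :- x :* u) :* e :+ (x :- y) :* e :* t := x :* ((t :- u) :* e)) refl x (bar x) θ θ̄ ε) (*δε x)

  -- Conjugating the relation replaces θ by θ̄; subtracting the two leaves δb = 0.
  coords-independent : ∀ {a b} → Fixed a → Fixed b → a + b * θ ≈ 0# → a ≈ 0# × b ≈ 0#
  coords-independent {a} {b} fa fb eq = a≈0 , b≈0
    where
    eq̄ : a + b * θ̄ ≈ 0#
    eq̄ = trans (+-cong (sym fa) (trans (*-congʳ (sym fb)) (sym (bar-* b θ))))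
               (trans (sym (bar-+ a _)) (trans (bar-cong eq) bar-0))
    b≈0 : b ≈ 0#
    b≈0 = xy≈0⇒y≈0 δ≉0 (begin
      δ * b                          ≈⟨ solve 4 (λ a b t u → (t :- u) :* b := a :+ b :* t :- (a :+ b :* u)) refl a b θ θ̄ ⟩
      a + b * θ - (a + b * θ̄)        ≈⟨ +-cong eq (-‿cong eq̄) ⟩
      0# - 0#                        ≈⟨ -‿inverseʳ 0# ⟩
      0#                             ∎)
    a≈0 : a ≈ 0#
    a≈0 = trans (sym (trans (+-congˡ (trans (*-congʳ b≈0) (zeroˡ θ))) (+-identityʳ a))) eq

  -- This is the copy of GF(q) over which the design is compared with an affine space when only its
  -- parameters are wanted and no subfield is given.
  fixedField : Field (c ⊔ ℓ) ℓ
  fixedField = record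
    { commutativeRing = record
      { Carrier = ∃ Fixed
      ; _≈_ = λ x y → proj₁ x ≈ proj₁ y
      ; _+_ = λ (x , fx) (y , fy) → x + y , Fixed-+ fx fy
      ; _*_ = λ (x , fx) (y , fy) → x * y , Fixed-* fx fy
      ; -_  = λ (x , fx) → - x , Fixed-neg fx
      ; 0#  = 0# , bar-0
      ; 1#  = 1# , bar-1
      ; isCommutativeRing = record
        { isRing = record
          { +-isAbelianGroup = record
            { isGroup = record
              { isMonoid = record
                { isSemigroup = record
                  { isMagma = record
                    { isEquivalence = On.isEquivalence proj₁ isEquivalence
                    ; ∙-cong = +-cong
                    }
                  ; assoc = λ _ _ _ → +-assoc _ _ _
                  }
                ; identity = (λ _ → +-identityˡ _) , (λ _ → +-identityʳ _)
                }
              ; inverse = (λ _ → -‿inverseˡ _) , (λ _ → -‿inverseʳ _)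
              ; ⁻¹-cong = -‿cong
              }
            ; comm = λ _ _ → +-comm _ _
            }
          ; *-cong = *-cong
          ; *-assoc = λ _ _ _ → *-assoc _ _ _
          ; *-identity = (λ _ → *-identityˡ _) , (λ _ → *-identityʳ _)
          ; distrib = (λ _ _ _ → distribˡ _ _ _) , (λ _ _ _ → distribʳ _ _ _)
          }
        ; *-comm = λ _ _ → *-comm _ _
        }
      }
    ; 0≉1 = 0≉1
    ; inverse = λ (x , fx) x≉0 → let y , xy≈1 = inverse x x≉0 in (y , Fixed-inverse fx xy≈1) , xy≈1
    }

  fixedField↪ : fixedField ↪ F
  fixedField↪ = record
    { ι = proj₁
    ; isRingMonomorphism = record
      { isRingHomomorphism = record
        { isSemiringHomomorphism = record
          { isNearSemiringHomomorphism = record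
            { +-isMonoidHomomorphism = record
              { isMagmaHomomorphism = record
                { isRelHomomorphism = record { cong = λ eq → eq } ; homo = λ _ _ → refl }
              ; ε-homo = refl
              }
            ; *-homo = λ _ _ → refl
            }
          ; 1#-homo = refl
          }
        ; -‿homo = λ _ → refl
        }
      ; injective = λ eq → eq
      }
    }

  -- If s is the number of fixed elements, the pair of traces identifies F with the pairs of fixed
  -- elements, so s² = q².
  fixedField-order : HasOrder fixedField q
  fixedField-order with s , card₀ ← HasCardinality-subset {S = setoid} card Fixed-resp (λ x → bar x ≟ x) =
    ≡.subst (HasCardinality (Field.setoid fixedField)) s≡q card₀
    where
    traces : Inverse setoid (×-setoid (Field.setoid fixedField) (Field.setoid fixedField))
    traces = mkInverse setoid (×-setoid (Field.setoid fixedField) (Field.setoid fixedField))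
      (λ x → (tr x , tr-fixed x) , (tr (θ * x) , tr-fixed (θ * x)))
      (λ ((a , _) , (b , _)) → fromTraces a b)
      (λ x≈y → tr-cong x≈y , tr-cong (*-congˡ x≈y)) (λ (a≈ , b≈) → fromTraces-cong a≈ b≈)
      (λ ((_ , fa) , (_ , fb)) → tr-fromTraces fa fb , trθ-fromTraces fa fb) fromTraces-tr
    s≡q : s ≡ q
    s≡q = m*m≡n*n⇒m≡n (≡.trans (HasCardinality-unique (HasCardinality-≅ traces (HasCardinality-× card₀ card₀)) card)
                               (≡.cong (q ℕ.*_) (ℕ.*-identityʳ q)))

  -- The Hermitian form and the blocks as level sets

  module HermitianForm (m : ℕ) where
    open GroupAction q F m
    open Construction q F m hiding (tr; 𝒮)
    open import Algebra.Properties.Semiring.Sum semiring using (sum-cong-≋; ∑-distrib-+)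
    open import Algebra.Properties.Ring ring using (-0#≈0#)

    tr-- : ∀ x y → tr (x - y) ≈ tr x - tr y
    tr-- x y = trans (+-congʳ (bar-- x y))
      (solve 4 (λ a b x y → a :- b :+ (x :- y) := a :+ x :- (b :+ y)) refl (bar x) (bar y) x y)

    tr-sum : ∀ {k} (f : Vector Carrier k) → tr (sum f) ≈ sum (tr ∘ f)
    tr-sum {zero}  f = tr-0
    tr-sum {suc k} f = trans (tr-+ (head f) (sum (tail f))) (+-congˡ (tr-sum (tail f)))

    abstract
      sum-fixed : ∀ {k} {f : Vector Carrier k} → (∀ s → Fixed (f s)) → Fixed (sum f)
      sum-fixed {zero}  ff = Fixed-0
      sum-fixed {suc k} ff = Fixed-+ (ff zero) (sum-fixed (ff ∘ suc))

    norms : ∀ {k} → Vector Carrier k → Carrier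
    norms x = sum λ s → x s ^ suc q

    norms-cong : ∀ {k} {x y : Vector Carrier k} → x ≋ y → norms x ≈ norms y
    norms-cong x≋y = sum-cong-≋ λ s → ^-congˡ (suc q) (x≋y s)

    abstract
      norms-fixed : ∀ {k} (x : Vector Carrier k) → Fixed (norms x)
      norms-fixed x = sum-fixed (norm-fixed ∘ x)

    -- Polarisation: in each entry the mixed terms iȳ and īy are conjugate, so together they form a
    -- trace.
    norms-+ : ∀ {k} (y i : Vector Carrier k) → norms (λ s → y s + i s) ≈ norms y + tr ((bar ∘ i) ∙ y) + norms i
    norms-+ y i = begin
      norms (λ s → y s + i s)                                          ≈⟨ sum-cong-≋ expand ⟩
      sum (λ s → y s ^ suc q + tr (bar (i s) * y s) + i s ^ suc q)     ≈⟨ ∑-distrib-+ (λ s → y s ^ suc q + tr (bar (i s) * y s)) (λ s → i s ^ suc q) ⟩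
      sum (λ s → y s ^ suc q + tr (bar (i s) * y s)) + norms i         ≈⟨ +-congʳ (∑-distrib-+ (λ s → y s ^ suc q) (λ s → tr (bar (i s) * y s))) ⟩
      norms y + sum (λ s → tr (bar (i s) * y s)) + norms i             ≈⟨ +-congʳ (+-congˡ (tr-sum (λ s → bar (i s) * y s))) ⟨
      norms y + tr ((bar ∘ i) ∙ y) + norms i                           ∎
      where
      expand : ∀ s → (y s + i s) * bar (y s + i s) ≈ y s * bar (y s) + tr (bar (i s) * y s) + i s * bar (i s)
      expand s = begin
        (y s + i s) * bar (y s + i s)          ≈⟨ *-congˡ (bar-+ (y s) (i s)) ⟩
        (y s + i s) * (bar (y s) + bar (i s))  ≈⟨ solve 4 (λ y i y′ i′ → (y :+ i) :* (y′ :+ i′) := y :* y′ :+ (i :* y′ :+ i′ :* y) :+ i :* i′) refl (y s) (i s) (bar (y s)) (bar (i s)) ⟩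
        y s * bar (y s) + (i s * bar (y s) + bar (i s) * y s) + i s * bar (i s)
          ≈⟨ +-congʳ (+-congˡ (+-congʳ (trans (bar-* _ _) (*-congʳ (bar-bar (i s)))))) ⟨
        y s * bar (y s) + tr (bar (i s) * y s) + i s * bar (i s)  ∎

    herm : AG → Carrier
    herm x = norms (init x) + tr (last x)

    herm-cong : ∀ {x y : AG} → x ≋ y → herm x ≈ herm y
    herm-cong {x} {y} x≋y = +-cong (norms-cong {x = init x} {init y} λ s → x≋y (inject₁ s)) (tr-cong (x≋y (fromℕ m)))

    abstract
      herm-fixed : ∀ x → Fixed (herm x)
      herm-fixed x = Fixed-+ (norms-fixed (init x)) (tr-fixed (last x))

    init-transform : ∀ i j y s → init (transform i j y) s ≈ init y s + init i s
    init-transform i j y s = reflexive (init-∷ʳ (λ k → init y k + init i k) _ s)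

    last-transform : ∀ i j y → last (transform i j y) ≈ last y + init y ∙ j + last i
    last-transform i j y = reflexive (last-∷ʳ (λ k → init y k + init i k) _)

    slope : Vector Carrier n → Vector Carrier m → Vector Carrier m
    slope i j s = bar (init i s) + j s

    -- The linear part has two sources, both collected in `slope`: the polarisation of the norms by
    -- i, and the shear of the last coordinate by j.
    herm-transform : ∀ i j y → herm (transform i j y) ≈ herm y + tr (slope i j ∙ init y) + herm i
    herm-transform i j y = begin
      norms (init T) + tr (last T)
        ≈⟨ +-cong (norms-cong (init-transform i j y)) (tr-cong (last-transform i j y)) ⟩
      norms (λ s → y′ s + i′ s) + tr (last y + y′ ∙ j + last i)
        ≈⟨ +-cong (norms-+ y′ i′) (trans (tr-+ _ _) (+-congʳ (tr-+ _ _))) ⟩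
      norms y′ + tr ((bar ∘ i′) ∙ y′) + norms i′ + (tr (last y) + tr (y′ ∙ j) + tr (last i))
        ≈⟨ solve 6 (λ a b c d e g → a :+ b :+ c :+ (d :+ e :+ g) := a :+ d :+ (b :+ e) :+ (c :+ g)) refl
             (norms y′) (tr ((bar ∘ i′) ∙ y′)) (norms i′) (tr (last y)) (tr (y′ ∙ j)) (tr (last i)) ⟩
      herm y + (tr ((bar ∘ i′) ∙ y′) + tr (y′ ∙ j)) + herm i
        ≈⟨ +-congʳ (+-congˡ (trans (tr-cong (trans (+-∙ (bar ∘ i′) j y′) (+-congˡ (∙-comm j y′)))) (tr-+ _ _))) ⟨
      herm y + tr (slope i j ∙ y′) + herm i  ∎
      where
      T = transform i j y
      y′ = init y
      i′ = init i

    -- Conjugation is additive and multiplicative, so the cone equation depends on the single scalar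
    -- ω ∙ x and says that it is fixed.
    coneForm : ∀ {k} (ω x : Vector Carrier k) → sum (λ s → ω s ^ q * x s ^ q - ω s * x s) ≈ bar (ω ∙ x) - ω ∙ x
    coneForm {zero}  ω x = sym (trans (+-congʳ bar-0) (-‿inverseʳ 0#))
    coneForm {suc k} ω x = begin
      bar (head ω) * bar (head x) - head ω * head x + sum (λ s → tail ω s ^ q * tail x s ^ q - tail ω s * tail x s)
        ≈⟨ +-cong (+-congʳ (sym (bar-* _ _))) (coneForm (tail ω) (tail x)) ⟩
      bar u - u + (bar z - z)    ≈⟨ solve 4 (λ u′ u z′ z → u′ :- u :+ (z′ :- z) := u′ :+ z′ :- (u :+ z)) refl (bar u) u (bar z) z ⟩
      bar u + bar z - (u + z)    ≈⟨ +-congʳ (bar-+ u z) ⟨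
      bar (u + z) - (u + z)      ∎
      where
      u = head ω * head x
      z = tail ω ∙ tail x

    -- Conjugation negates δ, so the factor δ turns the sum in the trace into the difference that
    -- occurs in the cone equation.
    tr-δ : ∀ z → tr (δ * z) ≈ - δ * (bar z - z)
    tr-δ z = begin
      bar (δ * z) + δ * z     ≈⟨ +-congʳ (trans (bar-* δ z) (*-congʳ bar-δ)) ⟩
      - δ * bar z + δ * z     ≈⟨ solve 3 (λ d z′ z → :- d :* z′ :+ d :* z := :- d :* (z′ :- z)) refl δ (bar z) z ⟩
      - δ * (bar z - z)       ∎

    -δ≉0 : ¬ - δ ≈ 0#
    -δ≉0 -δ≈0 = δ≉0 (begin
      δ        ≈⟨ solve 1 (λ d → d := :- (:- d)) refl δ ⟩
      - - δ    ≈⟨ trans (-‿cong -δ≈0) -0#≈0# ⟩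
      0#       ∎)

    rescale : ∀ {ρ x y x′ y′} → ¬ ρ ≈ 0# → ρ * x ≈ x′ → ρ * y ≈ y′ → x ≈ y ⇔ x′ ≈ y′
    rescale ρ≉0 ρx≈ ρy≈ = mk⇔
      (λ x≈y → trans (sym ρx≈) (trans (*-congˡ x≈y) ρy≈))
      (λ x≈y → *-cancelˡ ρ≉0 (trans ρx≈ (trans x≈y (sym ρy≈))))

    rewrite⇔ : ∀ {x y x′ y′} → x ≈ x′ → y ≈ y′ → x ≈ y ⇔ x′ ≈ y′
    rewrite⇔ x≈ y≈ = mk⇔ (λ x≈y → trans (sym x≈) (trans x≈y y≈)) (λ x≈y → trans x≈ (trans x≈y (sym y≈)))

    move : ∀ x z → x + z ≈ 0# ⇔ x ≈ - z
    move x z = mk⇔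
      (λ eq → trans (solve 2 (λ x z → x := x :+ z :- z) refl x z) (trans (+-congʳ eq) (+-identityˡ _)))
      (λ eq → trans (+-congʳ eq) (-‿inverseˡ z))

    -- Blocks of 𝒮 are the sets of this form with α₀ and β fixed by conjugation.
    LevelSet : Carrier → Vector Carrier m → Carrier → Pred AG ℓ
    LevelSet α₀ a β y = α₀ * herm y + tr (a ∙ init y) ≈ β

    LevelSet-cong : ∀ {α₀ α₀′ a a′ β β′} → α₀ ≈ α₀′ → a ≋ a′ → β ≈ β′ → ∀ y → LevelSet α₀ a β y ⇔ LevelSet α₀′ a′ β′ y
    LevelSet-cong α₀≈ a≋ β≈ y = rewrite⇔ (+-cong (*-congʳ α₀≈) (tr-cong (∙-congʳ {x = init y} a≋))) β≈

    Hermitian-image : ∀ g y → image g Hermitian y ⇔ LevelSet 1# (slope (G.i g) (G.j g)) (- herm (G.i g)) y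
    Hermitian-image g y =
      image⇔ g (λ x≋y → trans (sym (herm-cong x≋y))) y ⨾
      (rewrite⇔ (trans (herm-transform i j y) (+-congʳ (+-congʳ (sym (*-identityˡ _))))) refl ⨾
      move (1# * herm y + tr (slope i j ∙ init y)) (herm i))
      where open G g

    -- A cone constrains only the first m coordinates, on which g acts as a translation; this gives
    -- the coefficient 0 of `herm` and a constant that depends on `init i` alone.
    Cone-image : ∀ g ω y → image g (Cone ω) y ⇔ LevelSet 0# (λ s → δ * ω s) (- tr ((λ s → δ * ω s) ∙ init (G.i g))) y
    Cone-image g ω y =
      image⇔ g (λ {x} {y} x≋y x∈ → trans (sum-cong-≋ λ s → +-cong (*-congˡ (bar-cong (sym (x≋y (inject₁ s))))) (-‿cong (*-congˡ (sym (x≋y (inject₁ s)))))) x∈) y ⨾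
      (rescale -δ≉0 eq (zeroʳ _) ⨾
      move (0# * herm y + tr (δω ∙ init y)) (tr (δω ∙ init i)))
      where
      open G g
      δω : Vector Carrier m
      δω s = δ * ω s
      x = init (transform i j y)
      eq : - δ * sum (λ s → ω s ^ q * x s ^ q - ω s * x s) ≈ 0# * herm y + tr (δω ∙ init y) + tr (δω ∙ init i)
      eq = begin
        - δ * sum (λ s → ω s ^ q * x s ^ q - ω s * x s)    ≈⟨ *-congˡ (coneForm ω x) ⟩
        - δ * (bar (ω ∙ x) - ω ∙ x)                        ≈⟨ tr-δ (ω ∙ x) ⟨
        tr (δ * ω ∙ x)                                     ≈⟨ tr-cong (*-∙ δ ω x) ⟨
        tr (δω ∙ x)                                        ≈⟨ tr-cong (∙-congˡ {α = δω} (init-transform i j y)) ⟩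
        tr (δω ∙ (λ s → init y s + init i s))              ≈⟨ trans (tr-cong (∙-+ δω (init y) (init i))) (tr-+ _ _) ⟩
        tr (δω ∙ init y) + tr (δω ∙ init i)                ≈⟨ +-congʳ (trans (+-congʳ (zeroˡ _)) (+-identityˡ _)) ⟨
        0# * herm y + tr (δω ∙ init y) + tr (δω ∙ init i)  ∎

    -- A section of the trace over the fixed elements; the value 0 prescribed for tr (θx) is an
    -- arbitrary choice.
    withTrace : Carrier → Carrier
    withTrace a = fromTraces a 0#

    tr-withTrace : ∀ {a} → Fixed a → tr (withTrace a) ≈ a
    tr-withTrace fa = tr-fromTraces fa Fixed-0

    withHerm : Vector Carrier m → Carrier → AG
    withHerm x h = x ∷ʳ withTrace (h - norms x)

    herm-withHerm : ∀ x {h} → Fixed h → herm (withHerm x h) ≈ h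
    herm-withHerm x {h} fh = begin
      norms (init (withHerm x h)) + tr (last (withHerm x h))
        ≈⟨ +-cong (norms-cong λ s → reflexive (init-∷ʳ x w s)) (tr-cong (reflexive (last-∷ʳ x w))) ⟩
      norms x + tr w             ≈⟨ +-congˡ (tr-withTrace (Fixed-+ fh (Fixed-neg (norms-fixed x)))) ⟩
      norms x + (h - norms x)    ≈⟨ solve 2 (λ n h → n :+ (h :- n) := h) refl (norms x) h ⟩
      h                          ∎
      where w = withTrace (h - norms x)

    -- Dividing by α₀, whose inverse u is again fixed and so commutes with the trace, makes the
    -- coefficient of `herm` equal to 1. A translation then has enough freedom: its first m entries
    -- set the slope, and its last entry sets the constant.
    Hermitian-realisation : ∀ {α₀ β} (a : Vector Carrier m) → ¬ α₀ ≈ 0# → Fixed α₀ → Fixed β →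
                            ∃ λ g → ∀ y → image g Hermitian y ⇔ LevelSet α₀ a β y
    Hermitian-realisation {α₀} {β} a α₀≉0 fα₀ fβ with u , α₀u≈1 ← inverse α₀ α₀≉0 = translation i , λ y →
      Hermitian-image (translation i) y ⨾ rescale α₀≉0 (scaled y) scaled-β
      where
      fu : Fixed u
      fu = Fixed-inverse fα₀ α₀u≈1
      -- For j = 0 the slope is the conjugate of `init i`, so conjugated entries are chosen.
      x : Vector Carrier m
      x s = bar (u * a s)
      i : Vector Carrier n
      i = withHerm x (- (u * β))
      α₀u* : ∀ z → α₀ * (u * z) ≈ z
      α₀u* z = trans (sym (*-assoc _ _ _)) (trans (*-congʳ α₀u≈1) (*-identityˡ z))
      slope≈ : slope i 𝟎 ≋ (λ s → u * a s)
      slope≈ s = trans (+-identityʳ _) (trans (bar-cong (reflexive (init-∷ʳ x _ s))) (bar-bar _))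
      scaled : ∀ y → α₀ * (1# * herm y + tr (slope i 𝟎 ∙ init y)) ≈ α₀ * herm y + tr (a ∙ init y)
      scaled y = trans (distribˡ _ _ _) (+-cong (*-congˡ (*-identityˡ _)) (begin
        α₀ * tr (slope i 𝟎 ∙ init y)            ≈⟨ *-congˡ (tr-cong (trans (∙-congʳ {x = init y} slope≈) (*-∙ u a (init y)))) ⟩
        α₀ * tr (u * a ∙ init y)                ≈⟨ *-congˡ (tr-fixed-* (a ∙ init y) fu) ⟩
        α₀ * (u * tr (a ∙ init y))              ≈⟨ α₀u* _ ⟩
        tr (a ∙ init y)                         ∎))
      scaled-β : α₀ * - herm i ≈ β
      scaled-β = begin
        α₀ * - herm i          ≈⟨ *-congˡ (-‿cong (herm-withHerm x (Fixed-neg (Fixed-* fu fβ)))) ⟩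
        α₀ * - - (u * β)       ≈⟨ solve 2 (λ a z → a :* (:- (:- z)) := a :* z) refl α₀ (u * β) ⟩
        α₀ * (u * β)           ≈⟨ α₀u* β ⟩
        β                      ∎

    -- As a ≠ 0, the form a ∙ v takes every value in F, so its trace takes every fixed value;
    -- translating by a suitable v moves the cone to the required constant.
    Cone-realisation : ∀ {α₀ β} (a : Vector Carrier m) → α₀ ≈ 0# → ¬ a ≋ 𝟎 → Fixed β →
                       ∃₂ λ g ω → ¬ ω ≋ 𝟎 × ∀ y → image g (Cone ω) y ⇔ LevelSet α₀ a β y
    Cone-realisation {α₀} {β} a α₀≈0 a≉𝟎 fβ
      -- The sign is opposite to that of β because the constant of the image is minus the trace.
      with v , a∙v≈ ← AffineGeometry.Plane-inhabited F card (withTrace (- β)) a≉𝟎 =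
      translation (v ∷ʳ 0#) , ω , (λ ω≋𝟎 → a≉𝟎 λ s → trans (sym (δω≋a s)) (trans (*-congˡ (ω≋𝟎 s)) (zeroʳ δ))) ,
      λ y → Cone-image (translation (v ∷ʳ 0#)) ω y ⨾ LevelSet-cong (sym α₀≈0) δω≋a constant y
      where
      -- The factor ε = δ⁻¹ compensates the δ that turns the cone equation into a trace.
      ω : Vector Carrier m
      ω s = ε * a s
      δω≋a : (λ s → δ * ω s) ≋ a
      δω≋a s = trans (sym (*-assoc _ _ _)) (trans (*-congʳ δε≈1) (*-identityˡ _))
      constant : - tr ((λ s → δ * ω s) ∙ init (v ∷ʳ 0#)) ≈ β
      constant = begin
        - tr ((λ s → δ * ω s) ∙ init (v ∷ʳ 0#))   ≈⟨ -‿cong (tr-cong (trans (∙-cong δω≋a λ s → reflexive (init-∷ʳ v 0# s)) a∙v≈)) ⟩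
        - tr (withTrace (- β))                    ≈⟨ -‿cong (tr-withTrace (Fixed-neg fβ)) ⟩
        - - β                                     ≈⟨ solve 1 (λ b → :- (:- b) := b) refl β ⟩
        β                                         ∎

    N-orbit⇔ : ∀ x y → N-orbit x y ⇔ (init x ≋ init y × herm x ≈ herm y)
    N-orbit⇔ x y = mk⇔ to from
      where
      to : N-orbit x y → init x ≋ init y × herm x ≈ herm y
      to (g , (i≋𝟎 , j≋𝟎 , tr≈0) , x↦y) = init≋ , +-cong (norms-cong init≋) (begin
        tr (last x)                                    ≈⟨ tr-cong (trans (x≋ (fromℕ m)) (last-transform i j y)) ⟩
        tr (last y + init y ∙ j + last i)              ≈⟨ trans (tr-+ _ _) (+-congˡ tr≈0) ⟩
        tr (last y + init y ∙ j) + 0#                  ≈⟨ +-identityʳ _ ⟩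
        tr (last y + init y ∙ j)                       ≈⟨ tr-cong (+-congˡ (trans (∙-comm (init y) j) (trans (∙-congʳ {x = init y} j≋𝟎) (𝟎-∙ (init y))))) ⟩
        tr (last y + 0#)                               ≈⟨ tr-cong (+-identityʳ _) ⟩
        tr (last y)                                    ∎)
        where
        open G g
        x≋ = Equivalence.to (↦⇔transform g x y) x↦y
        init≋ : init x ≋ init y
        init≋ s = trans (x≋ (inject₁ s)) (trans (init-transform i j y s) (trans (+-congˡ (i≋𝟎 s)) (+-identityʳ _)))

      from : init x ≋ init y × herm x ≈ herm y → N-orbit x y
      from (init≋ , herm≈) = translation i ,
        ((λ s → reflexive (init-∷ʳ 𝟎 w s)) , (λ _ → refl) , trans (tr-cong lastᵢ) tr-w) ,
        Equivalence.from (↦⇔transform (translation i) x y) (≋-init-last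
          (λ s → sym (trans (init-transform i 𝟎 y s) (trans (+-congˡ (reflexive (init-∷ʳ 𝟎 w s))) (trans (+-identityʳ _) (sym (init≋ s))))))
          (sym (begin
            last (transform i 𝟎 y)         ≈⟨ last-transform i 𝟎 y ⟩
            last y + init y ∙ 𝟎 + last i   ≈⟨ +-cong (trans (+-congˡ (trans (∙-comm (init y) 𝟎) (𝟎-∙ (init y)))) (+-identityʳ _)) lastᵢ ⟩
            last y + (last x - last y)     ≈⟨ solve 2 (λ x y → y :+ (x :- y) := x) refl (last x) (last y) ⟩
            last x                         ∎)))
        where
        -- `transform` leads from y back to x, hence the order of the difference.
        w = last x - last y
        i : Vector Carrier n
        i = 𝟎 ∷ʳ w
        lastᵢ : last i ≈ w
        lastᵢ = reflexive (last-∷ʳ (𝟎 {m}) w)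
        tr-w : tr w ≈ 0#
        tr-w = begin
          tr (last x - last y)                     ≈⟨ tr-- (last x) (last y) ⟩
          tr (last x) - tr (last y)                ≈⟨ solve 3 (λ n a b → a :- b := n :+ a :- (n :+ b)) refl (norms (init x)) (tr (last x)) (tr (last y)) ⟩
          herm x - (norms (init x) + tr (last y))  ≈⟨ +-cong herm≈ (-‿cong (+-congʳ (norms-cong init≋))) ⟩
          herm y - herm y                          ≈⟨ -‿inverseʳ _ ⟩
          0#                                       ∎

    -- Coordinates and hyperplanes over a subfield of order q

    module OverSubfield (K : Field c′ ℓ′) (cardK : HasOrder K q) (K↪F : K ↪ F) where
      private
        module K = LinearAlgebra K hiding (_^_)
        module KD = DotProduct K
        open import Algebra.Properties.Semiring.Exp K.semiring using () renaming (_^_ to _^ᴷ_)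
      open _↪_ K↪F public
      open RingMorphisms.IsRingMonomorphism isRingMonomorphism public
        renaming (injective to ι-injective; ⟦⟧-cong to ι-cong; +-homo to ι-+; *-homo to ι-*; 0#-homo to ι-0; 1#-homo to ι-1)
        using ()

      ι-^ : ∀ a n → ι (a ^ᴷ n) ≈ ι a ^ n
      ι-^ a zero    = ι-1
      ι-^ a (suc n) = trans (ι-* _ _) (*-congˡ (ι-^ a n))

      ι-fixed : ∀ a → Fixed (ι a)
      ι-fixed a = trans (sym (ι-^ a q)) (ι-cong (FiniteFieldProperties.x^order≈x K cardK a))

      abstract
        -- Otherwise x and the q elements of K would be q + 1 roots of X ^ q − X.
        ι-surjective : ∀ {x} → Fixed x → ∃ λ a → ι a ≈ x
        ι-surjective {x} fx with Fin.any? (λ i → ι (Inverse.from cardK i) ≟ x)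
        ... | yes (i , eq) = Inverse.from cardK i , eq
        ... | no  x∉K      = contradiction (fixed-bound 1<q ρ ρ-injective ρ-fixed) ℕ.1+n≰n
          where
          ρ : Fin (suc q) → Carrier
          ρ zero    = x
          ρ (suc i) = ι (Inverse.from cardK i)
          ρ-injective : ∀ {i j} → ρ i ≈ ρ j → i ≡ j
          ρ-injective {zero}  {zero}  _  = ≡.refl
          ρ-injective {zero}  {suc j} eq = contradiction (j , sym eq) x∉K
          ρ-injective {suc i} {zero}  eq = contradiction (i , eq) x∉K
          ρ-injective {suc i} {suc j} eq = ≡.cong suc (≡.trans (≡.sym (Inverse.strictlyInverseˡ cardK i))
            (≡.trans (Inverse.to-cong cardK (ι-injective eq)) (Inverse.strictlyInverseˡ cardK j)))
          ρ-fixed : ∀ i → Fixed (ρ i)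
          ρ-fixed zero    = fx
          ρ-fixed (suc i) = ι-fixed _

      κ : ∀ {x} → Fixed x → K.Carrier
      κ fx = proj₁ (ι-surjective fx)

      ι-κ : ∀ {x} (fx : Fixed x) → ι (κ fx) ≈ x
      ι-κ fx = proj₂ (ι-surjective fx)
      d : ℕ
      d = suc (m ℕ.+ m)

      κ-cong : ∀ {x y} {fx : Fixed x} {fy : Fixed y} → x ≈ y → κ fx K.≈ κ fy
      κ-cong {fx = fx} {fy} x≈y = ι-injective (trans (ι-κ fx) (trans x≈y (sym (ι-κ fy))))

      ι-sum : ∀ {k} (t : Vector K.Carrier k) → ι (K.sum t) ≈ sum (ι ∘ t)
      ι-sum {zero}  t = ι-0
      ι-sum {suc k} t = trans (ι-+ _ _) (+-congˡ (ι-sum (tail t)))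

      coordinates : AG → Vector K.Carrier d
      coordinates x = κ (herm-fixed x) ∷ (λ s → κ (tr-fixed (init x s))) ++ (λ s → κ (tr-fixed (θ * init x s)))

      ι-coordinateˡ : ∀ x s → ι (coordinates x (suc (s ↑ˡ m))) ≈ tr (init x s)
      ι-coordinateˡ x s = trans (ι-cong (K.reflexive (lookup-++ˡ (λ s → κ (tr-fixed (init x s))) _ s))) (ι-κ _)

      ι-coordinateʳ : ∀ x s → ι (coordinates x (suc (m ↑ʳ s))) ≈ tr (θ * init x s)
      ι-coordinateʳ x s = trans (ι-cong (K.reflexive (lookup-++ʳ (λ s → κ (tr-fixed (init x s))) _ s))) (ι-κ _)

      coordinates⇔ : ∀ x y → coordinates x K.≋ coordinates y ⇔ (init x ≋ init y × herm x ≈ herm y)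
      coordinates⇔ x y = mk⇔ to from
        where
        to : coordinates x K.≋ coordinates y → init x ≋ init y × herm x ≈ herm y
        to eq = (λ s → begin
            init x s                                          ≈⟨ fromTraces-tr (init x s) ⟨
            fromTraces (tr (init x s)) (tr (θ * init x s))    ≈⟨ fromTraces-cong
                (trans (sym (ι-coordinateˡ x s)) (trans (ι-cong (eq _)) (ι-coordinateˡ y s)))
                (trans (sym (ι-coordinateʳ x s)) (trans (ι-cong (eq _)) (ι-coordinateʳ y s))) ⟩
            fromTraces (tr (init y s)) (tr (θ * init y s))    ≈⟨ fromTraces-tr (init y s) ⟩
            init y s                                          ∎)
          , trans (sym (ι-κ _)) (trans (ι-cong (eq zero)) (ι-κ _))
        from : init x ≋ init y × herm x ≈ herm y → coordinates x K.≋ coordinates y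
        from (init≋ , herm≈) zero    = κ-cong herm≈
        from (init≋ , herm≈) (suc k) = splitAt-elim m (λ k → coordinates x (suc k) K.≈ coordinates y (suc k))
          (λ s → ι-injective (trans (ι-coordinateˡ x s) (trans (tr-cong (init≋ s)) (sym (ι-coordinateˡ y s)))))
          (λ s → ι-injective (trans (ι-coordinateʳ x s) (trans (tr-cong (*-congˡ (init≋ s))) (sym (ι-coordinateʳ y s))))) k

      N-orbit⇔coordinates : ∀ x y → N-orbit x y ⇔ coordinates x K.≋ coordinates y
      N-orbit⇔coordinates x y = mk⇔
        (Equivalence.from (coordinates⇔ x y) ∘ Equivalence.to (N-orbit⇔ x y))
        (Equivalence.from (N-orbit⇔ x y) ∘ Equivalence.to (coordinates⇔ x y))

      fromCoordinates : Vector K.Carrier d → AG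
      fromCoordinates v = withHerm (λ s → fromTraces (ι (v (suc (s ↑ˡ m)))) (ι (v (suc (m ↑ʳ s))))) (ι (head v))

      coordinates-fromCoordinates : ∀ v → coordinates (fromCoordinates v) K.≋ v
      coordinates-fromCoordinates v zero = ι-injective (trans (ι-κ _) (herm-withHerm _ (ι-fixed (head v))))
      coordinates-fromCoordinates v (suc k) = splitAt-elim m (λ k → coordinates (fromCoordinates v) (suc k) K.≈ v (suc k))
        (λ s → ι-injective (trans (ι-coordinateˡ x s) (trans (tr-cong (init≈ s)) (tr-fromTraces (ι-fixed _) (ι-fixed _)))))
        (λ s → ι-injective (trans (ι-coordinateʳ x s) (trans (tr-cong (*-congˡ (init≈ s))) (trθ-fromTraces (ι-fixed _) (ι-fixed _))))) k
        where
        x : AG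
        x = fromCoordinates v
        x′ : Vector Carrier m
        x′ s = fromTraces (ι (v (suc (s ↑ˡ m)))) (ι (v (suc (m ↑ʳ s))))
        init≈ : ∀ s → init x s ≈ x′ s
        init≈ s = reflexive (init-∷ʳ x′ (withTrace (ι (head v) - norms x′)) s)

      -- Weights b, b′ in K on the coordinates tr xₛ and tr (θxₛ) combine, by linearity of the trace
      -- over K, to tr ((b + b′θ) xₛ). The entries of a normal are thus the coordinates of the slope
      -- in the basis 1, θ.
      slopeOf : Vector K.Carrier d → Vector Carrier m
      slopeOf α s = ι (α (suc (s ↑ˡ m))) + ι (α (suc (m ↑ʳ s))) * θ

      normal : K.Carrier → Vector Carrier m → Vector K.Carrier d
      normal α₀ a = α₀ ∷ (λ s → κ (coord₀-fixed (a s))) ++ (λ s → κ (coord₁-fixed (a s)))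

      slopeOf-normal : ∀ α₀ a → slopeOf (normal α₀ a) ≋ a
      slopeOf-normal α₀ a s = trans (+-cong
        (trans (ι-cong (K.reflexive (lookup-++ˡ (λ s → κ (coord₀-fixed (a s))) _ s))) (ι-κ _))
        (*-congʳ (trans (ι-cong (K.reflexive (lookup-++ʳ (λ s → κ (coord₀-fixed (a s))) _ s))) (ι-κ _)))) (coords (a s))

      slopeOf-𝟎 : ∀ {α} → α K.≋ K.𝟎 → slopeOf α ≋ 𝟎
      slopeOf-𝟎 α≋𝟎 s = trans (+-cong (trans (ι-cong (α≋𝟎 _)) ι-0) (trans (*-congʳ (trans (ι-cong (α≋𝟎 _)) ι-0)) (zeroˡ θ))) (+-identityʳ 0#)

      -- By independence of 1 and θ over K. It ensures that a hyperplane whose equation omits h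
      -- gives a cone with ω ≠ 0.
      slopeOf≋𝟎⇒≋𝟎 : ∀ {α} → head α K.≈ K.0# → slopeOf α ≋ 𝟎 → α K.≋ K.𝟎
      slopeOf≋𝟎⇒≋𝟎 α₀≈0 a≋𝟎 zero = α₀≈0
      slopeOf≋𝟎⇒≋𝟎 {α} α₀≈0 a≋𝟎 (suc k) = splitAt-elim m (λ k → α (suc k) K.≈ K.0#)
        (λ s → ι-injective (trans (proj₁ (indep s)) (sym ι-0)))
        (λ s → ι-injective (trans (proj₂ (indep s)) (sym ι-0))) k
        where
        indep : ∀ s → ι (α (suc (s ↑ˡ m))) ≈ 0# × ι (α (suc (m ↑ʳ s))) ≈ 0#
        indep s = coords-independent (ι-fixed _) (ι-fixed _) (a≋𝟎 s)

      ι-∙-coordinates : ∀ α x → ι (α KD.∙ coordinates x) ≈ ι (head α) * herm x + tr (slopeOf α ∙ init x)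
      ι-∙-coordinates α x = begin
        ι (α KD.∙ coordinates x)
          ≈⟨ trans (ι-+ _ _) (+-cong (trans (ι-* _ _) (*-congˡ (ι-κ _))) (ι-sum t)) ⟩
        ι (head α) * herm x + sum (ι ∘ t)
          ≈⟨ +-congˡ (trans (sum-++ m (ι ∘ t)) (sym (∑-distrib-+ (λ s → ι (t (s ↑ˡ m))) (λ s → ι (t (m ↑ʳ s)))))) ⟩
        ι (head α) * herm x + sum (λ s → ι (t (s ↑ˡ m)) + ι (t (m ↑ʳ s)))
          ≈⟨ +-congˡ (sum-cong-≋ term) ⟩
        ι (head α) * herm x + sum (λ s → tr (slopeOf α s * init x s))
          ≈⟨ +-congˡ (tr-sum (λ s → slopeOf α s * init x s)) ⟨
        ι (head α) * herm x + tr (slopeOf α ∙ init x)  ∎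
        where
        t : Vector K.Carrier (m ℕ.+ m)
        t k = α (suc k) K.* coordinates x (suc k)
        term : ∀ s → ι (t (s ↑ˡ m)) + ι (t (m ↑ʳ s)) ≈ tr (slopeOf α s * init x s)
        term s = begin
          ι (t (s ↑ˡ m)) + ι (t (m ↑ʳ s))
            ≈⟨ +-cong (trans (ι-* _ _) (*-congˡ (ι-coordinateˡ x s))) (trans (ι-* _ _) (*-congˡ (ι-coordinateʳ x s))) ⟩
          a₀ * tr (init x s) + a₁ * tr (θ * init x s)
            ≈⟨ +-cong (tr-fixed-* (init x s) (ι-fixed _)) (tr-fixed-* (θ * init x s) (ι-fixed _)) ⟨
          tr (a₀ * init x s) + tr (a₁ * (θ * init x s))   ≈⟨ tr-+ _ _ ⟨
          tr (a₀ * init x s + a₁ * (θ * init x s))        ≈⟨ tr-cong (solve 4 (λ a b t x → a :* x :+ b :* (t :* x) := (a :+ b :* t) :* x) refl a₀ a₁ θ (init x s)) ⟩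
          tr (slopeOf α s * init x s)                   ∎
          where
          a₀ a₁ : Carrier
          a₀ = ι (α (suc (s ↑ˡ m)))
          a₁ = ι (α (suc (m ↑ʳ s)))

      LevelSet⇔Plane : ∀ α β y → LevelSet (ι (head α)) (slopeOf α) (ι β) y ⇔ KD.Plane α β (coordinates y)
      LevelSet⇔Plane α β y = mk⇔
        (λ eq → ι-injective (trans (ι-∙-coordinates α y) eq))
        (λ eq → trans (sym (ι-∙-coordinates α y)) (ι-cong eq))

      LevelSet⇔Plane-normal : ∀ {α₀ β₀} a {β} (fβ : Fixed β) → ι α₀ ≈ β₀ → ∀ y →
                           LevelSet β₀ a β y ⇔ KD.Plane (normal α₀ a) (κ fβ) (coordinates y)
      LevelSet⇔Plane-normal {α₀} a fβ ια₀≈ y =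
        LevelSet-cong (sym ια₀≈) (≋.sym (slopeOf-normal α₀ a)) (sym (ι-κ fβ)) y ⨾ LevelSet⇔Plane (normal α₀ a) (κ fβ) y

      normal≉𝟎 : ∀ α₀ {a} → ¬ a ≋ 𝟎 → ¬ normal α₀ a K.≋ K.𝟎
      normal≉𝟎 α₀ {a} a≉𝟎 eq = a≉𝟎 (≋.trans (≋.sym (slopeOf-normal α₀ a)) (slopeOf-𝟎 {normal α₀ a} eq))

      normal≉𝟎₀ : ∀ {α₀} a → ¬ α₀ K.≈ K.0# → ¬ normal α₀ a K.≋ K.𝟎
      normal≉𝟎₀ a α₀≉0 eq = α₀≉0 (eq zero)

      ≐-⇔ : ∀ {r r′ r″} {A : Pred AG r} {B : Pred AG r′} {C : Pred AG r″} → A ≐ B → (∀ y → B y ⇔ C y) → ∀ y → A y ⇔ C y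
      ≐-⇔ (A⊆B , B⊆A) B⇔C y = mk⇔ (Equivalence.to (B⇔C y) ∘ A⊆B) (B⊆A ∘ Equivalence.from (B⇔C y))

      levelSet⇒plane : ∀ {r} {B : Pred AG r} α₀ {β₀ a β} → ι α₀ ≈ β₀ → Fixed β → ¬ normal α₀ a K.≋ K.𝟎 →
                       (∀ y → B y ⇔ LevelSet β₀ a β y) →
                       ∃₂ λ α β → ¬ α K.≋ K.𝟎 × (∀ y → B y ⇔ KD.Plane α β (coordinates y))
      levelSet⇒plane α₀ {β₀} {a} ια₀≈ fβ normal≉𝟎 B⇔LevelSet =
        normal α₀ a , κ fβ , normal≉𝟎 , λ y → B⇔LevelSet y ⨾ LevelSet⇔Plane-normal {α₀} {β₀} a fβ ια₀≈ y

      block⇒plane : (B : ∃ IsBlock) → ∃₂ λ α β → ¬ α K.≋ K.𝟎 × (∀ y → proj₁ B y ⇔ KD.Plane α β (coordinates y))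
      block⇒plane (B , g , inj₁ B≐) =
        levelSet⇒plane K.1# {1#} {slope (G.i g) (G.j g)} { - herm (G.i g)} ι-1
          (Fixed-neg {herm (G.i g)} (herm-fixed (G.i g)))
          (normal≉𝟎₀ (slope (G.i g) (G.j g)) (λ 1≈0 → Field.0≉1 K (K.sym 1≈0)))
          (≐-⇔ B≐ (Hermitian-image g))
      block⇒plane (B , g , inj₂ (ω , ω≉𝟎 , B≐)) =
        levelSet⇒plane K.0# {0#} {δω} { - tr (δω ∙ init (G.i g))} ι-0
          (Fixed-neg {tr (δω ∙ init (G.i g))} (tr-fixed (δω ∙ init (G.i g))))
          (normal≉𝟎 K.0# (λ δω≋𝟎 → ω≉𝟎 λ s → xy≈0⇒y≈0 δ≉0 (δω≋𝟎 s)))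
          (≐-⇔ B≐ (Cone-image g ω))
        where
        δω : Vector Carrier m
        δω s = δ * ω s

      -- The head of the normal is the coefficient of h: it decides between an image of the
      -- Hermitian variety and an image of a cone, and finiteness of K makes the test possible.
      plane⇒block : ∀ α β → ¬ α K.≋ K.𝟎 → ∃ λ (B : ∃ IsBlock) → ∀ y → proj₁ B y ⇔ KD.Plane α β (coordinates y)
      plane⇒block α β α≉𝟎 = case FiniteFieldProperties._≟_ K cardK (head α) K.0# of λ
        { (no α₀≉0) →
            let g , image⇔LevelSet = Hermitian-realisation {ι (head α)} {ι β} (slopeOf α)
                  (λ ια₀≈0 → α₀≉0 (ι-injective (trans ια₀≈0 (sym ι-0)))) (ι-fixed (head α)) (ι-fixed β)
            in (image g Hermitian , g , inj₁ ≐-refl) ,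
               λ y → image⇔LevelSet y ⨾ LevelSet⇔Plane α β y
        ; (yes α₀≈0) →
            let g , ω , ω≉𝟎 , image⇔LevelSet = Cone-realisation {ι (head α)} {ι β} (slopeOf α)
                  (trans (ι-cong α₀≈0) ι-0) (λ a≋𝟎 → α≉𝟎 (slopeOf≋𝟎⇒≋𝟎 {α} α₀≈0 a≋𝟎)) (ι-fixed β)
            in (image g (Cone ω) , g , inj₂ (ω , ω≉𝟎 , ≐-refl)) ,
               λ y → image⇔LevelSet y ⨾ LevelSet⇔Plane α β y
        }

      𝒮≅AGDesign : 𝒮 q F m ≅ AGDesign K d
      𝒮≅AGDesign = coordinates⇒≅ q F m K d coordinates fromCoordinates coordinates-fromCoordinates
        N-orbit⇔coordinates block⇒plane plane⇒block

-- The parameters in terms of n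

open import Data.List using (map; sum; upTo)
open import Data.Nat using (ℕ; suc; _*_; _∸_; _^_; _≤_; _<_)
open import Data.Product using (_×_)

theorem4p1 : {c ℓ c′ ℓ′ : Level}
    (q : ℕ) → PrimePower q →
    (F : Field c ℓ) → HasOrder F (q ^ 2) →
    (m : ℕ) → let n = suc m in 2 ≤ n →
    Is2Design (𝒮 q F m)
    (q ^ (2 * n ∸ 1))
    (q ^ (2 * (n ∸ 1)))
    (sum (map (q ^_) (upTo (2 * n ∸ 2))))
    × IsAffine (𝒮 q F m) (q ^ (2 * n ∸ 3))
    × (2 < q → (K : Field c′ ℓ′) → HasOrder K q → K ↪ F →
    𝒮 q F m ≅ AGDesign K (2 * n ∸ 1))
theorem4p1 q primePower F card zero (s≤s ())
theorem4p1 q primePower F card m@(suc m′) _ =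
  ≡.subst₂ (λ i j → Is2Design (𝒮 q F m) (q ^ (i ∸ 1)) (q ^ j) (geometricSum q (i ∸ 2))) (≡.sym 2n≡3+d) (≡.sym 2m≡1+d)
    (≅-Is2Design 𝒮≅ (is2Design d)) ,
  ≡.subst (λ i → IsAffine (𝒮 q F m) (q ^ (i ∸ 3))) (≡.sym 2n≡3+d) (≅-IsAffine 𝒮≅ (isAffine d)) ,
  λ _ K cardK K↪F → ≡.subst (λ i → 𝒮 q F m ≅ AGDesign K (i ∸ 1)) (≡.sym 2n≡3+d)
    (𝒮≅AGDesign K cardK K↪F)
  where
  -- Chosen so that the dimension 1 + (m + m) is 2 + d by computation; after rewriting 2n to 3 + d
  -- and 2m to 1 + d, the truncated subtractions in the parameters compute as well.
  d = m′ ℕ.+ suc m′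
  open Conjugation F primePower card using (fixedField; fixedField-order; fixedField↪; module HermitianForm)
  open HermitianForm.OverSubfield m using (𝒮≅AGDesign)
  open AffineGeometry fixedField fixedField-order using (is2Design; isAffine)
  𝒮≅ = 𝒮≅AGDesign fixedField fixedField-order fixedField↪
  open +-*-Solver
  2n≡3+d : 2 * suc m ≡ 3 ℕ.+ d
  2n≡3+d = solve 1 (λ k → con 2 :* (con 2 :+ k) := con 3 :+ (k :+ (con 1 :+ k))) ≡.refl m′
  2m≡1+d : 2 * m ≡ 1 ℕ.+ d
  2m≡1+d = solve 1 (λ k → con 2 :* (con 1 :+ k) := con 1 :+ (k :+ (con 1 :+ k))) ≡.refl m′
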